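{- Let $p=5$, let $X$ be the one-vertex symmetric digraph with three inverse pairs of loops $s_i,\bar s_i$ ($i=0,1,2$), with voltage assignment $\alpha:E(X)\to\mathbb Z_5$ given by $\alpha(s_0)=1$, $\alpha(s_1)=\alpha(s_2)=0$, $\alpha(\bar s_i)=-\alpha(s_i)$, and let $U_n$ be the Grover transition matrix on the $n$-th layer $X_n$ of the tower. Put \[ P_5(A)=A^4-\tfrac73A^3+\tfrac{29}{9}A^2-\tfrac73A+1\in\mathbb Z_5[A]. \] Then $P_5(1)=\frac59$ and $P_5(-1)=\frac{89}{9}$, so $P_5$ is coprime to $A^2-1$. Moreover, \[ \mathcal R_{X,P_5}(T)=\frac{\Phi_5(z)^2}{81z^4},\qquad z=1+T, \] where $\Phi_5$ is the fifth cyclotomic polynomial. As a power series over $\mathbb Z_5$ it satisfies \[ \mu(\mathcal R_{X,P_5})=0,\qquad\lambda(\mathcal R_{X,P_5})=8 . \] Consequently, for $\zeta\in\mu_{5^\infty}$, $\mathcal R_{X,P_5}(\zeta-1)=0$ if and only if $\zeta$ is a primitive fifth root of unity (so the condition $\mathcal R_{X,P_5}(\zeta-1)\ne0$ for all $\zeta\in\mu_{5^\infty}$ fails). The roots of $P_5$ occur as eigenvalues of $U_n$ on every level containing the primitive fifth characters, in particular for every $n\ge1$.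
   Context: A symmetric digraph has directed edges with origin $o(e)$, terminus $t(e)$ and inversion $e\mapsto\bar e\ne e$; $d_v=\#\{e:o(e)=v\}$ and the Grover weight is $w(e)=2/d_{o(e)}$ (here $1/3$). $X_n$ has vertex set $V(X)\times\mathbb Z/5^n$ and edges $(e,g):(o(e),g)\to(t(e),g+\alpha(e))$, with inverse $(\bar e,g+\alpha(e))$. The Grover transition matrix $U_n$, indexed by the directed edges of $X_n$, has $(U_n)_{e,f}=\frac{2}{d_{t(f)}}-\delta_{f,\bar e}$ if $t(f)=o(e)$ and $0$ otherwise. The characters of level $n$ correspond to $\mu_{5^n}(\overline{\mathbb Q}_5)$, and $\mu_{5^\infty}=\bigcup_n\mu_{5^n}(\overline{\mathbb Q}_5)$; level $n$ contains the primitive fifth characters when $n\ge1$. Since $X$ has one vertex, its spectral polynomial is $\mathcal F_X(A,T)=A^2+1-\frac A3(z+z^{ -1}+4)$ with $z=1+T$. $\mathcal R_{X,P}(T)=\operatorname{Res}_A(\mathcal F_X(A,T),P(A))$, where $\operatorname{Res}_A(f,g)=\prod_ig(\alpha_i)$ for monic $f=\prod_i(A-\alpha_i)$ over an algebraically closed field; $\mathcal R_{X,P}(\zeta-1)$ is evaluation at $T=\zeta-1$. For nonzero $F=5^NF_0$ with $F_0\in\mathbb Z_5[[T]]$, $5\nmid F_0$: $\mu(F)=N$ and $\lambda(F)=\operatorname{ord}_{T}(\overline F_0)$, the $T$-adic order of the reduction $\overline F_0\in\mathbb F_5[[T]]$. -}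

module Defs where

open import Level using (Level; 0ℓ)
open import Algebra.Apartness.Bundles using (HeytingField)
open import Algebra.Bundles using (CommutativeRing)
open import Algebra.Bundles.Raw using (RawRing)
import Algebra.Definitions.RawSemiring as SemiringDefs
import Algebra.Morphism.Structures as Morphism
open import Data.Bool.Base using (Bool; true; false; not; if_then_else_)
import Data.Bool.Properties as Bool
open import Data.Fin.Base as Fin using (Fin; toℕ; fromℕ<)
open import Data.Fin.Patterns using (0F; 1F; 2F)
import Data.Fin.Properties as Fin
open import Data.Integer.Base as ℤ using (ℤ; +_; -[1+_]; 0ℤ; 1ℤ)
import Data.Integer.Properties as ℤ
open import Data.Integer.Divisibility.Signed as ℤ∣ using (_∣_; divides)
open import Data.Integer.DivMod using (_%ℕ_; _/ℕ_; n%ℕd<d; a≡a%ℕn+[a/ℕn]*n)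
open import Data.Integer.Tactic.RingSolver using (solve-∀)
open import Data.List.Base
  using (List; []; _∷_; [_]; _++_; map; foldr; filter; length; cartesianProduct; allFin)
open import Data.List.Membership.Propositional using (_∈_)
open import Data.List.Membership.Propositional.Properties
  using (∈-cartesianProduct⁺; ∈-allFin)
open import Data.List.Relation.Unary.All using ([]; _∷_)
open import Data.List.Relation.Unary.AllPairs using ([]; _∷_)
open import Data.List.Relation.Unary.Any using (here; there)
open import Data.List.Relation.Unary.Unique.Propositional using (Unique)
open import Data.List.Relation.Unary.Unique.Propositional.Properties
  using (cartesianProduct⁺; allFin⁺)
open import Data.Nat.Base as ℕ using (ℕ; zero; NonZero)
import Data.Nat.Divisibility as ℕ∣
import Data.Nat.Properties as ℕ
open import Data.Product.Base using (∃; _×_; _,_; proj₁; proj₂)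
open import Data.Product.Properties using (≡-dec)
open import Data.Rational.Base as ℚ using (ℚ; 0ℚ; 1ℚ)
open import Data.Sum.Base using (inj₁; inj₂)
open import Data.Unit.Base using (⊤; tt)
import Data.Unit.Properties as Unit
open import Relation.Binary.Definitions using (DecidableEquality)
open import Relation.Binary.PropositionalEquality
  using (_≡_; _≢_; refl; sym; trans; cong; cong₂; subst; module ≡-Reasoning)
open import Relation.Nullary using (¬_; does; contradiction)

private
  variable
    c ℓ : Level

-- A polynomial is its list of coefficients, constant term first; trailing
-- zeros are allowed, so equality compares coefficients.
module Polynomial (R : RawRing c ℓ) where
  open RawRing R

  Poly : Set c
  Poly = List Carrier

  coeff : Poly → ℕ → Carrier
  coeff []      _         = 0#
  coeff (a ∷ _) zero      = a
  coeff (_ ∷ p) (ℕ.suc n) = coeff p n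

  infix 4 _≋_
  _≋_ : Poly → Poly → Set ℓ
  p ≋ q = ∀ n → coeff p n ≈ coeff q n

  addₚ : Poly → Poly → Poly
  addₚ []      q       = q
  addₚ (a ∷ p) []      = a ∷ p
  addₚ (a ∷ p) (b ∷ q) = (a + b) ∷ addₚ p q

  mulₚ : Poly → Poly → Poly
  mulₚ []      _ = []
  mulₚ (a ∷ p) q = addₚ (map (a *_) q) (0# ∷ mulₚ p q)

  eval : Poly → Carrier → Carrier
  eval []      x = 0#
  eval (a ∷ p) x = a + x * eval p x

  polyRing : RawRing c ℓ
  polyRing = record
    { Carrier = Poly
    ; _≈_     = _≋_
    ; _+_     = addₚ
    ; _*_     = mulₚ
    ; -_      = map -_
    ; 0#      = []
    ; 1#      = [ 1# ]
    }

  -- ∏ᵢ (A - αᵢ)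
  fromRoots : List Carrier → Poly
  fromRoots = foldr (λ α p → mulₚ (- α ∷ 1# ∷ []) p) [ 1# ]

module PowerSeries (R : RawRing c ℓ) where
  open RawRing R

  Σ[i<_] : ℕ → (ℕ → Carrier) → Carrier
  Σ[i< zero    ] f = 0#
  Σ[i< ℕ.suc n ] f = Σ[i< n ] f + f n

  const : Carrier → (ℕ → Carrier)
  const a zero      = a
  const a (ℕ.suc _) = 0#

  T : ℕ → Carrier
  T 1 = 1#
  T _ = 0#

  seriesRing : RawRing c ℓ
  seriesRing = record
    { Carrier = ℕ → Carrier
    ; _≈_     = λ F G → ∀ n → F n ≈ G n
    ; _+_     = λ F G n → F n + G n
    ; _*_     = λ F G n → Σ[i< ℕ.suc n ] (λ i → F i * G (n ℕ.∸ i))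
    ; -_      = λ F n → - F n
    ; 0#      = λ _ → 0#
    ; 1#      = const 1#
    }

-- r = Res_A(f , g) for monic f: the product of the values of g at the roots
-- of f, computed in an extension over which f splits.  All commutative
-- extension rings L are allowed, in particular algebraically closed fields;
-- since every monic f splits over some extension ring, r is uniquely
-- determined, and no algebraic closure of Frac R has to be constructed.
IsResultant : (R : RawRing 0ℓ 0ℓ) (f g : List (RawRing.Carrier R)) →
              RawRing.Carrier R → Set₁
IsResultant R f g r =
  (L : CommutativeRing 0ℓ 0ℓ) →
  let open CommutativeRing L using (_≈_; _*_; 1#; rawRing)
      open Polynomial rawRing
  in
  (φ : RawRing.Carrier R → CommutativeRing.Carrier L) →
  Morphism.IsRingMonomorphism R rawRing φ →
  (αs : List (CommutativeRing.Carrier L)) →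
  map φ f ≋ fromRoots αs →
  φ r ≈ foldr (λ α y → eval (map φ g) α * y) 1# αs

5^ : ℕ → ℤ
5^ n = + (5 ℕ.^ n)

-- ℤ₅ = lim ℤ/5ⁿ: a coherent sequence of residues, each given by an integer
-- representative.
record ℤ₅ : Set where
  constructor mkℤ₅
  field
    residue  : ℕ → ℤ
    coherent : ∀ n → 5^ n ∣ residue (ℕ.suc n) ℤ.- residue n

open ℤ₅ public

private
  ∣-by : ∀ {k a b} → a ≡ b → k ∣ a → k ∣ b
  ∣-by refl d = d

fromℤ : ℤ → ℤ₅
fromℤ a = mkℤ₅ (λ _ → a) (λ n → divides 0ℤ (ℤ.+-inverseʳ a))

infix  4 _≈₅_
infixl 6 _+₅_
infixl 7 _*₅_

_≈₅_ : ℤ₅ → ℤ₅ → Set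
x ≈₅ y = ∀ n → 5^ n ∣ residue x n ℤ.- residue y n

_+₅_ : ℤ₅ → ℤ₅ → ℤ₅
x +₅ y = mkℤ₅ (λ n → residue x n ℤ.+ residue y n) λ n →
  ∣-by (lemma (residue x (ℕ.suc n)) (residue x n) (residue y (ℕ.suc n)) (residue y n))
       (ℤ∣.∣m∣n⇒∣m+n (coherent x n) (coherent y n))
  where
  lemma : ∀ a b d e → (a ℤ.- b) ℤ.+ (d ℤ.- e) ≡ (a ℤ.+ d) ℤ.- (b ℤ.+ e)
  lemma = solve-∀

_*₅_ : ℤ₅ → ℤ₅ → ℤ₅
x *₅ y = mkℤ₅ (λ n → residue x n ℤ.* residue y n) λ n →
  ∣-by (lemma (residue x (ℕ.suc n)) (residue x n) (residue y (ℕ.suc n)) (residue y n))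
       (ℤ∣.∣m∣n⇒∣m+n (ℤ∣.∣n⇒∣m*n (residue x (ℕ.suc n)) (coherent y n))
                     (ℤ∣.∣m⇒∣m*n (residue y n) (coherent x n)))
  where
  lemma : ∀ a b d e → a ℤ.* (d ℤ.- e) ℤ.+ (a ℤ.- b) ℤ.* e ≡ a ℤ.* d ℤ.- b ℤ.* e
  lemma = solve-∀

-₅_ : ℤ₅ → ℤ₅
-₅ x = mkℤ₅ (λ n → ℤ.- residue x n) λ n →
  ∣-by (lemma (residue x (ℕ.suc n)) (residue x n)) (ℤ∣.∣m⇒∣-m (coherent x n))
  where
  lemma : ∀ a b → ℤ.- (a ℤ.- b) ≡ ℤ.- a ℤ.- (ℤ.- b)
  lemma = solve-∀

ℤ₅-ring : RawRing 0ℓ 0ℓ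
ℤ₅-ring = record
  { Carrier = ℤ₅
  ; _≈_     = _≈₅_
  ; _+_     = _+₅_
  ; _*_     = _*₅_
  ; -_      = -₅_
  ; 0#      = fromℤ 0ℤ
  ; 1#      = fromℤ 1ℤ
  }

-- 1/3 = 2 / (1 - (-5)) = ∑ᵢ 2 (-5)ⁱ
⅓ : ℤ₅
⅓ = mkℤ₅ partial λ n → ∣-by (lemma (partial n) (term n)) (5^∣term n)
  where
  term : ℕ → ℤ
  term zero      = + 2
  term (ℕ.suc n) = -[1+ 4 ] ℤ.* term n

  partial : ℕ → ℤ
  partial zero      = 0ℤ
  partial (ℕ.suc n) = partial n ℤ.+ term n

  lemma : ∀ a b → b ≡ (a ℤ.+ b) ℤ.- a
  lemma = solve-∀

  5^∣term : ∀ n → 5^ n ∣ term n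
  5^∣term zero      = divides (+ 2) refl
  5^∣term (ℕ.suc n) with 5^∣term n
  ... | divides q eq = divides (ℤ.- q) (begin
    -[1+ 4 ] ℤ.* term n          ≡⟨ cong (-[1+ 4 ] ℤ.*_) eq ⟩
    -[1+ 4 ] ℤ.* (q ℤ.* 5^ n)    ≡⟨ shuffle q (5^ n) ⟩
    ℤ.- q ℤ.* (+ 5 ℤ.* 5^ n)     ≡⟨ cong (ℤ.- q ℤ.*_) (ℤ.pos-* 5 (5 ℕ.^ n)) ⟨
    ℤ.- q ℤ.* 5^ (ℕ.suc n)       ∎)
    where
    open ≡-Reasoning
    shuffle : ∀ a b → -[1+ 4 ] ℤ.* (a ℤ.* b) ≡ ℤ.- a ℤ.* (+ 5 ℤ.* b)
    shuffle = solve-∀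

⅑ : ℤ₅
⅑ = ⅓ *₅ ⅓

-- (x , k) stands for x / 5ᵏ.
ℚ₅ : Set
ℚ₅ = ℤ₅ × ℕ

fromℤ₅ : ℤ₅ → ℚ₅
fromℤ₅ x = x , 0

ℚ₅-ring : RawRing 0ℓ 0ℓ
ℚ₅-ring = record
  { Carrier = ℚ₅
  ; _≈_     = λ (x , k) (y , l) → fromℤ (5^ l) *₅ x ≈₅ fromℤ (5^ k) *₅ y
  ; _+_     = λ (x , k) (y , l) → fromℤ (5^ l) *₅ x +₅ fromℤ (5^ k) *₅ y , k ℕ.+ l
  ; _*_     = λ (x , k) (y , l) → x *₅ y , k ℕ.+ l
  ; -_      = λ (x , k) → -₅ x , k
  ; 0#      = fromℤ₅ (fromℤ 0ℤ)
  ; 1#      = fromℤ₅ (fromℤ 1ℤ)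
  }

-- A field is a Heyting field, whose apartness relation _#_ plays the role
-- of ≠.  The homomorphism fromℚ is determined by the field structure.
record AlgebraicClosureOfℚ₅ : Set₁ where
  field
    heytingField : HeytingField 0ℓ 0ℓ 0ℓ

  open HeytingField heytingField public
    using (Carrier; _≈_; _#_; _+_; _*_; -_; _-_; 0#; 1#)

  ring : RawRing 0ℓ 0ℓ
  ring = record
    { Carrier = Carrier ; _≈_ = _≈_ ; _+_ = _+_ ; _*_ = _*_
    ; -_ = -_ ; 0# = 0# ; 1# = 1# }

  open Polynomial ring public using (Poly; eval)
  open PowerSeries ring public using (Σ[i<_])
  open SemiringDefs (RawRing.rawSemiring ring) public using (_^_)

  field
    fromℚ₅           : ℚ₅ → Carrier
    fromℚ₅-mono      : Morphism.IsRingMonomorphism ℚ₅-ring ring fromℚ₅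
    fromℚ            : ℚ → Carrier
    fromℚ-homo       : Morphism.IsRingHomomorphism ℚ.+-*-rawRing ring fromℚ
    algebraic        : ∀ x → ∃ λ (as : List ℚ₅) →
                       eval (map fromℚ₅ (as ++ [ RawRing.1# ℚ₅-ring ])) x ≈ 0#
    algebraicallyClosed : ∀ a (as : List Carrier) →
                       ∃ λ x → eval (a ∷ as ++ [ 1# ]) x ≈ 0#

  ι : ℤ₅ → Carrier
  ι x = fromℚ₅ (fromℤ₅ x)

  μ[_] : ℕ → Carrier → Set
  μ[ N ] ζ = ζ ^ N ≈ 1#

  μ5^∞ : Carrier → Set
  μ5^∞ ζ = ∃ λ n → μ[ 5 ℕ.^ n ] ζ

  PrimitiveRoot : ℕ → Carrier → Set
  PrimitiveRoot N ζ = μ[ N ] ζ × (∀ j → 0 ℕ.< j → j ℕ.< N → ¬ μ[ j ] ζ)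

  -- The characters of ℤ/5ⁿ correspond to their values at 1, i.e. to μ[ 5ⁿ ].
  ContainsPrimitiveFifthCharacters : ℕ → Set
  ContainsPrimitiveFifthCharacters n = ∃ λ ζ → μ[ 5 ℕ.^ n ] ζ × PrimitiveRoot 5 ζ

  IsRoot : List ℤ₅ → Carrier → Set
  IsRoot p a = eval (map ι p) a ≈ 0#

  -- F(x) = v: the partial sums of F at x converge to v in the 5-adic
  -- topology of ℤ₅[x].  For x = ζ - 1 with ζ ∈ μ5^∞ the ring ℤ₅[x] = ℤ₅[ζ]
  -- is a finite ℤ₅-module, so this is the topology of the absolute value.
  _⟨_⟩≈_ : (ℕ → ℤ₅) → Carrier → Carrier → Set
  F ⟨ x ⟩≈ v =
    ∀ m → ∃ λ M₀ → ∀ M → M₀ ℕ.≤ M → ∃ λ (as : List ℤ₅) →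
      v - Σ[i< M ] (λ i → ι (F i) * x ^ i) ≈ ι (fromℤ (5^ m)) * eval (map ι as) x

Λ : RawRing 0ℓ 0ℓ
Λ = PowerSeries.seriesRing ℤ₅-ring

open PowerSeries ℤ₅-ring using (const; T)
module Λ = RawRing Λ
open SemiringDefs Λ.rawSemiring using (_^_) renaming (_∤_ to _∤Λ_)

private
  nonZero-5^ : ∀ n → NonZero (5 ℕ.^ n)
  nonZero-5^ n = ℕ.m^n≢0 5 n

mod5^ : ∀ n → ℤ → Fin (5 ℕ.^ n)
mod5^ n a = fromℕ< (n%ℕd<d a (5 ℕ.^ n) {{nonZero-5^ n}})

-- Coefficientwise reduction ℤ₅[[T]] → 𝔽₅[[T]].
reduction : Λ.Carrier → (ℕ → Fin 5)
reduction F i = mod5^ 1 (residue (F i) 1)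

IsOrder : (ℕ → Fin 5) → ℕ → Set
IsOrder G l = (∀ i → i ℕ.< l → G i ≡ 0F) × G l ≢ 0F

IsDecomposition : Λ.Carrier → ℕ → Λ.Carrier → Set
IsDecomposition F N F₀ =
  F Λ.≈ const (fromℤ (5^ N)) Λ.* F₀ × const (fromℤ (+ 5)) ∤Λ F₀

μ-invariant : Λ.Carrier → ℕ → Set
μ-invariant F N = ∃ λ F₀ → IsDecomposition F N F₀

λ-invariant : Λ.Carrier → ℕ → Set
λ-invariant F l = ∃ λ N → ∃ λ F₀ → IsDecomposition F N F₀ × IsOrder (reduction F₀) l

record SymmetricDigraph : Set₁ where
  field
    V E             : Set
    _≟ᵥ_            : DecidableEquality V
    _≟ₑ_            : DecidableEquality E
    edges           : List E
    edges-unique    : Unique edges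
    edges-complete  : ∀ e → e ∈ edges
    o t             : E → V
    bar             : E → E
    bar-involutive  : ∀ e → bar (bar e) ≡ e
    bar-≢           : ∀ e → bar e ≢ e
    o-bar           : ∀ e → o (bar e) ≡ t e

  degree : V → ℕ
  degree v = length (filter (λ e → o e ≟ᵥ v) edges)

module _ (X : SymmetricDigraph) where
  open SymmetricDigraph X

  record Voltage : Set where
    field
      α     : E → ℤ₅
      α-bar : ∀ e → α (bar e) ≈₅ -₅ α e

  -- The value at 0 is irrelevant: degree (t f) ≥ 1 because of bar f.
  2/_ : ℕ → ℚ
  2/ zero    = 0ℚ
  2/ ℕ.suc d = + 2 ℚ./ ℕ.suc d

  Grover : E → E → ℚ
  Grover e f =
    if does (t f ≟ᵥ o e)
    then 2/ degree (t f) ℚ.- (if does (f ≟ₑ bar e) then 1ℚ else 0ℚ)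
    else 0ℚ

module _ (n : ℕ) where
  private
    N : ℕ
    N = 5 ℕ.^ n

    instance
      nonZero-N : NonZero N
      nonZero-N = nonZero-5^ n

  infixl 6 _⊞_
  _⊞_ : Fin N → ℤ₅ → Fin N
  g ⊞ x = mod5^ n (+ toℕ g ℤ.+ residue x n)

  private
    ≤-unique : ∀ a b → a ℕ.≤ b → b ℕ.< N → + N ∣ + a ℤ.- + b → a ≡ b
    ≤-unique a b a≤b b<N N∣a-b = ℕ.≤-antisym a≤b (ℕ.m∸n≡0⇒m≤n (small _ b∸a<N N∣b∸a))
      where
      b∸a<N : b ℕ.∸ a ℕ.< N
      b∸a<N = ℕ.≤-<-trans (ℕ.m∸n≤m b a) b<N

      N∣b∸a : N ℕ∣.∣ b ℕ.∸ a
      N∣b∸a = subst (N ℕ∣.∣_)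
        (trans (cong ℤ.∣_∣ (ℤ.m-n≡m⊖n a b)) (ℤ.∣⊖∣-≤ a≤b)) (ℤ∣.∣⇒∣ᵤ N∣a-b)

      small : ∀ d → d ℕ.< N → N ℕ∣.∣ d → d ≡ 0
      small zero      _   _   = refl
      small (ℕ.suc d) d<N N∣d = contradiction N∣d (ℕ∣.>⇒∤ d<N)

    <-unique : ∀ a b → a ℕ.< N → b ℕ.< N → + N ∣ + a ℤ.- + b → a ≡ b
    <-unique a b a<N b<N N∣a-b with ℕ.≤-total a b
    ... | inj₁ a≤b = ≤-unique a b a≤b b<N N∣a-b
    ... | inj₂ b≤a = sym (≤-unique b a b≤a a<N
                       (∣-by (lemma (+ a) (+ b)) (ℤ∣.∣m⇒∣-m N∣a-b)))
      where
      lemma : ∀ a b → ℤ.- (a ℤ.- b) ≡ b ℤ.- a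
      lemma = solve-∀

    toℕ-mod : ∀ a → + N ∣ a ℤ.- + toℕ (mod5^ n a)
    toℕ-mod a = divides (a /ℕ N) (begin
      a ℤ.- + toℕ (mod5^ n a)   ≡⟨ cong (λ r → a ℤ.- + r) (Fin.toℕ-fromℕ< (n%ℕd<d a N)) ⟩
      a ℤ.- + r                 ≡⟨ cong (ℤ._- + r) (a≡a%ℕn+[a/ℕn]*n a N) ⟩
      + r ℤ.+ q ℤ.* + N ℤ.- + r ≡⟨ cancel (+ r) (q ℤ.* + N) ⟩
      q ℤ.* + N                 ∎)
      where
      open ≡-Reasoning
      r = a %ℕ N
      q = a /ℕ N
      cancel : ∀ a b → a ℤ.+ b ℤ.- a ≡ b
      cancel = solve-∀

  ⊞-inverse : ∀ g x y → y ≈₅ -₅ x → g ⊞ x ⊞ y ≡ g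
  ⊞-inverse g x y y≈-x = Fin.toℕ-injective
    (<-unique _ _ (Fin.toℕ<n (g ⊞ x ⊞ y)) (Fin.toℕ<n g)
      (∣-by (combine (+ toℕ g) (residue x n) (residue y n)
                     (+ toℕ (g ⊞ x)) (+ toℕ (g ⊞ x ⊞ y)))
        (ℤ∣.∣m∣n⇒∣m-n (y≈-x n)
          (ℤ∣.∣m∣n⇒∣m+n (toℕ-mod (+ toℕ g ℤ.+ residue x n))
                         (toℕ-mod (+ toℕ (g ⊞ x) ℤ.+ residue y n))))))
    where
    combine : ∀ g x y h k →
      (y ℤ.- (ℤ.- x)) ℤ.- ((g ℤ.+ x ℤ.- h) ℤ.+ (h ℤ.+ y ℤ.- k)) ≡ k ℤ.- g
    combine = solve-∀

  Layer : (X : SymmetricDigraph) → Voltage X → SymmetricDigraph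
  Layer X voltage = record
    { V              = V × Fin N
    ; E              = E × Fin N
    ; _≟ᵥ_           = ≡-dec _≟ᵥ_ Fin._≟_
    ; _≟ₑ_           = ≡-dec _≟ₑ_ Fin._≟_
    ; edges          = cartesianProduct edges (allFin N)
    ; edges-unique   = cartesianProduct⁺ edges-unique (allFin⁺ N)
    ; edges-complete = λ (e , g) → ∈-cartesianProduct⁺ (edges-complete e) (∈-allFin g)
    ; o              = λ (e , g) → o e , g
    ; t              = λ (e , g) → t e , g ⊞ α e
    ; bar            = λ (e , g) → bar e , g ⊞ α e
    ; bar-involutive = λ (e , g) →
        cong₂ _,_ (bar-involutive e) (⊞-inverse g (α e) (α (bar e)) (α-bar e))
    ; bar-≢          = λ (e , g) eq → bar-≢ e (cong proj₁ eq)
    ; o-bar          = λ (e , g) → cong (_, g ⊞ α e) (o-bar e)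
    }
    where
    open SymmetricDigraph X
    open Voltage voltage

module _ (Ω : AlgebraicClosureOfℚ₅) where
  open AlgebraicClosureOfℚ₅ Ω

  IsEigenvalueOfGrover : SymmetricDigraph → Carrier → Set
  IsEigenvalueOfGrover X a = ∃ λ (v : E → Carrier) →
    (∃ λ e → v e # 0#) ×
    (∀ e → foldr (λ f y → fromℚ (Grover X e f) * v f + y) 0# edges ≈ a * v e)
    where open SymmetricDigraph X

-- (i , false) is the loop sᵢ and (i , true) its inverse.
bouquet : SymmetricDigraph
bouquet = record
  { V              = ⊤
  ; E              = Fin 3 × Bool
  ; _≟ᵥ_           = Unit._≟_
  ; _≟ₑ_           = ≡-dec Fin._≟_ Bool._≟_
  ; edges          = cartesianProduct (allFin 3) (false ∷ true ∷ [])
  ; edges-unique   = cartesianProduct⁺ (allFin⁺ 3) (((λ ()) ∷ []) ∷ [] ∷ [])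
  ; edges-complete = λ (i , b) → ∈-cartesianProduct⁺ (∈-allFin i) (bool b)
  ; o              = λ _ → tt
  ; t              = λ _ → tt
  ; bar            = λ (i , b) → i , not b
  ; bar-involutive = λ (i , b) → cong (i ,_) (Bool.not-involutive b)
  ; bar-≢          = λ (i , b) eq → Bool.not-¬ refl (sym (cong proj₂ eq))
  ; o-bar          = λ _ → refl
  }
  where
  bool : ∀ b → b ∈ false ∷ true ∷ []
  bool false = here refl
  bool true  = there (here refl)

bouquetVoltage : Voltage bouquet
bouquetVoltage = record { α = α ; α-bar = α-bar }
  where
  αₛ : Fin 3 → ℤ₅
  αₛ 0F = fromℤ 1ℤ
  αₛ 1F = fromℤ 0ℤ
  αₛ 2F = fromℤ 0ℤ

  α : Fin 3 × Bool → ℤ₅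
  α (i , false) = αₛ i
  α (i , true)  = -₅ αₛ i

  α-bar : ∀ ((i , b) : Fin 3 × Bool) → α (i , not b) ≈₅ -₅ α (i , b)
  α-bar (i , false) n = divides 0ℤ (ℤ.+-inverseʳ (residue (-₅ α (i , false)) n))
  α-bar (i , true)  n = divides 0ℤ (lemma (residue (α (i , false)) n))
    where
    lemma : ∀ a → a ℤ.- (ℤ.- (ℤ.- a)) ≡ 0ℤ
    lemma = solve-∀

bouquetLayer : ℕ → SymmetricDigraph
bouquetLayer n = Layer n bouquet bouquetVoltage

P₅ : List ℤ₅
P₅ = fromℤ 1ℤ
   ∷ -₅ (fromℤ (+ 7) *₅ ⅓)
   ∷ fromℤ (+ 29) *₅ ⅑
   ∷ -₅ (fromℤ (+ 7) *₅ ⅓)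
   ∷ fromℤ 1ℤ
   ∷ []

A²-1 : List ℤ₅
A²-1 = -₅ fromℤ 1ℤ ∷ fromℤ 0ℤ ∷ fromℤ 1ℤ ∷ []

Coprimeℚ₅[A] : (f g : List ℤ₅) → Set
Coprimeℚ₅[A] f g = SemiringDefs.Coprime
  (RawRing.rawSemiring (Polynomial.polyRing ℚ₅-ring)) (map fromℤ₅ f) (map fromℤ₅ g)

z : Λ.Carrier
z = Λ.1# Λ.+ T

-- (1 + T)⁻¹ = ∑ᵢ (-T)ⁱ
z⁻¹ : Λ.Carrier
z⁻¹ zero      = fromℤ 1ℤ
z⁻¹ (ℕ.suc i) = -₅ z⁻¹ i

-- F_X(A,T) = A² + 1 - (A/3)(z + z⁻¹ + 4) as a polynomial in A over ℤ₅[[T]]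
F-X : List Λ.Carrier
F-X = Λ.1#
    ∷ Λ.- (const ⅓ Λ.* (z Λ.+ z⁻¹ Λ.+ const (fromℤ (+ 4))))
    ∷ Λ.1#
    ∷ []

Φ₅ : Λ.Carrier → Λ.Carrier
Φ₅ x = Λ.1# Λ.+ x Λ.+ x ^ 2 Λ.+ x ^ 3 Λ.+ x ^ 4

-- R is the resultant ℛ_{X,P}(T) = Res_A(F_X(A,T) , P(A)).
Is-R-X : (P : List ℤ₅) (R : Λ.Carrier) → Set₁
Is-R-X P R = IsResultant Λ F-X (map const P) R

Φ₅²/81z⁴ : Λ.Carrier
Φ₅²/81z⁴ = const (⅑ *₅ ⅑) Λ.* Φ₅ z ^ 2 Λ.* z⁻¹ ^ 4

{-# OPTIONS --safe #-}

-- A root α of A² - sA + 1 satisfies P₅(α) = α² Q(s), where s = (z + z⁻¹ + 4)/3 gives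
-- Q(s) = Φ₅(z)/(9z²); the two roots have product 1, which yields the resultant.
--
-- If its value at ζ - 1 is 0, then Φ₅(ζ)² ∈ 5ᵐℤ₅[ζ] for all m.  Were ζ of 5-power order
-- different from 5, this would make 5 a unit of ℤ₅[ζ], contradicting Nakayama's lemma.
--
-- Over a primitive fifth root of unity ω, P₅(A) = F_X(A, ω - 1) F_X(A, ω² - 1), so every root a
-- of P₅ satisfies F_X(a, ζ - 1) = 0 for ζ = ω or ω².  Then v(e , g) = ζᵍ(a - ζ^α(e)) is an
-- eigenvector on each layer of level n ≥ 1.

module Submission where

open import Defs
open import Algebra.Apartness.Bundles using (HeytingField; HeytingCommutativeRing)
open import Algebra.Bundles using (CommutativeRing)
open import Algebra.Bundles.Raw using (RawRing)
import Algebra.Definitions.RawMagma as RawMagma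
import Algebra.Definitions.RawSemiring as SemiringDefs
import Algebra.Morphism.Structures as Morphism
import Algebra.Properties.CommutativeSemigroup as CommutativeSemigroup
import Algebra.Properties.Ring as RingProperties
import Algebra.Properties.Semiring.Exp as Exp
import Algebra.Solver.Ring
open import Algebra.Solver.Ring.AlmostCommutativeRing
  using (_-Raw-AlmostCommutative⟶_; fromCommutativeRing)
open import Data.Bool.Base using (true; false; if_then_else_)
open import Data.Fin.Base as Fin using (Fin; toℕ)
open import Data.Fin.Patterns using (0F; 1F; 2F)
import Data.Fin.Properties as Fin
open import Data.Integer.Base as ℤ using (ℤ; +_; -[1+_]; 0ℤ; 1ℤ)
open import Data.Integer.DivMod using (_%ℕ_; _/ℕ_; n%ℕd<d; a≡a%ℕn+[a/ℕn]*n)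
open import Data.Integer.Divisibility.Signed as ℤ∣ using (_∣_; divides; _∣?_)
import Data.Integer.Properties as ℤ
open import Data.Integer.Tactic.RingSolver using (solve-∀)
open import Data.List.Base
  using (List; []; _∷_; [_]; map; length; foldr; _++_; filter; cartesianProduct; allFin)
open import Data.List.Membership.Propositional using (_∈_)
open import Data.List.Membership.Propositional.Properties using (∈-allFin)
import Data.List.Properties as List
open import Data.List.Relation.Unary.All as All using (All; []; _∷_)
open import Data.List.Relation.Unary.AllPairs using ([]; _∷_)
open import Data.List.Relation.Unary.Any using (here; there)
open import Data.List.Relation.Unary.Unique.Propositional using (Unique)
open import Data.List.Relation.Unary.Unique.Propositional.Properties using (allFin⁺)
open import Data.Maybe.Base using (Maybe; just; nothing)
open import Data.Nat.Base as ℕ using (ℕ; zero; suc; NonZero; _≤_)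
import Data.Nat.DivMod as ℕ
import Data.Nat.Divisibility as ℕ∣
import Data.Nat.Properties as ℕ
open import Data.Product.Base using (∃; _×_; _,_; proj₁; proj₂)
open import Data.Rational.Base as ℚ using (ℚ; 0ℚ; 1ℚ)
open import Data.Sum.Base using (_⊎_; inj₁; inj₂)
open import Data.Unit.Base using (tt)
open import Function.Base using (_∘_)
open import Function.Bundles using (_⇔_; mk⇔)
open import Level using (Level; 0ℓ)
open import Relation.Binary.PropositionalEquality as ≡ using (_≡_; _≢_; cong; cong₂)
import Relation.Binary.Reasoning.Setoid as ≈-Reasoning
open import Relation.Binary.Structures using (IsEquivalence)
open import Relation.Nullary using (¬_; yes; no; contradiction; Dec; does)
open import Relation.Nullary.Decidable using (from-yes; from-no; dec-true; dec-false)
open import Relation.Unary using (Pred; Decidable)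

-- Commutative rings and the ring ℤ₅

-- `P₅` comes from the quadratic periods: for a primitive fifth root of unity ω the numbers ω + ω⁻¹
-- and ω² + ω⁻² are the roots of c² + c - 1, and multiplying F_X over these two values of c = z +
-- z⁻¹ gives a palindromic quartic with rational coefficients. Written in z, the same quadratic is
-- Φ₅(z)/z². Each of the two roots of F_X contributes it once to the resultant, which is why Φ₅
-- appears squared.
--
-- The resultant is given by a property quantified over all rings in which F_X splits. Existence
-- therefore means checking the value for every splitting, and uniqueness calls for one explicit
-- splitting ring.
--
-- Equality in Ω cannot be decided. Equations are drawn from tightness of the apartness relation,
-- and the choice between ω and ω² from its cotransitivity.
--
-- Values of series are limits modulo 5ᵐℤ₅[ζ], and it is left open whether these ideals intersect in
-- 0. A value 0 is thus exploited at fixed m only: m = 1 forces ζ⁵ = 1, and m = 3 excludes ζ = 1,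
-- where Φ₅(ζ)² = 25.

private
  variable
    c ℓ : Level

-- The laws are stated over a raw ring, so that the concrete rings ℤ₅, ℚ₅ and Λ can be used as
-- they are defined.
record IsCRing {c ℓ} (R : RawRing c ℓ) : Set (c Level.⊔ ℓ) where
  open RawRing R
  field
    isEquivalence : IsEquivalence _≈_
    +-cong        : ∀ {x y u v} → x ≈ y → u ≈ v → x + u ≈ y + v
    *-cong        : ∀ {x y u v} → x ≈ y → u ≈ v → x * u ≈ y * v
    -‿cong        : ∀ {x y} → x ≈ y → - x ≈ - y
    +-assoc       : ∀ x y z → (x + y) + z ≈ x + (y + z)
    +-comm        : ∀ x y → x + y ≈ y + x
    +-identityˡ   : ∀ x → 0# + x ≈ x
    -‿inverseˡ    : ∀ x → (- x) + x ≈ 0#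
    *-assoc       : ∀ x y z → (x * y) * z ≈ x * (y * z)
    *-comm        : ∀ x y → x * y ≈ y * x
    *-identityˡ   : ∀ x → 1# * x ≈ x
    distribˡ      : ∀ x y z → x * (y + z) ≈ x * y + x * z

  open IsEquivalence isEquivalence

  commutativeRing : CommutativeRing c ℓ
  commutativeRing = record
    { Carrier = Carrier ; _≈_ = _≈_ ; _+_ = _+_ ; _*_ = _*_ ; -_ = -_ ; 0# = 0# ; 1# = 1#
    ; isCommutativeRing = record
      { isRing = record
        { +-isAbelianGroup = record
          { isGroup = record
            { isMonoid = record
              { isSemigroup = record
                { isMagma = record { isEquivalence = isEquivalence ; ∙-cong = +-cong }
                ; assoc = +-assoc
                }
              ; identity = +-identityˡ , λ x → trans (+-comm x 0#) (+-identityˡ x)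
              }
            ; inverse = -‿inverseˡ , λ x → trans (+-comm x (- x)) (-‿inverseˡ x)
            ; ⁻¹-cong = -‿cong
            }
          ; comm = +-comm
          }
        ; *-cong = *-cong
        ; *-assoc = *-assoc
        ; *-identity = *-identityˡ , λ x → trans (*-comm x 1#) (*-identityˡ x)
        ; distrib = distribˡ , λ x y z →
            trans (*-comm (y + z) x) (trans (distribˡ x y z) (+-cong (*-comm x y) (*-comm x z)))
        }
      ; *-comm = *-comm
      }
    }

∣-resp : ∀ {k a b} → a ≡ b → k ∣ a → k ∣ b
∣-resp ≡.refl d = d

≡⇒∣ : ∀ {k a b} → a ≡ b → k ∣ a ℤ.- b
≡⇒∣ eq = divides 0ℤ (ℤ.i≡j⇒i-j≡0 eq)

≡⇒≈₅ : ∀ x y → (∀ n → residue x n ≡ residue y n) → x ≈₅ y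
≡⇒≈₅ x y eq n = ≡⇒∣ (eq n)

ℤ₅-isCRing : IsCRing ℤ₅-ring
ℤ₅-isCRing = record
  { isEquivalence = record
    { refl  = λ {x} → ≡⇒≈₅ x x λ _ → ≡.refl
    ; sym   = λ {x} {y} p n → ∣-resp (neg (residue x n) (residue y n)) (ℤ∣.∣m⇒∣-m (p n))
    ; trans = λ {x} {y} {z} p q n →
        ∣-resp (chain (residue x n) (residue y n) (residue z n)) (ℤ∣.∣m∣n⇒∣m+n (p n) (q n))
    }
  ; +-cong = λ {x} {y} {u} {v} p q n →
      ∣-resp (sum (residue x n) (residue y n) (residue u n) (residue v n))
             (ℤ∣.∣m∣n⇒∣m+n (p n) (q n))
  ; *-cong = λ {x} {y} {u} {v} p q n →
      ∣-resp (prod (residue x n) (residue y n) (residue u n) (residue v n))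
             (ℤ∣.∣m∣n⇒∣m+n (ℤ∣.∣n⇒∣m*n (residue x n) (q n)) (ℤ∣.∣m⇒∣m*n (residue v n) (p n)))
  ; -‿cong = λ {x} {y} p n → ∣-resp (opp (residue x n) (residue y n)) (ℤ∣.∣m⇒∣-m (p n))
  ; +-assoc     = λ x y z n → ≡⇒∣ (ℤ.+-assoc (residue x n) (residue y n) (residue z n))
  ; +-comm      = λ x y n → ≡⇒∣ (ℤ.+-comm (residue x n) (residue y n))
  ; +-identityˡ = λ x n → ≡⇒∣ (ℤ.+-identityˡ (residue x n))
  ; -‿inverseˡ  = λ x n → ≡⇒∣ (ℤ.+-inverseˡ (residue x n))
  ; *-assoc     = λ x y z n → ≡⇒∣ (ℤ.*-assoc (residue x n) (residue y n) (residue z n))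
  ; *-comm      = λ x y n → ≡⇒∣ (ℤ.*-comm (residue x n) (residue y n))
  ; *-identityˡ = λ x n → ≡⇒∣ (ℤ.*-identityˡ (residue x n))
  ; distribˡ    = λ x y z n → ≡⇒∣ (ℤ.*-distribˡ-+ (residue x n) (residue y n) (residue z n))
  }
  where
  neg : ∀ a b → ℤ.- (a ℤ.- b) ≡ b ℤ.- a
  neg = solve-∀
  chain : ∀ a b d → (a ℤ.- b) ℤ.+ (b ℤ.- d) ≡ a ℤ.- d
  chain = solve-∀
  sum : ∀ a b d e → (a ℤ.- b) ℤ.+ (d ℤ.- e) ≡ (a ℤ.+ d) ℤ.- (b ℤ.+ e)
  sum = solve-∀
  prod : ∀ a b d e → a ℤ.* (d ℤ.- e) ℤ.+ (a ℤ.- b) ℤ.* e ≡ a ℤ.* d ℤ.- b ℤ.* e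
  prod = solve-∀
  opp : ∀ a b → ℤ.- (a ℤ.- b) ≡ ℤ.- a ℤ.- (ℤ.- b)
  opp = solve-∀

module ℤ₅ₚ = CommutativeRing (IsCRing.commutativeRing ℤ₅-isCRing)

isCRing : (R : CommutativeRing c ℓ) → IsCRing (CommutativeRing.rawRing R)
isCRing R = record
  { isEquivalence = isEquivalence ; +-cong = +-cong ; *-cong = *-cong ; -‿cong = -‿cong
  ; +-assoc = +-assoc ; +-comm = +-comm ; +-identityˡ = +-identityˡ ; -‿inverseˡ = -‿inverseˡ
  ; *-assoc = *-assoc ; *-comm = *-comm ; *-identityˡ = *-identityˡ ; distribˡ = distribˡ
  }
  where open CommutativeRing R

IsHom : (R S : RawRing 0ℓ 0ℓ) → (RawRing.Carrier R → RawRing.Carrier S) → Set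
IsHom = Morphism.RingMorphisms.IsRingHomomorphism

module _ (R S : RawRing 0ℓ 0ℓ) (f : RawRing.Carrier R → RawRing.Carrier S) where
  private
    module R = RawRing R
    module S = RawRing S

  ringHomomorphism :
    (∀ {x y} → x R.≈ y → f x S.≈ f y) →
    (∀ x y → f (x R.+ y) S.≈ f x S.+ f y) →
    (∀ x y → f (x R.* y) S.≈ f x S.* f y) →
    (∀ x → f (R.- x) S.≈ S.- f x) →
    f R.0# S.≈ S.0# → f R.1# S.≈ S.1# → IsHom R S f
  ringHomomorphism f-cong f-+ f-* f-neg f-0 f-1 = record
    { isSemiringHomomorphism = record
      { isNearSemiringHomomorphism = record
        { +-isMonoidHomomorphism = record
          { isMagmaHomomorphism = record
            { isRelHomomorphism = record { cong = f-cong }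
            ; homo = f-+
            }
          ; ε-homo = f-0
          }
        ; *-homo = f-*
        }
      ; 1#-homo = f-1
      }
    ; -‿homo = f-neg
    }

ℤ-ring : RawRing 0ℓ 0ℓ
ℤ-ring = ℤ.+-*-rawRing

fromℤ-homomorphism : IsHom ℤ-ring ℤ₅-ring fromℤ
fromℤ-homomorphism = ringHomomorphism ℤ-ring ℤ₅-ring fromℤ
  (λ {x} x≡y → ≡.subst (λ a → fromℤ x ≈₅ fromℤ a) x≡y (refl₅ (fromℤ x)))
  (λ x y → refl₅ (fromℤ (x ℤ.+ y))) (λ x y → refl₅ (fromℤ (x ℤ.* y))) (λ x → refl₅ (fromℤ (ℤ.- x)))
  (refl₅ (fromℤ 0ℤ)) (refl₅ (fromℤ 1ℤ))
  where
  refl₅ : ∀ x → x ≈₅ x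
  refl₅ x = ℤ₅ₚ.refl {x}

-- The solver has to compare coefficients, and equality in ℤ₅ cannot be decided. Coefficients are
-- therefore integers, interpreted by φ, and constants such as 1/3 enter as variables.
module ℤSolver {S : RawRing 0ℓ 0ℓ} (S-ring : IsCRing S) {φ : ℤ → RawRing.Carrier S}
               (φ-hom : IsHom ℤ-ring S φ) where
  private
    R = IsCRing.commutativeRing S-ring
    module R = CommutativeRing R
    module φ = Morphism.IsRingHomomorphism φ-hom

    morphism : ℤ-ring -Raw-AlmostCommutative⟶ fromCommutativeRing R
    morphism = record
      { ⟦_⟧ = φ ; +-homo = φ.+-homo ; *-homo = φ.*-homo ; -‿homo = φ.-‿homo
      ; 0-homo = φ.0#-homo ; 1-homo = φ.1#-homo }

    φ≟ : ∀ a b → Maybe (φ a R.≈ φ b)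
    φ≟ a b with a ℤ.≟ b
    ... | yes eq = just (R.reflexive (cong φ eq))
    ... | no  _  = nothing

  open Algebra.Solver.Ring ℤ-ring (fromCommutativeRing R) morphism φ≟ public
    using (solve; _:=_; _:+_; _:*_; :-_; _:-_; con)

-- Power series and polynomials

module Summation {R : RawRing 0ℓ 0ℓ} (R-ring : IsCRing R) where
  open RawRing R using (Carrier; _≈_; _+_; _*_; -_; 0#; 1#)
  open CommutativeRing (IsCRing.commutativeRing R-ring)
    hiding (Carrier; _≈_; _+_; _*_; -_; 0#; 1#; rawRing)
  open PowerSeries R using (Σ[i<_])
  open CommutativeSemigroup +-commutativeSemigroup using (interchange)

  Σ-cong : ∀ n {f g} → (∀ i → i ℕ.< n → f i ≈ g i) → Σ[i< n ] f ≈ Σ[i< n ] g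
  Σ-cong zero    eq = refl
  Σ-cong (suc n) eq = +-cong (Σ-cong n λ i i<n → eq i (ℕ.m<n⇒m<1+n i<n)) (eq n (ℕ.n<1+n n))

  Σ-zero : ∀ n {f} → (∀ i → f i ≈ 0#) → Σ[i< n ] f ≈ 0#
  Σ-zero zero    eq = refl
  Σ-zero (suc n) eq = trans (+-cong (Σ-zero n eq) (eq n)) (+-identityʳ 0#)

  Σ-+ : ∀ n f g → Σ[i< n ] (λ i → f i + g i) ≈ Σ[i< n ] f + Σ[i< n ] g
  Σ-+ zero    f g = sym (+-identityʳ 0#)
  Σ-+ (suc n) f g = trans (+-congʳ (Σ-+ n f g)) (interchange _ _ _ _)

  Σ-*ˡ : ∀ n a f → Σ[i< n ] (λ i → a * f i) ≈ a * Σ[i< n ] f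
  Σ-*ˡ zero    a f = sym (zeroʳ a)
  Σ-*ˡ (suc n) a f = trans (+-congʳ (Σ-*ˡ n a f)) (sym (distribˡ a _ _))

  Σ-suc : ∀ n f → Σ[i< suc n ] f ≈ f 0 + Σ[i< n ] (f ∘ suc)
  Σ-suc zero    f = +-comm 0# (f 0)
  Σ-suc (suc n) f = trans (+-congʳ (Σ-suc n f)) (+-assoc _ _ _)

module SeriesRing {R : RawRing 0ℓ 0ℓ} (R-ring : IsCRing R) where
  open RawRing R using (Carrier; _≈_; _+_; _*_; -_; 0#; 1#)
  open CommutativeRing (IsCRing.commutativeRing R-ring)
    hiding (Carrier; _≈_; _+_; _*_; -_; 0#; 1#; rawRing)
  open PowerSeries R using (Σ[i<_]; const; T; seriesRing)
  open Summation R-ring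
  open RingProperties ring using (-0#≈0#)
  private
    module S = RawRing seriesRing
    module ≈ = ≈-Reasoning setoid

  *-zeroth : ∀ F G → (F S.* G) 0 ≈ F 0 * G 0
  *-zeroth F G = +-identityˡ _

  *-suc : ∀ F G n → (F S.* G) (suc n) ≈ F 0 * G (suc n) + ((F ∘ suc) S.* G) n
  *-suc F G n = Σ-suc (suc n) (λ i → F i * G (suc n ℕ.∸ i))

  private
    -- Splitting off the last summand gives the mirror image of `*-suc`, which splits off the first.
    -- Commutativity follows from the two by induction on the index.
    *-suc′ : ∀ F G n → (F S.* G) (suc n) ≈ (F S.* (G ∘ suc)) n + F (suc n) * G 0
    *-suc′ F G n = +-cong
      (Σ-cong (suc n) λ i i<1+n → *-congˡ (reflexive (cong G (ℕ.+-∸-assoc 1 (ℕ.s≤s⁻¹ i<1+n)))))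
      (*-congˡ (reflexive (cong G (ℕ.n∸n≡0 (suc n)))))

    ⊛-cong : ∀ {F G H K} → F S.≈ G → H S.≈ K → F S.* H S.≈ G S.* K
    ⊛-cong p q n = Σ-cong (suc n) λ i _ → *-cong (p i) (q (n ℕ.∸ i))

    ⊛-comm : ∀ F G → F S.* G S.≈ G S.* F
    ⊛-comm F G zero    = +-congˡ (*-comm _ _)
    ⊛-comm F G (suc n) = begin
      (F S.* G) (suc n)                            ≈⟨ *-suc F G n ⟩
      F 0 * G (suc n) + ((F ∘ suc) S.* G) n       ≈⟨ +-comm _ _ ⟩
      ((F ∘ suc) S.* G) n + F 0 * G (suc n)       ≈⟨ +-cong (⊛-comm (F ∘ suc) G n) (*-comm _ _) ⟩
      (G S.* (F ∘ suc)) n + G (suc n) * F 0       ≈⟨ *-suc′ G F n ⟨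
      (G S.* F) (suc n)                            ∎
      where open ≈

    ⊛-distribˡ : ∀ F G H → F S.* (G S.+ H) S.≈ F S.* G S.+ F S.* H
    ⊛-distribˡ F G H n = trans
      (Σ-cong (suc n) λ i _ → distribˡ _ _ _)
      (Σ-+ (suc n) (λ i → F i * G (n ℕ.∸ i)) (λ i → F i * H (n ℕ.∸ i)))

    scale : Carrier → (ℕ → Carrier) → (ℕ → Carrier)
    scale a F n = a * F n

    scale-* : ∀ a F G → scale a F S.* G S.≈ scale a (F S.* G)
    scale-* a F G n = trans
      (Σ-cong (suc n) λ i _ → *-assoc _ _ _)
      (Σ-*ˡ (suc n) a (λ i → F i * G (n ℕ.∸ i)))

    ⊛-distribʳ : ∀ F G H → (G S.+ H) S.* F S.≈ G S.* F S.+ H S.* F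
    ⊛-distribʳ F G H n = trans
      (Σ-cong (suc n) λ i _ → distribʳ _ _ _)
      (Σ-+ (suc n) (λ i → G i * F (n ℕ.∸ i)) (λ i → H i * F (n ℕ.∸ i)))

    -- Induction on the coefficient index for all F at once: `(F S.* G) ∘ suc` is F 0 times
    -- `G ∘ suc` plus `F′ S.* G` with F′ = `F ∘ suc`, so the induction hypothesis is applied to F′.
    ⊛-assoc : ∀ F G H → (F S.* G) S.* H S.≈ F S.* (G S.* H)
    ⊛-assoc F G H zero = begin
      0# + (0# + F 0 * G 0) * H 0   ≈⟨ +-congˡ (*-congʳ (+-identityˡ _)) ⟩
      0# + F 0 * G 0 * H 0          ≈⟨ +-congˡ (*-assoc _ _ _) ⟩
      0# + F 0 * (G 0 * H 0)        ≈⟨ +-congˡ (*-congˡ (+-identityˡ _)) ⟨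
      0# + F 0 * (0# + G 0 * H 0)   ∎
      where open ≈
    ⊛-assoc F G H (suc n) = begin
      ((F S.* G) S.* H) (suc n)
        ≈⟨ *-suc (F S.* G) H n ⟩
      (F S.* G) 0 * H (suc n) + (((F S.* G) ∘ suc) S.* H) n
        ≈⟨ +-cong (trans (*-congʳ (*-zeroth F G)) (*-assoc _ _ _))
                  (⊛-cong {H = H} (*-suc F G) (λ _ → refl) n) ⟩
      F 0 * (G 0 * H (suc n)) + ((scale (F 0) (G ∘ suc) S.+ F′ S.* G) S.* H) n
        ≈⟨ +-congˡ (⊛-distribʳ H (scale (F 0) (G ∘ suc)) (F′ S.* G) n) ⟩
      F 0 * (G 0 * H (suc n)) + ((scale (F 0) (G ∘ suc) S.* H) n + ((F′ S.* G) S.* H) n)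
        ≈⟨ +-assoc _ _ _ ⟨
      F 0 * (G 0 * H (suc n)) + (scale (F 0) (G ∘ suc) S.* H) n + ((F′ S.* G) S.* H) n
        ≈⟨ +-cong (+-congˡ (scale-* (F 0) (G ∘ suc) H n)) (⊛-assoc F′ G H n) ⟩
      F 0 * (G 0 * H (suc n)) + F 0 * ((G ∘ suc) S.* H) n + (F′ S.* (G S.* H)) n
        ≈⟨ +-congʳ (distribˡ _ _ _) ⟨
      F 0 * (G 0 * H (suc n) + ((G ∘ suc) S.* H) n) + (F′ S.* (G S.* H)) n
        ≈⟨ +-congʳ (*-congˡ (*-suc G H n)) ⟨
      F 0 * (G S.* H) (suc n) + (F′ S.* (G S.* H)) n
        ≈⟨ *-suc F (G S.* H) n ⟨
      (F S.* (G S.* H)) (suc n) ∎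
      where
      open ≈
      F′ = F ∘ suc

    zero-* : ∀ F n → (S.0# S.* F) n ≈ 0#
    zero-* F n = Σ-zero (suc n) λ i → zeroˡ _

  const-* : ∀ a F n → (const a S.* F) n ≈ a * F n
  const-* a F zero    = *-zeroth (const a) F
  const-* a F (suc n) = begin
    (const a S.* F) (suc n)            ≈⟨ *-suc (const a) F n ⟩
    a * F (suc n) + (S.0# S.* F) n     ≈⟨ +-congˡ (zero-* F n) ⟩
    a * F (suc n) + 0#                 ≈⟨ +-identityʳ _ ⟩
    a * F (suc n)                      ∎
    where open ≈

  T-*-zero : ∀ F → (T S.* F) 0 ≈ 0#
  T-*-zero F = trans (*-zeroth T F) (zeroˡ _)

  T-*-suc : ∀ F n → (T S.* F) (suc n) ≈ F n
  T-*-suc F n = begin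
    (T S.* F) (suc n)                        ≈⟨ *-suc T F n ⟩
    0# * F (suc n) + ((T ∘ suc) S.* F) n     ≈⟨ +-cong (zeroˡ _) (⊛-cong {H = F} T∘suc (λ _ → refl) n) ⟩
    0# + (S.1# S.* F) n                      ≈⟨ +-identityˡ _ ⟩
    (S.1# S.* F) n                           ≈⟨ const-* 1# F n ⟩
    1# * F n                                 ≈⟨ *-identityˡ _ ⟩
    F n                                      ∎
    where
    open ≈
    T∘suc : ∀ i → T (suc i) ≈ const 1# i
    T∘suc zero    = refl
    T∘suc (suc i) = refl

  seriesRing-isCRing : IsCRing seriesRing
  seriesRing-isCRing = record
    { isEquivalence = record
      { refl  = λ _ → refl
      ; sym   = λ p n → sym (p n)
      ; trans = λ p q n → trans (p n) (q n)
      }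
    ; +-cong      = λ p q n → +-cong (p n) (q n)
    ; *-cong      = ⊛-cong
    ; -‿cong      = λ p n → -‿cong (p n)
    ; +-assoc     = λ F G H n → +-assoc (F n) (G n) (H n)
    ; +-comm      = λ F G n → +-comm (F n) (G n)
    ; +-identityˡ = λ F n → +-identityˡ (F n)
    ; -‿inverseˡ  = λ F n → -‿inverseˡ (F n)
    ; *-assoc     = ⊛-assoc
    ; *-comm      = ⊛-comm
    ; *-identityˡ = λ F n → trans (const-* 1# F n) (*-identityˡ (F n))
    ; distribˡ    = ⊛-distribˡ
    }

  const-homomorphism : IsHom R seriesRing const
  const-homomorphism = ringHomomorphism R seriesRing const
    (λ where
      p zero    → p
      p (suc n) → refl)
    (λ where
      a b zero    → refl
      a b (suc n) → sym (+-identityʳ 0#))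
    (λ where
      a b zero    → sym (const-* a (const b) 0)
      a b (suc n) → sym (trans (const-* a (const b) (suc n)) (zeroʳ a)))
    (λ where
      a zero    → refl
      a (suc n) → sym -0#≈0#)
    (λ where
      zero    → refl
      (suc n) → refl)
    (λ _ → refl)

  module S′ = CommutativeRing (IsCRing.commutativeRing seriesRing-isCRing)

  infixl 6 _⊕_
  infixl 7 _⊛_

  -- The operations are sealed: unfolding them at ℤ₅ would compare coherence proofs.
  abstract
    _⊕_ _⊛_ : (F G : ℕ → Carrier) → (ℕ → Carrier)
    _⊕_ = S._+_
    _⊛_ = S._*_

    ⊖_ : (ℕ → Carrier) → (ℕ → Carrier)
    ⊖_ = S.-_

  seriesᵒ : RawRing 0ℓ 0ℓ
  seriesᵒ = record
    { Carrier = ℕ → Carrier ; _≈_ = S._≈_ ; _+_ = _⊕_ ; _*_ = _⊛_ ; -_ = ⊖_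
    ; 0# = λ _ → 0# ; 1# = const 1# }

  abstract
    ⊕-unfold : ∀ F G → F ⊕ G S.≈ F S.+ G
    ⊕-unfold F G _ = refl

    ⊛-unfold : ∀ F G → F ⊛ G S.≈ F S.* G
    ⊛-unfold F G _ = refl

    ⊖-unfold : ∀ F → ⊖ F S.≈ S.- F
    ⊖-unfold F _ = refl

    seriesᵒ-isCRing : IsCRing seriesᵒ
    seriesᵒ-isCRing = seriesRing-isCRing

    const-homᵒ : IsHom R seriesᵒ const
    const-homᵒ = const-homomorphism

    T-⊛-zero : ∀ F → (T ⊛ F) 0 ≈ 0#
    T-⊛-zero = T-*-zero

    T-⊛-suc : ∀ F n → (T ⊛ F) (suc n) ≈ F n
    T-⊛-suc = T-*-suc

    const-⊛ : ∀ a F n → (const a ⊛ F) n ≈ a * F n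
    const-⊛ = const-*

    -- The coefficient of (1 + T)F at n + 1 is F (n + 1) + F n, which the recursion makes 0. The
    -- hypotheses on F are the defining equations of `z⁻¹`.
    1+T-inverse : ∀ H F → H S.≈ const 1# ⊕ T → F 0 ≈ 1# → (∀ n → F (suc n) ≈ - F n) →
                  H ⊛ F S.≈ const 1#
    1+T-inverse H F H≈1+T F₀ F₊ n = begin
      (H S.* F) n                      ≈⟨ ⊛-cong {H = F} H≈1+T (λ _ → refl) n ⟩
      ((S.1# S.+ T) S.* F) n           ≈⟨ S′.distribʳ F S.1# T n ⟩
      (S.1# S.* F) n + (T S.* F) n     ≈⟨ +-congʳ (S′.*-identityˡ F n) ⟩
      F n + (T S.* F) n                ≈⟨ telescope n ⟩
      S.1# n                           ∎
      where
      open ≈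
      telescope : ∀ n → F n + (T S.* F) n ≈ S.1# n
      telescope zero    = trans (+-cong F₀ (T-*-zero F)) (+-identityʳ 1#)
      telescope (suc n) = trans (+-cong (F₊ n) (T-*-suc F n)) (-‿inverseˡ (F n))

-- List polynomials are compared through `coeff`, that is, as power series in which the
-- indeterminate is `T`. The formulas for sums and products carry identities from the series ring
-- over to polynomials.
module PolynomialSeries {R : RawRing 0ℓ 0ℓ} (R-ring : IsCRing R) where
  open RawRing R using (Carrier; _≈_; _+_; _*_; -_; 0#; 1#)
  open CommutativeRing (IsCRing.commutativeRing R-ring)
    hiding (Carrier; _≈_; _+_; _*_; -_; 0#; 1#; rawRing)
  open Polynomial R
  open PowerSeries R using (const; T)
  open SeriesRing R-ring using (seriesᵒ; seriesᵒ-isCRing; _⊕_; _⊛_; ⊕-unfold; const-⊛; T-⊛-zero; T-⊛-suc)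
  private
    module S = CommutativeRing (IsCRing.commutativeRing seriesᵒ-isCRing)

  coeff-map-* : ∀ a p n → coeff (map (a *_) p) n ≈ a * coeff p n
  coeff-map-* a []      n       = sym (zeroʳ a)
  coeff-map-* a (b ∷ p) zero    = refl
  coeff-map-* a (b ∷ p) (suc n) = coeff-map-* a p n

  coeff-addₚ : ∀ p q n → coeff (addₚ p q) n ≈ coeff p n + coeff q n
  coeff-addₚ []      q       n       = sym (+-identityˡ _)
  coeff-addₚ (a ∷ p) []      n       = sym (+-identityʳ _)
  coeff-addₚ (a ∷ p) (b ∷ q) zero    = refl
  coeff-addₚ (a ∷ p) (b ∷ q) (suc n) = coeff-addₚ p q n

  coeff-∷ : ∀ a p → coeff (a ∷ p) S.≈ const a ⊕ T ⊛ coeff p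
  coeff-∷ a p n = trans (split n) (sym (⊕-unfold (const a) (T ⊛ coeff p) n))
    where
    split : ∀ n → coeff (a ∷ p) n ≈ const a n + (T ⊛ coeff p) n
    split zero    = trans (sym (+-identityʳ a)) (+-congˡ (sym (T-⊛-zero (coeff p))))
    split (suc n) = trans (sym (+-identityˡ _)) (+-congˡ (sym (T-⊛-suc (coeff p) n)))

  coeff-mulₚ : ∀ p q → coeff (mulₚ p q) S.≈ coeff p ⊛ coeff q
  coeff-mulₚ []      q = S.sym (S.zeroˡ (coeff q))
  coeff-mulₚ (a ∷ p) q = begin
    coeff (addₚ (map (a *_) q) (0# ∷ mulₚ p q))
      ≈⟨ (λ n → trans (coeff-addₚ (map (a *_) q) (0# ∷ mulₚ p q) n)
                      (sym (⊕-unfold (coeff (map (a *_) q)) (coeff (0# ∷ mulₚ p q)) n))) ⟩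
    coeff (map (a *_) q) ⊕ coeff (0# ∷ mulₚ p q)
      ≈⟨ S.+-cong (λ n → trans (coeff-map-* a q n) (sym (const-⊛ a (coeff q) n))) (shift (coeff-mulₚ p q)) ⟩
    const a ⊛ coeff q ⊕ T ⊛ (coeff p ⊛ coeff q)
      ≈⟨ S.+-congˡ (S.*-assoc T (coeff p) (coeff q)) ⟨
    const a ⊛ coeff q ⊕ T ⊛ coeff p ⊛ coeff q
      ≈⟨ S.distribʳ (coeff q) (const a) (T ⊛ coeff p) ⟨
    (const a ⊕ T ⊛ coeff p) ⊛ coeff q
      ≈⟨ S.*-congʳ {coeff q} (coeff-∷ a p) ⟨
    coeff (a ∷ p) ⊛ coeff q ∎
    where
    open ≈-Reasoning S.setoid
    shift : ∀ {r F} → coeff r S.≈ F → coeff (0# ∷ r) S.≈ T ⊛ F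
    shift {F = F} eq zero    = sym (T-⊛-zero F)
    shift {F = F} eq (suc n) = trans (eq n) (sym (T-⊛-suc F n))

  coeff-linear-* : ∀ b p n → coeff (mulₚ (b ∷ 1# ∷ []) p) (suc n) ≈ b * coeff p (suc n) + coeff p n
  coeff-linear-* b p n = begin
    coeff (addₚ (map (b *_) p) (0# ∷ q)) (suc n)      ≈⟨ coeff-addₚ (map (b *_) p) (0# ∷ q) (suc n) ⟩
    coeff (map (b *_) p) (suc n) + coeff q n          ≈⟨ +-cong (coeff-map-* b p (suc n)) (coeff-addₚ (map (1# *_) p) (0# ∷ []) n) ⟩
    b * coeff p (suc n) + (coeff (map (1# *_) p) n + coeff (0# ∷ []) n)
      ≈⟨ +-congˡ (+-cong (trans (coeff-map-* 1# p n) (*-identityˡ _)) (zero-coeff n)) ⟩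
    b * coeff p (suc n) + (coeff p n + 0#)            ≈⟨ +-congˡ (+-identityʳ _) ⟩
    b * coeff p (suc n) + coeff p n                   ∎
    where
    open ≈-Reasoning setoid
    q = mulₚ (1# ∷ []) p
    zero-coeff : ∀ n → coeff (0# ∷ []) n ≈ 0#
    zero-coeff zero    = refl
    zero-coeff (suc n) = refl

  coeff-fromRoots-> : ∀ αs k → coeff (fromRoots αs) (suc (length αs ℕ.+ k)) ≈ 0#
  coeff-fromRoots-> []       k = refl
  coeff-fromRoots-> (α ∷ αs) k = begin
    coeff (fromRoots (α ∷ αs)) (suc (suc (length αs ℕ.+ k)))
      ≈⟨ coeff-linear-* (- α) p (suc (length αs ℕ.+ k)) ⟩
    - α * coeff p (suc (suc (length αs ℕ.+ k))) + coeff p (suc (length αs ℕ.+ k))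
      ≈⟨ +-cong (*-congˡ (trans (reflexive (cong (coeff p ∘ suc) (≡.sym (ℕ.+-suc (length αs) k))))
                                (coeff-fromRoots-> αs (suc k))))
                (coeff-fromRoots-> αs k) ⟩
    - α * 0# + 0#
      ≈⟨ trans (+-identityʳ _) (zeroʳ _) ⟩
    0# ∎
    where
    open ≈-Reasoning setoid
    p = fromRoots αs

  fromRoots-monic : ∀ αs → coeff (fromRoots αs) (length αs) ≈ 1#
  fromRoots-monic []       = refl
  fromRoots-monic (α ∷ αs) = begin
    coeff (fromRoots (α ∷ αs)) (suc (length αs))
      ≈⟨ coeff-linear-* (- α) p (length αs) ⟩
    - α * coeff p (suc (length αs)) + coeff p (length αs)
      ≈⟨ +-cong (*-congˡ (trans (reflexive (cong (coeff p ∘ suc) (≡.sym (ℕ.+-identityʳ _))))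
                                (coeff-fromRoots-> αs 0)))
                (fromRoots-monic αs) ⟩
    - α * 0# + 1#
      ≈⟨ trans (+-congʳ (zeroʳ _)) (+-identityˡ _) ⟩
    1# ∎
    where
    open ≈-Reasoning setoid
    p = fromRoots αs

-- Identities in ℤ₅-algebras

-- The partial sums s of ∑ 2(-5)ⁱ also obey s ↦ 2 - 5s. The summands are local to `⅓`, so they are
-- recovered as differences of consecutive residues.
⅓-residue-suc : ∀ n → residue ⅓ (suc n) ≡ -[1+ 4 ] ℤ.* residue ⅓ n ℤ.+ + 2
⅓-residue-suc zero    = ≡.refl
⅓-residue-suc (suc n) = ≡.trans (unfold (residue ⅓ n) _)
  (≡.trans (cong (λ r → r ℤ.+ -[1+ 4 ] ℤ.* (r ℤ.- residue ⅓ n)) (⅓-residue-suc n))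
  (≡.trans (step (residue ⅓ n)) (cong (λ r → -[1+ 4 ] ℤ.* r ℤ.+ + 2) (≡.sym (⅓-residue-suc n)))))
  where
  unfold : ∀ a b → (a ℤ.+ b) ℤ.+ -[1+ 4 ] ℤ.* b ≡ (a ℤ.+ b) ℤ.+ -[1+ 4 ] ℤ.* ((a ℤ.+ b) ℤ.- a)
  unfold = solve-∀
  step : ∀ a → (-[1+ 4 ] ℤ.* a ℤ.+ + 2) ℤ.+ -[1+ 4 ] ℤ.* ((-[1+ 4 ] ℤ.* a ℤ.+ + 2) ℤ.- a) ≡
               -[1+ 4 ] ℤ.* (-[1+ 4 ] ℤ.* a ℤ.+ + 2) ℤ.+ + 2
  step = solve-∀

5^-suc : ∀ n → 5^ (suc n) ≡ + 5 ℤ.* 5^ n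
5^-suc n = ℤ.pos-* 5 (5 ℕ.^ n)

3*⅓≈1 : fromℤ (+ 3) *₅ ⅓ ≈₅ fromℤ 1ℤ
3*⅓≈1 zero    = divides -[1+ 0 ] ≡.refl
3*⅓≈1 (suc n) with 3*⅓≈1 n
... | divides q eq = divides (ℤ.- q) (begin
  + 3 ℤ.* residue ⅓ (suc n) ℤ.- 1ℤ                     ≡⟨ cong (λ r → + 3 ℤ.* r ℤ.- 1ℤ) (⅓-residue-suc n) ⟩
  + 3 ℤ.* (-[1+ 4 ] ℤ.* residue ⅓ n ℤ.+ + 2) ℤ.- 1ℤ    ≡⟨ step (residue ⅓ n) ⟩
  -[1+ 4 ] ℤ.* (+ 3 ℤ.* residue ⅓ n ℤ.- 1ℤ)            ≡⟨ cong (-[1+ 4 ] ℤ.*_) eq ⟩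
  -[1+ 4 ] ℤ.* (q ℤ.* 5^ n)                             ≡⟨ shuffle q (5^ n) ⟩
  ℤ.- q ℤ.* (+ 5 ℤ.* 5^ n)                              ≡⟨ cong (ℤ.- q ℤ.*_) (5^-suc n) ⟨
  ℤ.- q ℤ.* 5^ (suc n)                                  ∎)
  where
  open ≡.≡-Reasoning
  step : ∀ a → + 3 ℤ.* (-[1+ 4 ] ℤ.* a ℤ.+ + 2) ℤ.- 1ℤ ≡ -[1+ 4 ] ℤ.* (+ 3 ℤ.* a ℤ.- 1ℤ)
  step = solve-∀
  shuffle : ∀ a b → -[1+ 4 ] ℤ.* (a ℤ.* b) ≡ ℤ.- a ℤ.* (+ 5 ℤ.* b)
  shuffle = solve-∀

∘-homomorphism : ∀ {R S T : RawRing 0ℓ 0ℓ} {f : RawRing.Carrier R → RawRing.Carrier S}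
                 {g : RawRing.Carrier S → RawRing.Carrier T} →
                 (∀ {x y z} → RawRing._≈_ T x y → RawRing._≈_ T y z → RawRing._≈_ T x z) →
                 IsHom R S f → IsHom S T g → IsHom R T (g ∘ f)
∘-homomorphism {R} {S} {T} {f} {g} trans f-hom g-hom = ringHomomorphism R T (g ∘ f)
  (λ p → G.⟦⟧-cong (F.⟦⟧-cong p))
  (λ x y → trans (G.⟦⟧-cong (F.+-homo x y)) (G.+-homo (f x) (f y)))
  (λ x y → trans (G.⟦⟧-cong (F.*-homo x y)) (G.*-homo (f x) (f y)))
  (λ x → trans (G.⟦⟧-cong (F.-‿homo x)) (G.-‿homo (f x)))
  (trans (G.⟦⟧-cong F.0#-homo) G.0#-homo)
  (trans (G.⟦⟧-cong F.1#-homo) G.1#-homo)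
  where
  module F = Morphism.IsRingHomomorphism f-hom
  module G = Morphism.IsRingHomomorphism g-hom

-- The same identities are needed in ℤ₅, in ℚ₅[[T]] for coprimality, in ℤ₅[[T]], in the splitting
-- rings of the resultant and in Ω. They are proved once for a ring under ℤ₅, with t for the image
-- of 1/3.
module ℤ₅-Algebra {R : RawRing 0ℓ 0ℓ} (R-ring : IsCRing R) {ψ : ℤ₅ → RawRing.Carrier R}
                  (ψ-hom : IsHom ℤ₅-ring R ψ) where
  open RawRing R using (Carrier; _≈_; _+_; _*_; -_; 0#; 1#)
  open CommutativeRing (IsCRing.commutativeRing R-ring)
    hiding (Carrier; _≈_; _+_; _*_; -_; 0#; 1#; rawRing)
  open Polynomial R using (eval)
  open ≈-Reasoning setoid

  module ψ = Morphism.IsRingHomomorphism ψ-hom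

  k : ℤ → Carrier
  k = ψ ∘ fromℤ

  k-hom : IsHom ℤ-ring R k
  k-hom = ∘-homomorphism {ℤ-ring} {ℤ₅-ring} {R} trans fromℤ-homomorphism ψ-hom

  module k = Morphism.IsRingHomomorphism k-hom

  open ℤSolver R-ring k-hom public

  t : Carrier
  t = ψ ⅓

  3t≈1 : k (+ 3) * t ≈ k 1ℤ
  3t≈1 = trans (sym (ψ.*-homo (fromℤ (+ 3)) ⅓)) (ψ.⟦⟧-cong 3*⅓≈1)

  -- Calculation modulo the relation a ≈ b: the solver checks x = y + (b - a)c as a polynomial
  -- identity, where c is the quotient of x - y by b - a. Nested uses work modulo several relations.
  reduce : ∀ {x y a b c} → a ≈ b → x ≈ y + (b - a) * c → x ≈ y
  reduce {x} {y} {a} {b} {c} a≈b eq = begin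
    x                  ≈⟨ eq ⟩
    y + (b - a) * c    ≈⟨ +-congˡ (*-congʳ (+-congˡ (-‿cong a≈b))) ⟩
    y + (b - b) * c    ≈⟨ +-congˡ (*-congʳ (-‿inverseʳ b)) ⟩
    y + 0# * c         ≈⟨ +-congˡ (zeroˡ c) ⟩
    y + 0#             ≈⟨ +-identityʳ y ⟩
    y                  ∎

  -- Horner form in the bracketing of `eval`. Constants are `k` of an integer, even for 1, because
  -- this is what `con` denotes in the solver.
  P : Carrier → Carrier
  P α = k 1ℤ + α * (- (k (+ 7) * t) + α * (k (+ 29) * (t * t) + α * (- (k (+ 7) * t) + α * k 1ℤ)))

  eval-P₅ : ∀ α → eval (map ψ P₅) α ≈ P α
  eval-P₅ α =
    +-congˡ (*-congˡ (+-cong 7t (*-congˡ (+-cong 29t² (*-congˡ (+-cong 7t (*-congˡ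
      (trans (+-congˡ (zeroʳ α)) (+-identityʳ _)))))))))
    where
    7t : ψ (-₅ (fromℤ (+ 7) *₅ ⅓)) ≈ - (k (+ 7) * t)
    7t = trans (ψ.-‿homo (fromℤ (+ 7) *₅ ⅓)) (-‿cong (ψ.*-homo (fromℤ (+ 7)) ⅓))
    29t² : ψ (fromℤ (+ 29) *₅ ⅑) ≈ k (+ 29) * (t * t)
    29t² = trans (ψ.*-homo (fromℤ (+ 29)) ⅑) (*-congˡ (ψ.*-homo ⅓ ⅓))

  P[1] : P (k 1ℤ) ≈ k (+ 5) * (t * t)
  P[1] = reduce 3t≈1 (solve 1 (λ t →
    con 1ℤ :+ con 1ℤ :* (:- (con (+ 7) :* t) :+ con 1ℤ :* (con (+ 29) :* (t :* t) :+ con 1ℤ :* (:- (con (+ 7) :* t) :+ con 1ℤ :* con 1ℤ)))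
    := con (+ 5) :* (t :* t) :+ (con 1ℤ :- con (+ 3) :* t) :* (con (+ 2) :* (con 1ℤ :- con (+ 4) :* t))) refl t)

  P[-1] : P (- k 1ℤ) ≈ k (+ 89) * (t * t)
  P[-1] = reduce 3t≈1 (solve 1 (λ t →
    con 1ℤ :+ :- con 1ℤ :* (:- (con (+ 7) :* t) :+ :- con 1ℤ :* (con (+ 29) :* (t :* t) :+ :- con 1ℤ :* (:- (con (+ 7) :* t) :+ :- con 1ℤ :* con 1ℤ)))
    := con (+ 89) :* (t :* t) :+ (con 1ℤ :- con (+ 3) :* t) :* (con (+ 2) :* (con 1ℤ :+ con (+ 10) :* t))) refl t)

  -- `P₅` is palindromic: α⁻²P₅(α) = (α² + α⁻²) - 7t(α + α⁻¹) + 29t², and α² + α⁻² = s² - 2 for s =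
  -- α + α⁻¹.
  Q : Carrier → Carrier
  Q s = s * s + - (k (+ 7) * t * s) + (k (+ 29) * (t * t) + - k (+ 2))

  P≈α²Q : ∀ α β → α * β ≈ k 1ℤ → P α ≈ α * α * Q (α + β)
  P≈α²Q α β αβ≈1 = reduce αβ≈1 (solve 3 (λ α β t →
    con 1ℤ :+ α :* (:- (con (+ 7) :* t) :+ α :* (con (+ 29) :* (t :* t) :+ α :* (:- (con (+ 7) :* t) :+ α :* con 1ℤ)))
    := α :* α :* ((α :+ β) :* (α :+ β) :- con (+ 7) :* t :* (α :+ β) :+ (con (+ 29) :* (t :* t) :- con (+ 2)))
       :+ (con 1ℤ :- α :* β) :* (con 1ℤ :+ α :* β :+ con (+ 2) :* α :* α :- con (+ 7) :* t :* α)) refl α β t)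

  Φ : Carrier → Carrier
  Φ x = k 1ℤ + x + x * x + x * (x * x) + x * x * (x * x)

  -- With c = z + y, the shift by 4 and 9t² = 1 turn Q into t²(c² + c - 1). Substituting y = z⁻¹ and
  -- multiplying c² + c - 1 by z² gives Φ₅(z).
  Q≈t²Φ/z² : ∀ z y → z * y ≈ k 1ℤ → Q (t * (z + y + k (+ 4))) ≈ t * t * (Φ z * (y * y))
  Q≈t²Φ/z² z y zy≈1 = trans
    (reduce 3t≈1 (solve 2 (λ t c →
      (t :* (c :+ con (+ 4))) :* (t :* (c :+ con (+ 4))) :- con (+ 7) :* t :* (t :* (c :+ con (+ 4))) :+ (con (+ 29) :* (t :* t) :- con (+ 2))
      := t :* t :* (c :* c :+ c :- con 1ℤ)
         :+ (con 1ℤ :- con (+ 3) :* t) :* (:- con (+ 2) :* (con 1ℤ :+ con (+ 3) :* t))) refl t (z + y)))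
    (*-congˡ (sym (reduce zy≈1 (solve 2 (λ z y →
      (con 1ℤ :+ z :+ z :* z :+ z :* (z :* z) :+ z :* z :* (z :* z)) :* (y :* y)
      := (z :+ y) :* (z :+ y) :+ (z :+ y) :- con 1ℤ
         :+ (con 1ℤ :- z :* y) :* :- (z :* z :* (con 1ℤ :+ z :* y) :+ z :* (con 1ℤ :+ z :* y) :+ y :- (con 1ℤ :- z :* y))) refl z y))))

  PαPβ : ∀ α β z y → α * β ≈ k 1ℤ → z * y ≈ k 1ℤ → α + β ≈ t * (z + y + k (+ 4)) →
         P α * P β ≈ (t * t) * (t * t) * (Φ z * Φ z) * ((y * y) * (y * y))
  PαPβ α β z y αβ≈1 zy≈1 s = begin
    P α * P β
      ≈⟨ *-cong (P≈α²Q α β αβ≈1) (P≈α²Q β α (trans (*-comm β α) αβ≈1)) ⟩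
    α * α * Q (α + β) * (β * β * Q (β + α))
      ≈⟨ *-cong (*-congˡ Qs) (*-congˡ (trans (Q-cong (+-comm β α)) Qs)) ⟩
    α * α * q * (β * β * q)
      ≈⟨ reduce αβ≈1 (solve 3 (λ α β q → α :* α :* q :* (β :* β :* q) :=
           q :* q :+ (con 1ℤ :- α :* β) :* (:- (con 1ℤ :+ α :* β) :* q :* q)) refl α β q) ⟩
    q * q
      ≈⟨ solve 3 (λ t f y → t :* t :* (f :* (y :* y)) :* (t :* t :* (f :* (y :* y))) :=
           (t :* t) :* (t :* t) :* (f :* f) :* ((y :* y) :* (y :* y))) refl t (Φ z) y ⟩
    (t * t) * (t * t) * (Φ z * Φ z) * ((y * y) * (y * y)) ∎
    where
    q = t * t * (Φ z * (y * y))
    Q-cong : ∀ {x y} → x ≈ y → Q x ≈ Q y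
    Q-cong x≈y = +-congʳ (+-cong (*-cong x≈y x≈y) (-‿cong (*-congˡ x≈y)))
    Qs : Q (α + β) ≈ q
    Qs = trans (Q-cong s) (Q≈t²Φ/z² z y zy≈1)

-- The field ℚ₅ and coprimality

5^-+ : ∀ k l → 5^ (k ℕ.+ l) ≡ 5^ k ℤ.* 5^ l
5^-+ k l = ≡.trans (cong +_ (ℕ.^-distribˡ-+-* 5 k l)) (ℤ.pos-* (5 ℕ.^ k) (5 ℕ.^ l))

residue-coherent : ∀ x l n → 5^ n ∣ residue x (l ℕ.+ n) ℤ.- residue x n
residue-coherent x zero    n = divides 0ℤ (ℤ.+-inverseʳ (residue x n))
residue-coherent x (suc l) n = ∣-resp (chain (residue x (suc (l ℕ.+ n))) (residue x (l ℕ.+ n)) (residue x n))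
  (ℤ∣.∣m∣n⇒∣m+n (ℤ∣.∣-trans (divides (5^ l) (5^-+ l n)) (coherent x (l ℕ.+ n))) (residue-coherent x l n))
  where
  chain : ∀ a b c → (a ℤ.- b) ℤ.+ (b ℤ.- c) ≡ a ℤ.- c
  chain = solve-∀

-- ℤ₅ has no 5-torsion. Cancelling 5ˡ at level n would lose l digits, so the divisibility is taken
-- at level l + n, cancelled there, and brought down by coherence. This is what makes equality of
-- fractions in ℚ₅ transitive.
5^-cancel : ∀ l x → (∀ n → 5^ n ∣ 5^ l ℤ.* residue x n) → ∀ n → 5^ n ∣ residue x n
5^-cancel l x div n = ∣-resp (sub (residue x (l ℕ.+ n)) (residue x n))
  (ℤ∣.∣m∣n⇒∣m-n
    (ℤ∣.*-cancelˡ-∣ (5^ l) {{ℕ.m^n≢0 5 l}} (≡.subst (_∣ 5^ l ℤ.* residue x (l ℕ.+ n)) (5^-+ l n) (div (l ℕ.+ n))))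
    (residue-coherent x l n))
  where
  sub : ∀ a b → a ℤ.- (a ℤ.- b) ≡ b
  sub = solve-∀

ℚ₅-isCRing : IsCRing ℚ₅-ring
ℚ₅-isCRing = record
  { isEquivalence = record
    { refl  = λ {(x , k)} → ℤ₅ₚ.refl {fromℤ (5^ k) *₅ x}
    ; sym   = λ {(x , k)} {(y , l)} → ℤ₅ₚ.sym {fromℤ (5^ l) *₅ x} {fromℤ (5^ k) *₅ y}
    ; trans = λ {(x , k)} {(y , l)} {(z , m)} → transitive x y z k l m
    }
  ; +-cong = λ {(x , k)} {(x′ , k′)} {(y , l)} {(y′ , l′)} → plus x x′ y y′ k k′ l l′
  ; *-cong = λ {(x , k)} {(x′ , k′)} {(y , l)} {(y′ , l′)} → times x x′ y y′ k k′ l l′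
  ; -‿cong = λ {(x , k)} {(y , l)} p n →
      ∣-resp (neg (5^ l) (residue x n) (5^ k) (residue y n)) (ℤ∣.∣m⇒∣-m (p n))
  ; +-assoc     = λ (x , k) (y , l) (z , m) n → ≡⇒∣ (assoc k l m (residue x n) (residue y n) (residue z n))
  ; +-comm      = λ (x , k) (y , l) n → ≡⇒∣ (comm k l (residue x n) (residue y n))
  ; +-identityˡ = λ (x , k) n → ≡⇒∣ (identity (5^ k) (residue x n))
  ; -‿inverseˡ  = λ (x , k) n → ≡⇒∣ (inverse (5^ k) (residue x n) (5^ (k ℕ.+ k)))
  ; *-assoc     = λ (x , k) (y , l) (z , m) n → ≡⇒∣
      (cong₂ ℤ._*_ (cong 5^ (≡.sym (ℕ.+-assoc k l m))) (ℤ.*-assoc (residue x n) (residue y n) (residue z n)))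
  ; *-comm      = λ (x , k) (y , l) n → ≡⇒∣
      (cong₂ ℤ._*_ (cong 5^ (ℕ.+-comm l k)) (ℤ.*-comm (residue x n) (residue y n)))
  ; *-identityˡ = λ (x , k) n → ≡⇒∣ (cong (5^ k ℤ.*_) (ℤ.*-identityˡ (residue x n)))
  ; distribˡ    = λ (x , k) (y , l) (z , m) n → ≡⇒∣ (distrib k l m (residue x n) (residue y n) (residue z n))
  }
  where
  transitive : ∀ x y z k l m → fromℤ (5^ l) *₅ x ≈₅ fromℤ (5^ k) *₅ y →
               fromℤ (5^ m) *₅ y ≈₅ fromℤ (5^ l) *₅ z → fromℤ (5^ m) *₅ x ≈₅ fromℤ (5^ k) *₅ z
  transitive x y z k l m p q = 5^-cancel l (fromℤ (5^ m) *₅ x +₅ -₅ (fromℤ (5^ k) *₅ z)) λ n →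
    ∣-resp (combine (5^ k) (5^ l) (5^ m) (residue x n) (residue y n) (residue z n))
      (ℤ∣.∣m∣n⇒∣m+n (ℤ∣.∣n⇒∣m*n (5^ m) (p n)) (ℤ∣.∣n⇒∣m*n (5^ k) (q n)))
    where
    combine : ∀ a b c x y z → c ℤ.* (b ℤ.* x ℤ.- a ℤ.* y) ℤ.+ a ℤ.* (c ℤ.* y ℤ.- b ℤ.* z) ≡
                               b ℤ.* (c ℤ.* x ℤ.- a ℤ.* z)
    combine = solve-∀

  plus : ∀ x x′ y y′ k k′ l l′ →
    fromℤ (5^ k′) *₅ x ≈₅ fromℤ (5^ k) *₅ x′ → fromℤ (5^ l′) *₅ y ≈₅ fromℤ (5^ l) *₅ y′ →
    fromℤ (5^ (k′ ℕ.+ l′)) *₅ (fromℤ (5^ l) *₅ x +₅ fromℤ (5^ k) *₅ y) ≈₅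
    fromℤ (5^ (k ℕ.+ l)) *₅ (fromℤ (5^ l′) *₅ x′ +₅ fromℤ (5^ k′) *₅ y′)
  plus x x′ y y′ k k′ l l′ p q n =
    ∣-resp (≡.trans
        (combine (5^ k) (5^ k′) (5^ l) (5^ l′) (residue x n) (residue x′ n) (residue y n) (residue y′ n))
        (≡.sym (cong₂ (λ a b → a ℤ.* (5^ l ℤ.* residue x n ℤ.+ 5^ k ℤ.* residue y n) ℤ.-
                               b ℤ.* (5^ l′ ℤ.* residue x′ n ℤ.+ 5^ k′ ℤ.* residue y′ n)) (5^-+ k′ l′) (5^-+ k l))))
      (ℤ∣.∣m∣n⇒∣m+n (ℤ∣.∣n⇒∣m*n (5^ l ℤ.* 5^ l′) (p n)) (ℤ∣.∣n⇒∣m*n (5^ k ℤ.* 5^ k′) (q n)))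
    where
    combine : ∀ a a′ b b′ x x′ y y′ →
      b ℤ.* b′ ℤ.* (a′ ℤ.* x ℤ.- a ℤ.* x′) ℤ.+ a ℤ.* a′ ℤ.* (b′ ℤ.* y ℤ.- b ℤ.* y′) ≡
      a′ ℤ.* b′ ℤ.* (b ℤ.* x ℤ.+ a ℤ.* y) ℤ.- a ℤ.* b ℤ.* (b′ ℤ.* x′ ℤ.+ a′ ℤ.* y′)
    combine = solve-∀

  times : ∀ x x′ y y′ k k′ l l′ →
    fromℤ (5^ k′) *₅ x ≈₅ fromℤ (5^ k) *₅ x′ → fromℤ (5^ l′) *₅ y ≈₅ fromℤ (5^ l) *₅ y′ →
    fromℤ (5^ (k′ ℕ.+ l′)) *₅ (x *₅ y) ≈₅ fromℤ (5^ (k ℕ.+ l)) *₅ (x′ *₅ y′)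
  times x x′ y y′ k k′ l l′ p q n =
    ∣-resp (≡.trans
        (combine (5^ k) (5^ k′) (5^ l) (5^ l′) (residue x n) (residue x′ n) (residue y n) (residue y′ n))
        (≡.sym (cong₂ (λ a b → a ℤ.* (residue x n ℤ.* residue y n) ℤ.-
                               b ℤ.* (residue x′ n ℤ.* residue y′ n)) (5^-+ k′ l′) (5^-+ k l))))
      (ℤ∣.∣m∣n⇒∣m+n (ℤ∣.∣n⇒∣m*n (5^ l′ ℤ.* residue y n) (p n)) (ℤ∣.∣n⇒∣m*n (5^ k ℤ.* residue x′ n) (q n)))
    where
    combine : ∀ a a′ b b′ x x′ y y′ →
      b′ ℤ.* y ℤ.* (a′ ℤ.* x ℤ.- a ℤ.* x′) ℤ.+ a ℤ.* x′ ℤ.* (b′ ℤ.* y ℤ.- b ℤ.* y′) ≡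
      a′ ℤ.* b′ ℤ.* (x ℤ.* y) ℤ.- a ℤ.* b ℤ.* (x′ ℤ.* y′)
    combine = solve-∀

  neg : ∀ b x a y → ℤ.- (b ℤ.* x ℤ.- a ℤ.* y) ≡ b ℤ.* (ℤ.- x) ℤ.- a ℤ.* (ℤ.- y)
  neg = solve-∀

  assoc : ∀ k l m x y z →
    5^ (k ℕ.+ (l ℕ.+ m)) ℤ.* (5^ m ℤ.* (5^ l ℤ.* x ℤ.+ 5^ k ℤ.* y) ℤ.+ 5^ (k ℕ.+ l) ℤ.* z) ≡
    5^ (k ℕ.+ l ℕ.+ m) ℤ.* (5^ (l ℕ.+ m) ℤ.* x ℤ.+ 5^ k ℤ.* (5^ m ℤ.* y ℤ.+ 5^ l ℤ.* z))
  assoc k l m x y z = ≡.trans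
    (cong₂ (λ a b → a ℤ.* (5^ m ℤ.* (5^ l ℤ.* x ℤ.+ 5^ k ℤ.* y) ℤ.+ b ℤ.* z))
      (≡.trans (5^-+ k (l ℕ.+ m)) (cong (5^ k ℤ.*_) (5^-+ l m))) (5^-+ k l))
    (≡.trans (identity′ (5^ k) (5^ l) (5^ m) x y z)
    (≡.sym (cong₂ (λ a b → a ℤ.* (b ℤ.* x ℤ.+ 5^ k ℤ.* (5^ m ℤ.* y ℤ.+ 5^ l ℤ.* z)))
      (≡.trans (5^-+ (k ℕ.+ l) m) (cong (ℤ._* 5^ m) (5^-+ k l))) (5^-+ l m))))
    where
    identity′ : ∀ a b c x y z →
      a ℤ.* (b ℤ.* c) ℤ.* (c ℤ.* (b ℤ.* x ℤ.+ a ℤ.* y) ℤ.+ a ℤ.* b ℤ.* z) ≡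
      a ℤ.* b ℤ.* c ℤ.* (b ℤ.* c ℤ.* x ℤ.+ a ℤ.* (c ℤ.* y ℤ.+ b ℤ.* z))
    identity′ = solve-∀

  comm : ∀ k l x y → 5^ (l ℕ.+ k) ℤ.* (5^ l ℤ.* x ℤ.+ 5^ k ℤ.* y) ≡
                      5^ (k ℕ.+ l) ℤ.* (5^ k ℤ.* y ℤ.+ 5^ l ℤ.* x)
  comm k l x y = cong₂ ℤ._*_ (cong 5^ (ℕ.+-comm l k)) (ℤ.+-comm (5^ l ℤ.* x) (5^ k ℤ.* y))

  identity : ∀ a x → a ℤ.* (a ℤ.* 0ℤ ℤ.+ 1ℤ ℤ.* x) ≡ a ℤ.* x
  identity = solve-∀

  inverse : ∀ a x b → 1ℤ ℤ.* (a ℤ.* (ℤ.- x) ℤ.+ a ℤ.* x) ≡ b ℤ.* 0ℤ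
  inverse = solve-∀

  distrib : ∀ k l m x y z →
    5^ (k ℕ.+ l ℕ.+ (k ℕ.+ m)) ℤ.* (x ℤ.* (5^ m ℤ.* y ℤ.+ 5^ l ℤ.* z)) ≡
    5^ (k ℕ.+ (l ℕ.+ m)) ℤ.* (5^ (k ℕ.+ m) ℤ.* (x ℤ.* y) ℤ.+ 5^ (k ℕ.+ l) ℤ.* (x ℤ.* z))
  distrib k l m x y z = ≡.trans
    (cong (ℤ._* (x ℤ.* (5^ m ℤ.* y ℤ.+ 5^ l ℤ.* z)))
      (≡.trans (5^-+ (k ℕ.+ l) (k ℕ.+ m)) (cong₂ ℤ._*_ (5^-+ k l) (5^-+ k m))))
    (≡.trans (identity′ (5^ k) (5^ l) (5^ m) x y z)
    (≡.sym (cong₂ ℤ._*_ (≡.trans (5^-+ k (l ℕ.+ m)) (cong (5^ k ℤ.*_) (5^-+ l m)))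
      (cong₂ (λ a b → a ℤ.* (x ℤ.* y) ℤ.+ b ℤ.* (x ℤ.* z)) (5^-+ k m) (5^-+ k l)))))
    where
    identity′ : ∀ a b c x y z →
      a ℤ.* b ℤ.* (a ℤ.* c) ℤ.* (x ℤ.* (c ℤ.* y ℤ.+ b ℤ.* z)) ≡
      a ℤ.* (b ℤ.* c) ℤ.* (a ℤ.* c ℤ.* (x ℤ.* y) ℤ.+ a ℤ.* b ℤ.* (x ℤ.* z))
    identity′ = solve-∀

module ℚ₅ₚ = CommutativeRing (IsCRing.commutativeRing ℚ₅-isCRing)

fromℤ₅-+ : ∀ x y → fromℤ₅ (x +₅ y) ℚ₅ₚ.≈ fromℤ₅ x ℚ₅ₚ.+ fromℤ₅ y
fromℤ₅-+ x y n = ≡⇒∣ (identity (residue x n) (residue y n))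
  where
  identity : ∀ x y → 1ℤ ℤ.* (x ℤ.+ y) ≡ 1ℤ ℤ.* (1ℤ ℤ.* x ℤ.+ 1ℤ ℤ.* y)
  identity = solve-∀

fromℤ₅-hom : IsHom ℤ₅-ring ℚ₅-ring fromℤ₅
fromℤ₅-hom = ringHomomorphism ℤ₅-ring ℚ₅-ring fromℤ₅
  (λ {x} {y} → ℤ₅ₚ.*-congˡ {fromℤ 1ℤ} {x} {y})
  fromℤ₅-+
  (λ x y → ℚ₅ₚ.refl {fromℤ₅ (x *₅ y)})
  (λ x → ℚ₅ₚ.refl {fromℤ₅ (-₅ x)})
  (ℚ₅ₚ.refl {ℚ₅ₚ.0#}) (ℚ₅ₚ.refl {ℚ₅ₚ.1#})

-- 1/89 = - ∑ᵢ 90ⁱ, whose partial sums satisfy the recursion below.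
1/89 : ℤ₅
1/89 = mkℤ₅ partial λ n → ∣-resp (diff (partial n)) (89*partial n)
  where
  partial : ℕ → ℤ
  partial zero    = 0ℤ
  partial (suc n) = + 90 ℤ.* partial n ℤ.- 1ℤ

  diff : ∀ a → + 89 ℤ.* a ℤ.- 1ℤ ≡ + 90 ℤ.* a ℤ.- 1ℤ ℤ.- a
  diff = solve-∀

  89*partial : ∀ n → 5^ n ∣ + 89 ℤ.* partial n ℤ.- 1ℤ
  89*partial zero    = divides -[1+ 0 ] ≡.refl
  89*partial (suc n) with 89*partial n
  ... | divides q eq = divides (+ 18 ℤ.* q) (≡.trans (step (partial n))
    (≡.trans (cong (+ 90 ℤ.*_) eq)
    (≡.trans (shuffle q (5^ n)) (cong (+ 18 ℤ.* q ℤ.*_) (≡.sym (5^-suc n))))))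
    where
    step : ∀ a → + 89 ℤ.* (+ 90 ℤ.* a ℤ.- 1ℤ) ℤ.- 1ℤ ≡ + 90 ℤ.* (+ 89 ℤ.* a ℤ.- 1ℤ)
    step = solve-∀
    shuffle : ∀ q b → + 90 ℤ.* (q ℤ.* b) ≡ + 18 ℤ.* q ℤ.* (+ 5 ℤ.* b)
    shuffle = solve-∀

89*1/89≈1 : fromℤ (+ 89) *₅ 1/89 ≈₅ fromℤ 1ℤ
89*1/89≈1 n = ∣-resp (diff (residue 1/89 n)) (coherent 1/89 n)
  where
  diff : ∀ a → + 90 ℤ.* a ℤ.- 1ℤ ℤ.- a ≡ + 89 ℤ.* a ℤ.- 1ℤ
  diff = solve-∀

-- 445 = 81 P₅(1) P₅(-1), which up to the unit 81 is the resultant of `P₅` and A² - 1. It is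
-- divisible by 5, hence the denominator 5¹ and a Bézout identity over ℚ₅ rather than ℤ₅.
1/445 : ℚ₅
1/445 = 1/89 , 1

445*1/445≈1 : fromℤ₅ (fromℤ (+ 445)) ℚ₅ₚ.* 1/445 ℚ₅ₚ.≈ ℚ₅ₚ.1#
445*1/445≈1 n = ∣-resp (identity (residue 1/89 n)) (ℤ∣.∣n⇒∣m*n (+ 5) (89*1/89≈1 n))
  where
  identity : ∀ a → + 5 ℤ.* (+ 89 ℤ.* a ℤ.- 1ℤ) ≡ 1ℤ ℤ.* (+ 445 ℤ.* a) ℤ.- + 5 ℤ.* 1ℤ
  identity = solve-∀

module Bézout {R : RawRing 0ℓ 0ℓ} (R-ring : IsCRing R) {ψ : ℤ₅ → RawRing.Carrier R}
              (ψ-hom : IsHom ℤ₅-ring R ψ) where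
  open RawRing R using (Carrier; _≈_; _+_; _*_; -_; 0#; 1#)
  open CommutativeRing (IsCRing.commutativeRing R-ring)
    hiding (Carrier; _≈_; _+_; _*_; -_; 0#; 1#; rawRing)
  open ℤ₅-Algebra R-ring ψ-hom public

  -- (47 - 42X)(47 + 42X) = 445 - 42²(X² - 1) and 9P = 47 - 42X modulo X² - 1.
  bézout : ∀ X j → k (+ 445) * j ≈ k 1ℤ →
    (k (+ 423) * j + X * (k (+ 378) * j)) * P X +
    (k -[1+ 21 ] * j + X * (k -[1+ 608 ] * j + X * (k (+ 459) * j + X * (k -[1+ 377 ] * j)))) *
      (k -[1+ 0 ] + X * X) ≈ k 1ℤ
  bézout X j 445j≈1 = trans (reduce 3t≈1 (solve 3 (λ X j t →
      (con (+ 423) :* j :+ X :* (con (+ 378) :* j)) :*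
        (con 1ℤ :+ X :* (:- (con (+ 7) :* t) :+ X :* (con (+ 29) :* (t :* t) :+ X :* (:- (con (+ 7) :* t) :+ X :* con 1ℤ)))) :+
      (con -[1+ 21 ] :* j :+ X :* (con -[1+ 608 ] :* j :+ X :* (con (+ 459) :* j :+ X :* (con -[1+ 377 ] :* j)))) :*
        (con -[1+ 0 ] :+ X :* X) :=
      con (+ 445) :* j :+ (con 1ℤ :- con (+ 3) :* t) :*
        (j :* (con (+ 47) :+ con (+ 42) :* X) :*
          (con (+ 21) :* X :+ con (+ 21) :* (X :* (X :* X)) :- con (+ 29) :* (X :* X) :* (con 1ℤ :+ con (+ 3) :* t)))) refl X j t))
    445j≈1

module Coprimality where
  open Polynomial ℚ₅-ring
  open PowerSeries ℚ₅-ring using (const; T)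
  open SeriesRing ℚ₅-isCRing using (_⊕_; _⊛_; ⊕-unfold; seriesᵒ; seriesᵒ-isCRing; const-homᵒ)
  open PolynomialSeries ℚ₅-isCRing using (coeff-∷; coeff-mulₚ; coeff-addₚ)
  private
    module S = CommutativeRing (IsCRing.commutativeRing seriesᵒ-isCRing)
    module const = Morphism.IsRingHomomorphism const-homᵒ

    ψ-hom : IsHom ℤ₅-ring seriesᵒ (const ∘ fromℤ₅)
    ψ-hom = ∘-homomorphism {ℤ₅-ring} {ℚ₅-ring} {seriesᵒ} (λ {F} {G} {H} → S.trans {F} {G} {H}) fromℤ₅-hom const-homᵒ

    open Bézout seriesᵒ-isCRing ψ-hom

    -- A polynomial, seen as a series, is its own value at `T`. So `bézout` at X = T becomes an
    -- identity between coefficient sequences.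
    coeff≈eval : ∀ p → coeff p S.≈ Polynomial.eval seriesᵒ (map const p) T
    coeff≈eval []      = S.refl {S.0#}
    coeff≈eval (a ∷ p) = S.trans {coeff (a ∷ p)} {const a ⊕ T ⊛ coeff p} {const a ⊕ T ⊛ e} (coeff-∷ a p)
      (S.+-congˡ {const a} {T ⊛ coeff p} {T ⊛ e} (S.*-congˡ {T} {coeff p} {e} (coeff≈eval p)))
      where e = Polynomial.eval seriesᵒ (map const p) T

    J : ℕ → ℚ₅
    J = const 1/445

    scaled : ℤ → ℚ₅
    scaled a = fromℤ₅ (fromℤ a) ℚ₅ₚ.* 1/445

    U V : List ℚ₅
    U = scaled (+ 423) ∷ scaled (+ 378) ∷ []
    V = scaled -[1+ 21 ] ∷ scaled -[1+ 608 ] ∷ scaled (+ 459) ∷ scaled -[1+ 377 ] ∷ []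

    last : ∀ F → F ⊕ T ⊛ S.0# S.≈ F
    last F = S.trans {F ⊕ T ⊛ S.0#} {F ⊕ S.0#} {F} (S.+-congˡ {F} (S.zeroʳ T)) (S.+-identityʳ F)

    ∷≈ : ∀ {c} p {F G} → const c S.≈ F → coeff p S.≈ G → coeff (c ∷ p) S.≈ F ⊕ T ⊛ G
    ∷≈ {c} p {F} {G} c≈F p≈G = S.trans {coeff (c ∷ p)} {const c ⊕ T ⊛ coeff p} {F ⊕ T ⊛ G} (coeff-∷ c p)
      (S.+-cong {const c} {F} {T ⊛ coeff p} {T ⊛ G} c≈F (S.*-congˡ {T} {coeff p} {G} p≈G))

    [c]≈ : ∀ {c F} → const c S.≈ F → coeff (c ∷ []) S.≈ F
    [c]≈ {c} {F} c≈F = S.trans {coeff (c ∷ [])} {F ⊕ T ⊛ S.0#} {F}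
      (∷≈ [] {F} {S.0#} c≈F (S.refl {S.0#})) (last F)

    s≈ : ∀ a → const (scaled a) S.≈ k a ⊛ J
    s≈ a = const.*-homo (fromℤ₅ (fromℤ a)) 1/445

    A²-1≈ : coeff (map fromℤ₅ A²-1) S.≈ k -[1+ 0 ] ⊕ T ⊛ T
    A²-1≈ = ∷≈ (map fromℤ₅ (fromℤ 0ℤ ∷ fromℤ 1ℤ ∷ [])) {k -[1+ 0 ]} {T}
      (S.refl {k -[1+ 0 ]})
      (S.trans {coeff (map fromℤ₅ (fromℤ 0ℤ ∷ fromℤ 1ℤ ∷ []))} {S.0# ⊕ T ⊛ S.1#} {T}
        (∷≈ (map fromℤ₅ (fromℤ 1ℤ ∷ [])) {S.0#} {S.1#} const.0#-homo ([c]≈ {_} {S.1#} (S.refl {S.1#})))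
        (S.trans {S.0# ⊕ T ⊛ S.1#} {T ⊛ S.1#} {T} (S.+-identityˡ (T ⊛ S.1#)) (S.*-identityʳ T)))

    bezout-coeff : coeff U ⊛ coeff (map fromℤ₅ P₅) ⊕ coeff V ⊛ coeff (map fromℤ₅ A²-1) S.≈ S.1#
    bezout-coeff = S.trans {coeff U ⊛ p ⊕ coeff V ⊛ q} {U′ ⊛ P T ⊕ V′ ⊛ q′} {S.1#}
      (S.+-cong {coeff U ⊛ p} {U′ ⊛ P T} {coeff V ⊛ q} {V′ ⊛ q′}
        (S.*-cong {coeff U} {U′} {p} {P T} U≈
          (S.trans {p} {Polynomial.eval seriesᵒ (map (const ∘ fromℤ₅) P₅) T} {P T}
            (coeff≈eval (map fromℤ₅ P₅)) (eval-P₅ T)))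
        (S.*-cong {coeff V} {V′} {q} {q′} V≈ A²-1≈))
      (bézout T J (S.trans {k (+ 445) ⊛ J} {const (scaled (+ 445))} {S.1#}
        (S.sym {const (scaled (+ 445))} {k (+ 445) ⊛ J} (s≈ (+ 445))) (const.⟦⟧-cong 445*1/445≈1)))
      where
      p = coeff (map fromℤ₅ P₅)
      q = coeff (map fromℤ₅ A²-1)
      q′ = k -[1+ 0 ] ⊕ T ⊛ T
      V₃ = k -[1+ 377 ] ⊛ J
      V₂ = k (+ 459) ⊛ J ⊕ T ⊛ V₃
      V₁ = k -[1+ 608 ] ⊛ J ⊕ T ⊛ V₂
      V′ = k -[1+ 21 ] ⊛ J ⊕ T ⊛ V₁
      U′ = k (+ 423) ⊛ J ⊕ T ⊛ (k (+ 378) ⊛ J)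
      U≈ : coeff U S.≈ U′
      U≈ = ∷≈ _ {k (+ 423) ⊛ J} {k (+ 378) ⊛ J} (s≈ (+ 423)) ([c]≈ {_} {k (+ 378) ⊛ J} (s≈ (+ 378)))
      V≈ : coeff V S.≈ V′
      V≈ = ∷≈ _ {k -[1+ 21 ] ⊛ J} {V₁} (s≈ -[1+ 21 ])
        (∷≈ _ {k -[1+ 608 ] ⊛ J} {V₂} (s≈ -[1+ 608 ])
        (∷≈ _ {k (+ 459) ⊛ J} {V₃} (s≈ (+ 459))
        ([c]≈ {_} {V₃} (s≈ -[1+ 377 ]))))

  P₅-coprime-A²-1 : Coprimeℚ₅[A] P₅ A²-1
  P₅-coprime-A²-1 {d} d∣P d∣Q = addₚ (mulₚ U a) (mulₚ V b) RawMagma., λ n →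
    S.trans {coeff (mulₚ w d)} {coeff w ⊛ coeff d} {coeff [ ℚ₅ₚ.1# ]} (coeff-mulₚ w d)
      (S.trans {coeff w ⊛ coeff d} {coeff U ⊛ p ⊕ coeff V ⊛ q} {coeff [ ℚ₅ₚ.1# ]} w*d
        (S.trans {coeff U ⊛ p ⊕ coeff V ⊛ q} {S.1#} {coeff [ ℚ₅ₚ.1# ]} bezout-coeff
          (S.sym {coeff [ ℚ₅ₚ.1# ]} {S.1#} ([c]≈ {_} {S.1#} (S.refl {S.1#}))))) n
    where
    a = RawMagma._∣ʳ_.quotient d∣P
    b = RawMagma._∣ʳ_.quotient d∣Q
    w = addₚ (mulₚ U a) (mulₚ V b)
    p = coeff (map fromℤ₅ P₅)
    q = coeff (map fromℤ₅ A²-1)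
    open ≈-Reasoning S.setoid
    half : ∀ r c f → coeff (mulₚ c d) S.≈ f → coeff (mulₚ r c) ⊛ coeff d S.≈ coeff r ⊛ f
    half r c f eq = begin
      coeff (mulₚ r c) ⊛ coeff d         ≈⟨ S.*-congʳ {coeff d} (coeff-mulₚ r c) ⟩
      coeff r ⊛ coeff c ⊛ coeff d        ≈⟨ S.*-assoc (coeff r) (coeff c) (coeff d) ⟩
      coeff r ⊛ (coeff c ⊛ coeff d)      ≈⟨ S.*-congˡ {coeff r} (coeff-mulₚ c d) ⟨
      coeff r ⊛ coeff (mulₚ c d)         ≈⟨ S.*-congˡ {coeff r} eq ⟩
      coeff r ⊛ f                        ∎
    w*d : coeff w ⊛ coeff d S.≈ coeff U ⊛ p ⊕ coeff V ⊛ q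
    w*d = begin
      coeff w ⊛ coeff d
        ≈⟨ S.*-congʳ {coeff d} {coeff w} {coeff (mulₚ U a) ⊕ coeff (mulₚ V b)} (λ n →
             ℚ₅ₚ.trans {coeff w n} {coeff (mulₚ U a) n ℚ₅ₚ.+ coeff (mulₚ V b) n} {(coeff (mulₚ U a) ⊕ coeff (mulₚ V b)) n}
             (coeff-addₚ (mulₚ U a) (mulₚ V b) n)
             (ℚ₅ₚ.sym {(coeff (mulₚ U a) ⊕ coeff (mulₚ V b)) n} {coeff (mulₚ U a) n ℚ₅ₚ.+ coeff (mulₚ V b) n} (⊕-unfold (coeff (mulₚ U a)) (coeff (mulₚ V b)) n))) ⟩
      (coeff (mulₚ U a) ⊕ coeff (mulₚ V b)) ⊛ coeff d
        ≈⟨ S.distribʳ (coeff d) (coeff (mulₚ U a)) (coeff (mulₚ V b)) ⟩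
      coeff (mulₚ U a) ⊛ coeff d ⊕ coeff (mulₚ V b) ⊛ coeff d
        ≈⟨ S.+-cong {coeff (mulₚ U a) ⊛ coeff d} {coeff U ⊛ p} {coeff (mulₚ V b) ⊛ coeff d} {coeff V ⊛ q}
             (half U a p (RawMagma._∣ʳ_.equality d∣P)) (half V b q (RawMagma._∣ʳ_.equality d∣Q)) ⟩
      coeff U ⊛ p ⊕ coeff V ⊛ q ∎

-- The resultant

open PowerSeries ℤ₅-ring using (const; T)

open SeriesRing ℤ₅-isCRing public
  using (_⊕_; _⊛_; ⊖_; ⊕-unfold; ⊛-unfold; ⊖-unfold; T-⊛-zero; T-⊛-suc; const-⊛)
  renaming (seriesᵒ to Λᵒ; seriesᵒ-isCRing to Λᵒ-isCRing; const-homᵒ to const-hom)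

module Λₚ = CommutativeRing (IsCRing.commutativeRing Λᵒ-isCRing)
module Λ^ = SemiringDefs Λ.rawSemiring

z≈1+T : z Λ.≈ Λ.1# ⊕ T
z≈1+T n = ℤ₅ₚ.sym {(Λ.1# ⊕ T) n} {z n} (⊕-unfold Λ.1# T n)

z⊛z⁻¹≈1 : z ⊛ z⁻¹ Λ.≈ Λ.1#
z⊛z⁻¹≈1 = SeriesRing.1+T-inverse ℤ₅-isCRing z z⁻¹ z≈1+T (ℤ₅ₚ.refl {fromℤ 1ℤ}) (λ n → ℤ₅ₚ.refl {z⁻¹ (suc n)})

private
  +⇒⊕ : ∀ {F F′ G G′} → F Λ.≈ F′ → G Λ.≈ G′ → F Λ.+ G Λ.≈ F′ ⊕ G′
  +⇒⊕ {F} {F′} {G} {G′} p q = Λₚ.trans {F Λ.+ G} {F ⊕ G} {F′ ⊕ G′}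
    (Λₚ.sym {F ⊕ G} {F Λ.+ G} (⊕-unfold F G)) (Λₚ.+-cong {F} {F′} {G} {G′} p q)

  *⇒⊛ : ∀ {F F′ G G′} → F Λ.≈ F′ → G Λ.≈ G′ → F Λ.* G Λ.≈ F′ ⊛ G′
  *⇒⊛ {F} {F′} {G} {G′} p q = Λₚ.trans {F Λ.* G} {F ⊛ G} {F′ ⊛ G′}
    (Λₚ.sym {F ⊛ G} {F Λ.* G} (⊛-unfold F G)) (Λₚ.*-cong {F} {F′} {G} {G′} p q)

  -- Over a variable ring `refl` has only the recursion of the power to unfold. Used at Λ as an
  -- equation, it exposes one factor before the sealed product takes over.
  ^-unfold : ∀ (R : RawRing 0ℓ 0ℓ) → let open SemiringDefs (RawRing.rawSemiring R) in
             ∀ x k → x ^ (suc k) ≡ RawRing._*_ R x (x ^ k)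
  ^-unfold R x k = ≡.refl

  ^-suc : ∀ F k {G} → F Λ^.^ k Λ.≈ G → F Λ^.^ (suc k) Λ.≈ F ⊛ G
  ^-suc F k {G} p = ≡.subst (Λ._≈ F ⊛ G) (≡.sym (^-unfold Λ F k)) (*⇒⊛ {F} {F} {F Λ^.^ k} {G} (Λₚ.refl {F}) p)

  ^2⇒ : ∀ F → F Λ^.^ 2 Λ.≈ F ⊛ F
  ^2⇒ F = ^-suc F 1 {F} (Λₚ.trans {F Λ^.^ 1} {F ⊛ Λ.1#} {F}
    (^-suc F 0 {Λ.1#} (Λₚ.refl {Λ.1#})) (Λₚ.*-identityʳ F))

  ^4⇒ : ∀ F → F Λ^.^ 4 Λ.≈ F ⊛ F ⊛ (F ⊛ F)
  ^4⇒ F = Λₚ.trans {F Λ^.^ 4} {F ⊛ (F ⊛ (F ⊛ F))} {F ⊛ F ⊛ (F ⊛ F)}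
    (^-suc F 3 {F ⊛ (F ⊛ F)} (^-suc F 2 {F ⊛ F} (^2⇒ F)))
    (Λₚ.sym {F ⊛ F ⊛ (F ⊛ F)} {F ⊛ (F ⊛ (F ⊛ F))} (Λₚ.*-assoc F F (F ⊛ F)))

module Λ-ring = ℤ₅-Algebra Λᵒ-isCRing const-hom

Φ₅≈ : ∀ F → Φ₅ F Λ.≈ Λ-ring.Φ F
Φ₅≈ F = +⇒⊕ {Λ.1# Λ.+ F Λ.+ F Λ^.^ 2 Λ.+ F Λ^.^ 3} {_} {F Λ^.^ 4} {_}
  (+⇒⊕ {Λ.1# Λ.+ F Λ.+ F Λ^.^ 2} {_} {F Λ^.^ 3} {_}
    (+⇒⊕ {Λ.1# Λ.+ F} {_} {F Λ^.^ 2} {_}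
      (+⇒⊕ {Λ.1#} {Λ-ring.k 1ℤ} {F} {F} (Λₚ.refl {Λ.1#}) (Λₚ.refl {F}))
      (^2⇒ F))
    (^-suc F 2 {F ⊛ F} (^2⇒ F)))
  (^4⇒ F)

⅑ₛ : Λ.Carrier
⅑ₛ = const ⅓ ⊛ const ⅓

Φ₅²/81z⁴≈ : Φ₅²/81z⁴ Λ.≈ ⅑ₛ ⊛ ⅑ₛ ⊛ (Λ-ring.Φ z ⊛ Λ-ring.Φ z) ⊛ (z⁻¹ ⊛ z⁻¹ ⊛ (z⁻¹ ⊛ z⁻¹))
Φ₅²/81z⁴≈ = *⇒⊛ {const (⅑ *₅ ⅑) Λ.* Φ₅ z Λ^.^ 2} {_} {z⁻¹ Λ^.^ 4} {_}
  (*⇒⊛ {const (⅑ *₅ ⅑)} {_} {Φ₅ z Λ^.^ 2} {_}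
    (Λₚ.trans {const (⅑ *₅ ⅑)} {const ⅑ ⊛ const ⅑} {⅑ₛ ⊛ ⅑ₛ} (const.*-homo ⅑ ⅑)
      (Λₚ.*-cong {const ⅑} {⅑ₛ} {const ⅑} {⅑ₛ} (const.*-homo ⅓ ⅓) (const.*-homo ⅓ ⅓)))
    (Λₚ.trans {Φ₅ z Λ^.^ 2} {Φ₅ z ⊛ Φ₅ z} {Λ-ring.Φ z ⊛ Λ-ring.Φ z} (^2⇒ (Φ₅ z))
      (Λₚ.*-cong {Φ₅ z} {Λ-ring.Φ z} {Φ₅ z} {Λ-ring.Φ z} (Φ₅≈ z) (Φ₅≈ z))))
  (^4⇒ z⁻¹)
  where module const = Morphism.IsRingHomomorphism const-hom

trace : Λ.Carrier
trace = const ⅓ Λ.* (z Λ.+ z⁻¹ Λ.+ const (fromℤ (+ 4)))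

module Λ-Algebra {R : RawRing 0ℓ 0ℓ} (R-ring : IsCRing R) {φ : Λ.Carrier → RawRing.Carrier R}
                 (φ-hom : IsHom Λ R φ) where
  open RawRing R using (Carrier; _≈_; _+_; _*_; -_; 0#; 1#)
  open CommutativeRing (IsCRing.commutativeRing R-ring)
    hiding (Carrier; _≈_; _+_; _*_; -_; 0#; 1#; rawRing)
  open Polynomial R
  open ≈-Reasoning setoid
  private
    module φ = Morphism.IsRingHomomorphism φ-hom

  φᵒ-hom : IsHom Λᵒ R φ
  φᵒ-hom = ringHomomorphism Λᵒ R φ φ.⟦⟧-cong
    (λ F G → trans (φ.⟦⟧-cong (⊕-unfold F G)) (φ.+-homo F G))
    (λ F G → trans (φ.⟦⟧-cong (⊛-unfold F G)) (φ.*-homo F G))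
    (λ F → trans (φ.⟦⟧-cong (⊖-unfold F)) (φ.-‿homo F))
    φ.0#-homo φ.1#-homo

  private
    module φᵒ = Morphism.IsRingHomomorphism φᵒ-hom

  open ℤ₅-Algebra R-ring (∘-homomorphism {ℤ₅-ring} {Λᵒ} {R} trans const-hom φᵒ-hom)

  private
    1→k : ∀ {x} → x ≈ 1# → x ≈ k 1ℤ
    1→k p = trans p (sym k.1#-homo)

    square-homo : ∀ F → φ (F ⊛ F) ≈ φ F * φ F
    square-homo F = φᵒ.*-homo F F

    fourth-homo : ∀ F → φ (F ⊛ F ⊛ (F ⊛ F)) ≈ φ F * φ F * (φ F * φ F)
    fourth-homo F = trans (φᵒ.*-homo (F ⊛ F) (F ⊛ F)) (*-cong (square-homo F) (square-homo F))

  Φ-homo : ∀ F → φ (Λ-ring.Φ F) ≈ Φ (φ F)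
  Φ-homo F = begin
    φ (Λ-ring.Φ F)
      ≈⟨ φᵒ.+-homo (Λ-ring.k 1ℤ ⊕ F ⊕ F ⊛ F ⊕ F ⊛ (F ⊛ F)) (F ⊛ F ⊛ (F ⊛ F)) ⟩
    φ (Λ-ring.k 1ℤ ⊕ F ⊕ F ⊛ F ⊕ F ⊛ (F ⊛ F)) + φ (F ⊛ F ⊛ (F ⊛ F))
      ≈⟨ +-cong (φᵒ.+-homo (Λ-ring.k 1ℤ ⊕ F ⊕ F ⊛ F) (F ⊛ (F ⊛ F))) (fourth-homo F) ⟩
    φ (Λ-ring.k 1ℤ ⊕ F ⊕ F ⊛ F) + φ (F ⊛ (F ⊛ F)) + φ F * φ F * (φ F * φ F)
      ≈⟨ +-congʳ (+-cong (φᵒ.+-homo (Λ-ring.k 1ℤ ⊕ F) (F ⊛ F))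
                         (trans (φᵒ.*-homo F (F ⊛ F)) (*-congˡ (square-homo F)))) ⟩
    φ (Λ-ring.k 1ℤ ⊕ F) + φ (F ⊛ F) + φ F * (φ F * φ F) + φ F * φ F * (φ F * φ F)
      ≈⟨ +-congʳ (+-congʳ (+-cong (φᵒ.+-homo (Λ-ring.k 1ℤ) F) (square-homo F))) ⟩
    Φ (φ F) ∎

  Φ₅²/81z⁴-homo : φ Φ₅²/81z⁴ ≈
    (t * t) * (t * t) * (Φ (φ z) * Φ (φ z)) * ((φ z⁻¹ * φ z⁻¹) * (φ z⁻¹ * φ z⁻¹))
  Φ₅²/81z⁴-homo = begin
    φ Φ₅²/81z⁴
      ≈⟨ φ.⟦⟧-cong Φ₅²/81z⁴≈ ⟩
    φ (⅑ₛ ⊛ ⅑ₛ ⊛ (Λ-ring.Φ z ⊛ Λ-ring.Φ z) ⊛ (z⁻¹ ⊛ z⁻¹ ⊛ (z⁻¹ ⊛ z⁻¹)))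
      ≈⟨ φᵒ.*-homo (⅑ₛ ⊛ ⅑ₛ ⊛ (Λ-ring.Φ z ⊛ Λ-ring.Φ z)) (z⁻¹ ⊛ z⁻¹ ⊛ (z⁻¹ ⊛ z⁻¹)) ⟩
    φ (⅑ₛ ⊛ ⅑ₛ ⊛ (Λ-ring.Φ z ⊛ Λ-ring.Φ z)) * φ (z⁻¹ ⊛ z⁻¹ ⊛ (z⁻¹ ⊛ z⁻¹))
      ≈⟨ *-cong (φᵒ.*-homo (⅑ₛ ⊛ ⅑ₛ) (Λ-ring.Φ z ⊛ Λ-ring.Φ z)) (fourth-homo z⁻¹) ⟩
    φ (⅑ₛ ⊛ ⅑ₛ) * φ (Λ-ring.Φ z ⊛ Λ-ring.Φ z) * ((φ z⁻¹ * φ z⁻¹) * (φ z⁻¹ * φ z⁻¹))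
      ≈⟨ *-congʳ (*-cong (fourth-homo (const ⅓))
                         (trans (square-homo (Λ-ring.Φ z)) (*-cong (Φ-homo z) (Φ-homo z)))) ⟩
    (t * t) * (t * t) * (Φ (φ z) * Φ (φ z)) * ((φ z⁻¹ * φ z⁻¹) * (φ z⁻¹ * φ z⁻¹)) ∎

  φz*φz⁻¹≈1 : φ z * φ z⁻¹ ≈ k 1ℤ
  φz*φz⁻¹≈1 = trans (sym (φᵒ.*-homo z z⁻¹)) (φ.⟦⟧-cong z⊛z⁻¹≈1)

  trace-homo : φ trace ≈ t * (φ z + φ z⁻¹ + k (+ 4))
  trace-homo = trans (φ.*-homo (const ⅓) (z Λ.+ z⁻¹ Λ.+ const (fromℤ (+ 4))))
    (*-congˡ (trans (φ.+-homo (z Λ.+ z⁻¹) (const (fromℤ (+ 4)))) (+-congʳ (φ.+-homo z z⁻¹))))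

  resultant-value : ∀ α β → α * β ≈ 1# → α + β ≈ φ trace →
    φ Φ₅²/81z⁴ ≈ foldr (λ α y → eval (map φ (map const P₅)) α * y) 1# (α ∷ β ∷ [])
  resultant-value α β αβ≈1 α+β = begin
    φ Φ₅²/81z⁴
      ≈⟨ Φ₅²/81z⁴-homo ⟩
    (t * t) * (t * t) * (Φ (φ z) * Φ (φ z)) * ((φ z⁻¹ * φ z⁻¹) * (φ z⁻¹ * φ z⁻¹))
      ≈⟨ PαPβ α β (φ z) (φ z⁻¹) (1→k αβ≈1) φz*φz⁻¹≈1 (trans α+β trace-homo) ⟨
    P α * P β
      ≈⟨ *-cong (eval-P₅ α) (eval-P₅ β) ⟨
    eval (map φ (map const P₅)) α * eval (map φ (map const P₅)) β
      ≈⟨ *-congˡ (*-identityʳ _) ⟨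
    eval (map φ (map const P₅)) α * (eval (map φ (map const P₅)) β * 1#) ∎

  -- A splitting of the wrong degree yields 1 ≈ 0 in the splitting ring. There the resultant formula
  -- holds because any two elements agree.
  trivial : 1# ≈ 0# → ∀ x y → x ≈ y
  trivial 1≈0 x y = begin
    x        ≈⟨ *-identityˡ x ⟨
    1# * x   ≈⟨ trans (*-congʳ 1≈0) (zeroˡ x) ⟩
    0#       ≈⟨ trans (*-congʳ 1≈0) (zeroˡ y) ⟨
    1# * y   ≈⟨ *-identityˡ y ⟩
    y        ∎

  fromRoots-pair : ∀ α β →
    coeff (fromRoots (α ∷ β ∷ [])) 0 ≈ α * β × coeff (fromRoots (α ∷ β ∷ [])) 1 ≈ - (α + β)
  fromRoots-pair α β =
    ( begin
      - α * (- β * 1# + 0#) + 0#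
        ≈⟨ trans (+-identityʳ _) (*-congˡ (trans (+-identityʳ _) (*-identityʳ _))) ⟩
      - α * - β
        ≈⟨ solve 2 (λ α β → :- α :* :- β := α :* β) refl α β ⟩
      α * β ∎)
    , ( begin
      - α * (1# * 1# + 0#) + (1# * (- β * 1# + 0#) + 0#)
        ≈⟨ +-cong (trans (*-congˡ (trans (+-identityʳ _) (*-identityˡ _))) (*-identityʳ _))
                  (trans (+-identityʳ _) (trans (*-identityˡ _) (trans (+-identityʳ _) (*-identityʳ _)))) ⟩
      - α + - β
        ≈⟨ solve 2 (λ α β → :- α :+ :- β := :- (α :+ β)) refl α β ⟩
      - (α + β) ∎)

-- Unless 0 = 1, comparing leading coefficients shows that F-X splits into two linear factors.
Φ₅²/81z⁴-isResultant : Is-R-X P₅ Φ₅²/81z⁴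
Φ₅²/81z⁴-isResultant L φ φ-mono = roots
  where
  open CommutativeRing L
  open Polynomial rawRing
  module φ = Morphism.IsRingMonomorphism φ-mono
  open Λ-Algebra (isCRing L) φ.isRingHomomorphism
  open PolynomialSeries (isCRing L) using (fromRoots-monic)
  open RingProperties ring using (-‿injective)

  roots : ∀ αs → map φ F-X ≋ fromRoots αs →
          φ Φ₅²/81z⁴ ≈ foldr (λ α y → eval (map φ (map const P₅)) α * y) 1# αs
  roots []           eq = trivial (trans (sym φ.1#-homo) (eq 2)) _ _
  roots (α ∷ [])     eq = trivial (trans (sym φ.1#-homo) (eq 2)) _ _
  roots (α ∷ β ∷ []) eq = resultant-value α β
    (trans (sym (proj₁ (fromRoots-pair α β))) (trans (sym (eq 0)) φ.1#-homo))
    (-‿injective (trans (sym (proj₂ (fromRoots-pair α β)))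
                        (trans (sym (eq 1)) (φ.-‿homo trace))))
  roots αs@(_ ∷ _ ∷ _ ∷ _) eq =
    trivial (trans (sym (fromRoots-monic αs)) (sym (eq (length αs)))) _ _

-- R[A]/(A² - sA + 1), with (a , b) standing for a + bA.
module QuadraticExtension {R : RawRing 0ℓ 0ℓ} (R-ring : IsCRing R) {φ : ℤ → RawRing.Carrier R}
                          (φ-hom : IsHom ℤ-ring R φ) (s : RawRing.Carrier R) where
  open RawRing R using (Carrier; _≈_; _+_; _*_; -_; 0#; 1#)
  open CommutativeRing (IsCRing.commutativeRing R-ring)
    hiding (Carrier; _≈_; _+_; _*_; -_; 0#; 1#; rawRing)
  open ℤSolver R-ring φ-hom
  open RingProperties ring using (-0#≈0#)
  open ≈-Reasoning setoid

  extension : RawRing 0ℓ 0ℓ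
  extension = record
    { Carrier = Carrier × Carrier
    ; _≈_     = λ (a , b) (c , d) → a ≈ c × b ≈ d
    ; _+_     = λ (a , b) (c , d) → a + c , b + d
    ; _*_     = λ (a , b) (c , d) → a * c + - (b * d) , a * d + b * c + s * (b * d)
    ; -_      = λ (a , b) → - a , - b
    ; 0#      = 0# , 0#
    ; 1#      = 1# , 0#
    }

  private
    module E = RawRing extension

    ⊛-assoc : ∀ x y z → (x E.* y) E.* z E.≈ x E.* (y E.* z)
    ⊛-assoc (a , b) (c , d) (e , f) =
      solve 7 (λ a b c d e f s →
        (a :* c :- b :* d) :* e :- (a :* d :+ b :* c :+ s :* (b :* d)) :* f :=
        a :* (c :* e :- d :* f) :- b :* (c :* f :+ d :* e :+ s :* (d :* f))) refl a b c d e f s ,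
      solve 7 (λ a b c d e f s →
        (a :* c :- b :* d) :* f :+ (a :* d :+ b :* c :+ s :* (b :* d)) :* e :+ s :* ((a :* d :+ b :* c :+ s :* (b :* d)) :* f) :=
        a :* (c :* f :+ d :* e :+ s :* (d :* f)) :+ b :* (c :* e :- d :* f) :+ s :* (b :* (c :* f :+ d :* e :+ s :* (d :* f))))
        refl a b c d e f s

    ⊛-comm : ∀ x y → x E.* y E.≈ y E.* x
    ⊛-comm (a , b) (c , d) =
      solve 4 (λ a b c d → a :* c :- b :* d := c :* a :- d :* b) refl a b c d ,
      solve 5 (λ a b c d s → a :* d :+ b :* c :+ s :* (b :* d) := c :* b :+ d :* a :+ s :* (d :* b)) refl a b c d s

    ⊛-distribˡ : ∀ x y z → x E.* (y E.+ z) E.≈ x E.* y E.+ x E.* z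
    ⊛-distribˡ (a , b) (c , d) (e , f) =
      solve 6 (λ a b c d e f → a :* (c :+ e) :- b :* (d :+ f) := (a :* c :- b :* d) :+ (a :* e :- b :* f)) refl a b c d e f ,
      solve 7 (λ a b c d e f s → a :* (d :+ f) :+ b :* (c :+ e) :+ s :* (b :* (d :+ f)) :=
        (a :* d :+ b :* c :+ s :* (b :* d)) :+ (a :* f :+ b :* e :+ s :* (b :* f))) refl a b c d e f s

    *ˡ-base : ∀ a c d → (a , 0#) E.* (c , d) E.≈ (a * c , a * d)
    *ˡ-base a c d =
      (begin
        a * c - 0# * d   ≈⟨ +-congˡ (trans (-‿cong (zeroˡ d)) -0#≈0#) ⟩
        a * c + 0#       ≈⟨ +-identityʳ _ ⟩
        a * c            ∎) ,
      (begin
        a * d + 0# * c + s * (0# * d)   ≈⟨ +-cong (+-congˡ (zeroˡ c)) (trans (*-congˡ (zeroˡ d)) (zeroʳ s)) ⟩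
        a * d + 0# + 0#                 ≈⟨ trans (+-identityʳ _) (+-identityʳ _) ⟩
        a * d                           ∎)

  extension-isCRing : IsCRing extension
  extension-isCRing = record
    { isEquivalence = record
      { refl  = refl , refl
      ; sym   = λ (p , q) → sym p , sym q
      ; trans = λ (p , q) (r , t) → trans p r , trans q t
      }
    ; +-cong      = λ (p , q) (r , t) → +-cong p r , +-cong q t
    ; *-cong      = λ (p , q) (r , t) → +-cong (*-cong p r) (-‿cong (*-cong q t)) ,
                      +-cong (+-cong (*-cong p t) (*-cong q r)) (*-congˡ (*-cong q t))
    ; -‿cong      = λ (p , q) → -‿cong p , -‿cong q
    ; +-assoc     = λ (a , b) (c , d) (e , f) → +-assoc a c e , +-assoc b d f
    ; +-comm      = λ (a , b) (c , d) → +-comm a c , +-comm b d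
    ; +-identityˡ = λ (a , b) → +-identityˡ a , +-identityˡ b
    ; -‿inverseˡ  = λ (a , b) → -‿inverseˡ a , -‿inverseˡ b
    ; *-assoc     = ⊛-assoc
    ; *-comm      = ⊛-comm
    ; *-identityˡ = λ (a , b) → trans (proj₁ (*ˡ-base 1# a b)) (*-identityˡ a) ,
                                trans (proj₂ (*ˡ-base 1# a b)) (*-identityˡ b)
    ; distribˡ    = ⊛-distribˡ
    }

  base : Carrier → Carrier × Carrier
  base a = a , 0#

  base-mono : Morphism.IsRingMonomorphism R extension base
  base-mono = record
    { isRingHomomorphism = ringHomomorphism R extension base
        (λ p → p , refl)
        (λ _ _ → refl , sym (+-identityʳ 0#))
        (λ a b → sym (proj₁ (*ˡ-base a b 0#)) , sym (trans (proj₂ (*ˡ-base a b 0#)) (zeroʳ a)))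
        (λ _ → refl , sym -0#≈0#)
        (refl , refl) (refl , refl)
    ; injective = proj₁
    }

  root conjugate : Carrier × Carrier
  root      = 0# , 1#
  conjugate = s , - 1#

  root*conjugate : root E.* conjugate E.≈ E.1#
  root*conjugate =
    (begin
      0# * s - 1# * - 1#   ≈⟨ +-cong (zeroˡ s) (-‿cong (*-identityˡ _)) ⟩
      0# - - 1#            ≈⟨ +-identityˡ _ ⟩
      - - 1#               ≈⟨ solve 1 (λ a → :- (:- a) := a) refl 1# ⟩
      1#                   ∎) ,
    (begin
      0# * - 1# + 1# * s + s * (1# * - 1#)   ≈⟨ +-cong (+-cong (zeroˡ _) (*-identityˡ s)) (*-congˡ (*-identityˡ _)) ⟩
      0# + s + s * - 1#                      ≈⟨ +-cong (+-identityˡ s) (solve 2 (λ s a → s :* :- a := :- (s :* a)) refl s 1#) ⟩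
      s - s * 1#                             ≈⟨ +-congˡ (-‿cong (*-identityʳ s)) ⟩
      s - s                                  ≈⟨ -‿inverseʳ s ⟩
      0#                                     ∎)

  root+conjugate : root E.+ conjugate E.≈ base s
  root+conjugate = +-identityˡ s , -‿inverseʳ 1#


-- The roots A and s - A of F-X in Λ[A]/(F-X) determine the resultant.
resultant-unique : ∀ R → Is-R-X P₅ R → R Λ.≈ Φ₅²/81z⁴
resultant-unique R R-res = proj₁
  (L.trans {base R} {value} {base Φ₅²/81z⁴} (R-res L base base-mono αs split)
    (L.sym {base Φ₅²/81z⁴} {value} (Φ₅²/81z⁴-isResultant L base base-mono αs split)))
  where
  open QuadraticExtension Λᵒ-isCRing Λ-ring.k-hom trace
    renaming (base-mono to baseᵒ-mono)
  L : CommutativeRing 0ℓ 0ℓ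
  L = IsCRing.commutativeRing extension-isCRing
  module L = CommutativeRing L
  module baseᵒ = Morphism.IsRingMonomorphism baseᵒ-mono
  module E = RawRing extension

  -- `IsResultant` speaks of Λ with its original operations, while the extension is built over the
  -- sealed `Λᵒ`. The unfolding lemmas carry the homomorphism laws from one to the other.
  base-mono : Morphism.IsRingMonomorphism Λ extension base
  base-mono = record
    { isRingHomomorphism = ringHomomorphism Λ extension base
        (λ p → p , Λₚ.refl {Λ.0#})
        (λ F G → L.trans {base (F Λ.+ G)} {base (F ⊕ G)} {base F E.+ base G}
          (Λₚ.sym {F ⊕ G} {F Λ.+ G} (⊕-unfold F G) , Λₚ.refl {Λ.0#}) (baseᵒ.+-homo F G))
        (λ F G → L.trans {base (F Λ.* G)} {base (F ⊛ G)} {base F E.* base G}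
          (Λₚ.sym {F ⊛ G} {F Λ.* G} (⊛-unfold F G) , Λₚ.refl {Λ.0#}) (baseᵒ.*-homo F G))
        (λ F → L.trans {base (Λ.- F)} {base (⊖ F)} {E.- base F}
          (Λₚ.sym {⊖ F} {Λ.- F} (⊖-unfold F) , Λₚ.refl {Λ.0#}) (baseᵒ.-‿homo F))
        (L.refl {E.0#}) (L.refl {E.1#})
    ; injective = proj₁
    }

  module φ = Morphism.IsRingMonomorphism base-mono
  open Λ-Algebra extension-isCRing φ.isRingHomomorphism using (fromRoots-pair)
  open PolynomialSeries extension-isCRing using (fromRoots-monic; coeff-fromRoots->)
  open Polynomial extension

  αs : List (Λ.Carrier × Λ.Carrier)
  αs = root ∷ conjugate ∷ []

  value : Λ.Carrier × Λ.Carrier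
  value = foldr (λ α y → eval (map base (map const P₅)) α E.* y) E.1# αs

  split : map base F-X ≋ fromRoots αs
  split 0 = L.trans {E.1#} {root E.* conjugate} {coeff (fromRoots αs) 0}
    (L.sym {root E.* conjugate} {E.1#} root*conjugate)
    (L.sym {coeff (fromRoots αs) 0} {root E.* conjugate} (proj₁ (fromRoots-pair root conjugate)))
  split 1 = L.trans {base (Λ.- trace)} {E.- base trace} {coeff (fromRoots αs) 1} (φ.-‿homo trace)
    (L.trans {E.- base trace} {E.- (root E.+ conjugate)} {coeff (fromRoots αs) 1}
      (L.-‿cong {base trace} {root E.+ conjugate} (L.sym {root E.+ conjugate} {base trace} root+conjugate))
      (L.sym {coeff (fromRoots αs) 1} {E.- (root E.+ conjugate)} (proj₂ (fromRoots-pair root conjugate))))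
  split 2 = L.sym {coeff (fromRoots αs) 2} {E.1#} (fromRoots-monic αs)
  split (suc (suc (suc n))) = L.sym {coeff (fromRoots αs) (3 ℕ.+ n)} {E.0#} (coeff-fromRoots-> αs n)

-- The invariants μ and λ

∣-≤ : ∀ {d n} → n ℕ.< d → d ℕ∣.∣ n → n ≡ 0
∣-≤ {n = zero}  _   _   = ≡.refl
∣-≤ {n = suc n} n<d d∣n = contradiction d∣n (ℕ∣.>⇒∤ n<d)

∣⇒%ℕ≡0 : ∀ a d .{{_ : NonZero d}} → + d ∣ a → a %ℕ d ≡ 0
∣⇒%ℕ≡0 a d d∣a = ∣-≤ (n%ℕd<d a d) (ℤ∣.∣⇒∣ᵤ (∣-resp
  (≡.trans (cong (ℤ._- q) (a≡a%ℕn+[a/ℕn]*n a d)) (cancel (+ (a %ℕ d)) q))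
  (ℤ∣.∣m∣n⇒∣m-n d∣a (divides (a /ℕ d) ≡.refl))))
  where
  q = (a /ℕ d) ℤ.* + d
  cancel : ∀ r q → r ℤ.+ q ℤ.- q ≡ r
  cancel = solve-∀

%ℕ≡0⇒∣ : ∀ a d .{{_ : NonZero d}} → a %ℕ d ≡ 0 → + d ∣ a
%ℕ≡0⇒∣ a d eq = divides (a /ℕ d) (≡.trans (a≡a%ℕn+[a/ℕn]*n a d)
  (≡.trans (cong (λ r → + r ℤ.+ (a /ℕ d) ℤ.* + d) eq) (ℤ.+-identityˡ _)))

reduction≡0⇔ : ∀ F i → (+ 5 ∣ residue (F i) 1 → reduction F i ≡ 0F) ×
                        (reduction F i ≡ 0F → + 5 ∣ residue (F i) 1)
reduction≡0⇔ F i =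
  (λ 5∣a → Fin.toℕ-injective (≡.trans (Fin.toℕ-fromℕ< _) (∣⇒%ℕ≡0 (residue (F i) 1) 5 5∣a))) ,
  (λ eq → %ℕ≡0⇒∣ (residue (F i) 1) 5 (≡.trans (≡.sym (Fin.toℕ-fromℕ< _)) (cong toℕ eq)))

module Invariants (R : Λ.Carrier) (R≈ : R Λ.≈ Φ₅²/81z⁴) where

  5∣R⇔ : ∀ i → (+ 5 ∣ residue (Φ₅²/81z⁴ i) 1 → + 5 ∣ residue (R i) 1) ×
               (+ 5 ∣ residue (R i) 1 → + 5 ∣ residue (Φ₅²/81z⁴ i) 1)
  5∣R⇔ i =
    (λ d → ∣-resp (add (residue (R i) 1) (residue (Φ₅²/81z⁴ i) 1)) (ℤ∣.∣m∣n⇒∣m+n (R≈ i 1) d)) ,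
    (λ d → ∣-resp (sub (residue (R i) 1) (residue (Φ₅²/81z⁴ i) 1)) (ℤ∣.∣m∣n⇒∣m-n d (R≈ i 1)))
    where
    add : ∀ a b → (a ℤ.- b) ℤ.+ b ≡ a
    add = solve-∀
    sub : ∀ a b → a ℤ.- (a ℤ.- b) ≡ b
    sub = solve-∀

  -- Modulo 5, Φ₅(1 + T) is T⁴, and 81z⁴ is a unit, so the reduction is T⁸ times a unit. In practice
  -- the residues modulo 5 of the coefficients 0 to 8 are computed and tested.
  order : IsOrder (reduction R) 8
  order = (λ i i<8 → proj₁ (reduction≡0⇔ R i) (proj₁ (5∣R⇔ i) (low i<8))) ,
          (λ eq → high (proj₂ (5∣R⇔ 8) (proj₂ (reduction≡0⇔ R 8) eq)))
    where
    low : ∀ {i} → i ℕ.< 8 → + 5 ∣ residue (Φ₅²/81z⁴ i) 1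
    low = from-yes (ℕ.allUpTo? (λ i → + 5 ∣? residue (Φ₅²/81z⁴ i) 1) 8)
    high : ¬ + 5 ∣ residue (Φ₅²/81z⁴ 8) 1
    high = from-no (+ 5 ∣? residue (Φ₅²/81z⁴ 8) 1)

  decomposition : IsDecomposition R 0 R
  decomposition =
    (λ i → ℤ₅ₚ.sym {(one Λ.* R) i} {R i}
      (ℤ₅ₚ.trans {(one Λ.* R) i} {(one ⊛ R) i} {R i}
        (ℤ₅ₚ.sym {(one ⊛ R) i} {(one Λ.* R) i} (⊛-unfold one R i))
        (Λₚ.*-identityˡ R i))) ,
    (λ 5∣R → proj₂ order (proj₁ (reduction≡0⇔ R 8)
      (5∣Q*5 (RawMagma._∣ʳ_.quotient 5∣R) (RawMagma._∣ʳ_.equality 5∣R))))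
    where
    one = const (fromℤ (5^ 0))

    5∣Q*5 : ∀ Q → Q Λ.* const (fromℤ (+ 5)) Λ.≈ R → + 5 ∣ residue (R 8) 1
    5∣Q*5 Q eq = ∣-resp (combine (residue (R 8) 1) (residue ((Q ⊛ five) 8) 1) (residue (Q 8) 1))
      (ℤ∣.∣m∣n⇒∣m+n (ℤ∣.∣m∣n⇒∣m-n (5Q 1) (Q5≈R 1)) (ℤ∣.∣m⇒∣m*n (residue (Q 8) 1) ℤ∣.∣-refl))
      where
      five = const (fromℤ (+ 5))
      Q5≈R : (Q ⊛ five) 8 ≈₅ R 8
      Q5≈R = ℤ₅ₚ.trans {(Q ⊛ five) 8} {(Q Λ.* five) 8} {R 8} (⊛-unfold Q five 8) (eq 8)
      5Q : (Q ⊛ five) 8 ≈₅ fromℤ (+ 5) *₅ Q 8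
      5Q = ℤ₅ₚ.trans {(Q ⊛ five) 8} {(five ⊛ Q) 8} {fromℤ (+ 5) *₅ Q 8} (Λₚ.*-comm Q five 8) (const-⊛ (fromℤ (+ 5)) Q 8)
      combine : ∀ r q s → (q ℤ.- + 5 ℤ.* s) ℤ.- (q ℤ.- r) ℤ.+ + 5 ℤ.* s ≡ r
      combine = solve-∀

  μ≡0 : μ-invariant R 0
  μ≡0 = R , decomposition

  λ≡8 : λ-invariant R 8
  λ≡8 = 0 , R , decomposition , order

id-hom : IsHom ℤ₅-ring ℤ₅-ring (λ x → x)
id-hom = ringHomomorphism ℤ₅-ring ℤ₅-ring (λ x → x) (λ {x} {y} p → p)
  (λ x y → ℤ₅ₚ.refl {x +₅ y}) (λ x y → ℤ₅ₚ.refl {x *₅ y}) (λ x → ℤ₅ₚ.refl { -₅ x})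
  (ℤ₅ₚ.refl {fromℤ 0ℤ}) (ℤ₅ₚ.refl {fromℤ 1ℤ})

module _ where
  open ℤ₅-Algebra ℤ₅-isCRing id-hom

  P₅[1]≈5/9 : Polynomial.eval ℤ₅-ring P₅ (fromℤ 1ℤ) ≈₅ fromℤ (+ 5) *₅ ⅑
  P₅[1]≈5/9 = ℤ₅ₚ.trans {Polynomial.eval ℤ₅-ring P₅ (fromℤ 1ℤ)} {P (fromℤ 1ℤ)} {fromℤ (+ 5) *₅ ⅑}
    (eval-P₅ (fromℤ 1ℤ)) P[1]

  P₅[-1]≈89/9 : Polynomial.eval ℤ₅-ring P₅ (-₅ fromℤ 1ℤ) ≈₅ fromℤ (+ 89) *₅ ⅑
  P₅[-1]≈89/9 = ℤ₅ₚ.trans {Polynomial.eval ℤ₅-ring P₅ (-₅ fromℤ 1ℤ)} {P (-₅ fromℤ 1ℤ)} {fromℤ (+ 89) *₅ ⅑}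
    (eval-P₅ (-₅ fromℤ 1ℤ)) P[-1]

-- Nakayama's lemma and 5-adic convergence

module Span {R : RawRing 0ℓ 0ℓ} (R-ring : IsCRing R) {ψ : ℤ₅ → RawRing.Carrier R}
            (ψ-hom : IsHom ℤ₅-ring R ψ) where
  open RawRing R using (Carrier; _≈_; _+_; _*_; -_; 0#; 1#)
  open CommutativeRing (IsCRing.commutativeRing R-ring)
    hiding (Carrier; _≈_; _+_; _*_; -_; 0#; 1#; rawRing)
  open ℤ₅-Algebra R-ring ψ-hom
  open PowerSeries R using (Σ[i<_])
  open Summation R-ring
  open ≈-Reasoning setoid

  module _ (e : ℕ → Carrier) where

    Combination : ℕ → Carrier → Set
    Combination d y = ∃ λ (c : ℕ → ℤ₅) → y ≈ Σ[i< d ] (λ i → ψ (c i) * e i)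

    combination-cong : ∀ {d y w} → w ≈ y → Combination d y → Combination d w
    combination-cong w≈y (c , eq) = c , trans w≈y eq

    combination-+ : ∀ d {y w} → Combination d y → Combination d w → Combination d (y + w)
    combination-+ d {y} {w} (b , p) (c , q) = (λ i → b i +₅ c i) , (begin
      y + w
        ≈⟨ +-cong p q ⟩
      Σ[i< d ] (λ i → ψ (b i) * e i) + Σ[i< d ] (λ i → ψ (c i) * e i)
        ≈⟨ Σ-+ d (λ i → ψ (b i) * e i) (λ i → ψ (c i) * e i) ⟨
      Σ[i< d ] (λ i → ψ (b i) * e i + ψ (c i) * e i)
        ≈⟨ Σ-cong d (λ i _ → trans (*-congʳ (ψ.+-homo (b i) (c i))) (distribʳ (e i) _ _)) ⟨
      Σ[i< d ] (λ i → ψ (b i +₅ c i) * e i) ∎)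

    combination-* : ∀ d a {y} → Combination d y → Combination d (ψ a * y)
    combination-* d a {y} (c , p) = (λ i → a *₅ c i) , (begin
      ψ a * y
        ≈⟨ *-congˡ p ⟩
      ψ a * Σ[i< d ] (λ i → ψ (c i) * e i)
        ≈⟨ Σ-*ˡ d (ψ a) (λ i → ψ (c i) * e i) ⟨
      Σ[i< d ] (λ i → ψ a * (ψ (c i) * e i))
        ≈⟨ Σ-cong d (λ i _ → trans (*-congʳ (ψ.*-homo a (c i))) (*-assoc _ _ _)) ⟨
      Σ[i< d ] (λ i → ψ (a *₅ c i) * e i) ∎)

    -- The elements 1 + 5a are closed under products, so the elimination clears a generator by
    -- multiplying with them instead of dividing. In the end it matters only that 1 + 5a is not 0 in
    -- Ω.
    u : ℤ₅ → Carrier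
    u a = k 1ℤ + k (+ 5) * ψ a

    private
      pull : ∀ a c {y s w} → u a * y ≈ k (+ 5) * (s + ψ c * w) →
             u a * y ≈ k (+ 5) * s + k (+ 5) * ψ c * w
      pull a c eq = trans eq (trans (distribˡ _ _ _) (+-congˡ (sym (*-assoc _ _ _))))

      solve-last : ∀ a c {y s} → u a * y ≈ k (+ 5) * (s + ψ c * y) → u (a +₅ -₅ c) * y ≈ k (+ 5) * s
      solve-last a c {y} {s} eq = begin
        u (a +₅ -₅ c) * y
          ≈⟨ *-congʳ (+-congˡ (*-congˡ (trans (ψ.+-homo a (-₅ c)) (+-congˡ (ψ.-‿homo c))))) ⟩
        (k 1ℤ + k (+ 5) * (ψ a + - ψ c)) * y
          ≈⟨ solve 3 (λ a c y → (con 1ℤ :+ con (+ 5) :* (a :+ :- c)) :* y :=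
               (con 1ℤ :+ con (+ 5) :* a) :* y :- con (+ 5) :* c :* y) refl (ψ a) (ψ c) y ⟩
        u a * y + - (k (+ 5) * ψ c * y)
          ≈⟨ +-congʳ (pull a c eq) ⟩
        k (+ 5) * s + k (+ 5) * ψ c * y + - (k (+ 5) * ψ c * y)
          ≈⟨ trans (+-assoc _ _ _) (trans (+-congˡ (-‿inverseʳ _)) (+-identityʳ _)) ⟩
        k (+ 5) * s ∎

      u-* : ∀ a b → u a * u b ≈ u (a +₅ b +₅ fromℤ (+ 5) *₅ (a *₅ b))
      u-* a b = begin
        u a * u b
          ≈⟨ solve 2 (λ a b → (con 1ℤ :+ con (+ 5) :* a) :* (con 1ℤ :+ con (+ 5) :* b) :=
               con 1ℤ :+ con (+ 5) :* (a :+ b :+ con (+ 5) :* (a :* b))) refl (ψ a) (ψ b) ⟩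
        k 1ℤ + k (+ 5) * (ψ a + ψ b + k (+ 5) * (ψ a * ψ b))
          ≈⟨ +-congˡ (*-congˡ (+-cong (ψ.+-homo a b)
               (trans (ψ.*-homo (fromℤ (+ 5)) (a *₅ b)) (*-congˡ (ψ.*-homo a b))))) ⟨
        k 1ℤ + k (+ 5) * (ψ (a +₅ b) + ψ (fromℤ (+ 5) *₅ (a *₅ b)))
          ≈⟨ +-congˡ (*-congˡ (ψ.+-homo (a +₅ b) (fromℤ (+ 5) *₅ (a *₅ b)))) ⟨
        u (a +₅ b +₅ fromℤ (+ 5) *₅ (a *₅ b)) ∎

      ψu : ∀ a → ψ (fromℤ 1ℤ +₅ fromℤ (+ 5) *₅ a) ≈ u a
      ψu a = trans (ψ.+-homo (fromℤ 1ℤ) (fromℤ (+ 5) *₅ a)) (+-congˡ (ψ.*-homo (fromℤ (+ 5)) a))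

    -- If the span M of e satisfies M = 5M, eliminating generators one by one kills e 0 up to
    -- an element of 1 + 5ℤ₅.
    nakayama : ∀ d → (∀ j → j ℕ.< suc d → ∃ λ a → ∃ λ y → Combination (suc d) y × u a * e j ≈ k (+ 5) * y) →
               ∃ λ a → u a * e 0 ≈ 0#
    nakayama zero    h with h 0 (ℕ.s≤s ℕ.z≤n)
    ... | a , y , (c , y≈) , eq = a +₅ -₅ c 0 , trans (solve-last a (c 0) (trans eq (*-congˡ y≈))) (zeroʳ _)
    nakayama (suc d) h with h (suc d) (ℕ.n<1+n (suc d))
    ... | a , y , (c , y≈) , eq = nakayama d eliminated
      where
      b = a +₅ -₅ c (suc d)
      last = solve-last a (c (suc d)) (trans eq (*-congˡ y≈))
      S = Σ[i< suc d ] (λ i → ψ (c i) * e i)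
      eliminated : ∀ j → j ℕ.< suc d → ∃ λ a → ∃ λ y → Combination (suc d) y × u a * e j ≈ k (+ 5) * y
      eliminated j j<1+d with h j (ℕ.m<n⇒m<1+n j<1+d)
      ... | a′ , y′ , (c′ , y′≈) , eq′ =
        b +₅ a′ +₅ fromℤ (+ 5) *₅ (b *₅ a′) ,
        ψ (fromℤ 1ℤ +₅ fromℤ (+ 5) *₅ b) * S′ + ψ (fromℤ (+ 5) *₅ cⱼ) * S ,
        combination-+ (suc d) (combination-* (suc d) (fromℤ 1ℤ +₅ fromℤ (+ 5) *₅ b) (c′ , refl))
                              (combination-* (suc d) (fromℤ (+ 5) *₅ cⱼ) (c , refl)) ,
        (begin
          u (b +₅ a′ +₅ fromℤ (+ 5) *₅ (b *₅ a′)) * e j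
            ≈⟨ *-congʳ (u-* b a′) ⟨
          u b * u a′ * e j
            ≈⟨ *-assoc _ _ _ ⟩
          u b * (u a′ * e j)
            ≈⟨ *-congˡ (pull a′ cⱼ (trans eq′ (*-congˡ y′≈))) ⟩
          u b * (k (+ 5) * S′ + k (+ 5) * ψ cⱼ * e (suc d))
            ≈⟨ solve 4 (λ u s c e → u :* (con (+ 5) :* s :+ con (+ 5) :* c :* e) :=
                 con (+ 5) :* (u :* s) :+ con (+ 5) :* c :* (u :* e)) refl (u b) S′ (ψ cⱼ) (e (suc d)) ⟩
          k (+ 5) * (u b * S′) + k (+ 5) * ψ cⱼ * (u b * e (suc d))
            ≈⟨ +-congˡ (*-congˡ last) ⟩
          k (+ 5) * (u b * S′) + k (+ 5) * ψ cⱼ * (k (+ 5) * S)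
            ≈⟨ solve 4 (λ u s c t → con (+ 5) :* (u :* s) :+ con (+ 5) :* c :* (con (+ 5) :* t) :=
                 con (+ 5) :* (u :* s :+ con (+ 5) :* c :* t)) refl (u b) S′ (ψ cⱼ) S ⟩
          k (+ 5) * (u b * S′ + k (+ 5) * ψ cⱼ * S)
            ≈⟨ *-congˡ (+-cong (*-congʳ (ψu b)) (*-congʳ (ψ.*-homo (fromℤ (+ 5)) cⱼ))) ⟨
          k (+ 5) * (ψ (fromℤ 1ℤ +₅ fromℤ (+ 5) *₅ b) * S′ + ψ (fromℤ (+ 5) *₅ cⱼ) * S) ∎)
        where
        cⱼ = c′ (suc d)
        S′ = Σ[i< suc d ] (λ i → ψ (c′ i) * e i)

-- Evaluation of power series at x in the 5-adic topology of ℤ₅[x]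

module Adjoin {R : RawRing 0ℓ 0ℓ} (R-ring : IsCRing R) {ψ : ℤ₅ → RawRing.Carrier R}
              (ψ-hom : IsHom ℤ₅-ring R ψ) (x : RawRing.Carrier R) where
  open RawRing R using (Carrier; _≈_; _+_; _*_; -_; 0#; 1#)
  open CommutativeRing (IsCRing.commutativeRing R-ring)
    hiding (Carrier; _≈_; _+_; _*_; -_; 0#; 1#; rawRing)
  open ℤ₅-Algebra R-ring ψ-hom
  open Polynomial R using (eval)
  open Polynomial ℤ₅-ring using (addₚ; mulₚ)
  open PowerSeries R using (Σ[i<_])
  open SemiringDefs (RawRing.rawSemiring R) using (_^_)
  open Summation R-ring
  open RingProperties ring using (-‿distribʳ-*)
  open Exp semiring using (^-homo-*)
  open ≈-Reasoning setoid

  InA : Carrier → Set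
  InA y = ∃ λ as → y ≈ eval (map ψ as) x

  private
    eval-add : ∀ p q → eval (map ψ (addₚ p q)) x ≈ eval (map ψ p) x + eval (map ψ q) x
    eval-add []      q       = sym (+-identityˡ _)
    eval-add (a ∷ p) []      = sym (+-identityʳ _)
    eval-add (a ∷ p) (b ∷ q) = begin
      ψ (a +₅ b) + x * eval (map ψ (addₚ p q)) x
        ≈⟨ +-cong (ψ.+-homo a b) (*-congˡ (eval-add p q)) ⟩
      ψ a + ψ b + x * (eval (map ψ p) x + eval (map ψ q) x)
        ≈⟨ solve 5 (λ a b x p q → a :+ b :+ x :* (p :+ q) := a :+ x :* p :+ (b :+ x :* q))
             refl (ψ a) (ψ b) x (eval (map ψ p) x) (eval (map ψ q) x) ⟩
      eval (map ψ (a ∷ p)) x + eval (map ψ (b ∷ q)) x ∎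

    eval-scale : ∀ a q → eval (map ψ (map (a *₅_) q)) x ≈ ψ a * eval (map ψ q) x
    eval-scale a []      = sym (zeroʳ _)
    eval-scale a (b ∷ q) = begin
      ψ (a *₅ b) + x * eval (map ψ (map (a *₅_) q)) x
        ≈⟨ +-cong (ψ.*-homo a b) (*-congˡ (eval-scale a q)) ⟩
      ψ a * ψ b + x * (ψ a * eval (map ψ q) x)
        ≈⟨ solve 4 (λ a b x q → a :* b :+ x :* (a :* q) := a :* (b :+ x :* q))
             refl (ψ a) (ψ b) x (eval (map ψ q) x) ⟩
      ψ a * eval (map ψ (b ∷ q)) x ∎

    eval-mul : ∀ p q → eval (map ψ (mulₚ p q)) x ≈ eval (map ψ p) x * eval (map ψ q) x
    eval-mul []      q = sym (zeroˡ _)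
    eval-mul (a ∷ p) q = begin
      eval (map ψ (addₚ (map (a *₅_) q) (fromℤ 0ℤ ∷ mulₚ p q))) x
        ≈⟨ eval-add (map (a *₅_) q) (fromℤ 0ℤ ∷ mulₚ p q) ⟩
      eval (map ψ (map (a *₅_) q)) x + (k 0ℤ + x * eval (map ψ (mulₚ p q)) x)
        ≈⟨ +-cong (eval-scale a q) (+-congˡ (*-congˡ (eval-mul p q))) ⟩
      ψ a * eval (map ψ q) x + (k 0ℤ + x * (eval (map ψ p) x * eval (map ψ q) x))
        ≈⟨ solve 4 (λ a x p q → a :* q :+ (con 0ℤ :+ x :* (p :* q)) := (a :+ x :* p) :* q)
             refl (ψ a) x (eval (map ψ p) x) (eval (map ψ q) x) ⟩
      eval (map ψ (a ∷ p)) x * eval (map ψ q) x ∎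

  A-cong : ∀ {y w} → w ≈ y → InA y → InA w
  A-cong w≈y (as , eq) = as , trans w≈y eq

  A-ψ : ∀ a → InA (ψ a)
  A-ψ a = a ∷ [] , sym (trans (+-congˡ (zeroʳ x)) (+-identityʳ _))

  A-+ : ∀ {y w} → InA y → InA w → InA (y + w)
  A-+ (p , y≈) (q , w≈) = addₚ p q , trans (+-cong y≈ w≈) (sym (eval-add p q))

  A-* : ∀ {y w} → InA y → InA w → InA (y * w)
  A-* (p , y≈) (q , w≈) = mulₚ p q , trans (*-cong y≈ w≈) (sym (eval-mul p q))

  A-neg : ∀ {y} → InA y → InA (- y)
  A-neg {y} Ay = A-cong (solve 1 (λ y → :- y := con -[1+ 0 ] :* y) refl y) (A-* (A-ψ (fromℤ -[1+ 0 ])) Ay)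

  A-1 : InA 1#
  A-1 = A-cong (sym k.1#-homo) (A-ψ (fromℤ 1ℤ))

  A-x : InA x
  A-x = fromℤ 0ℤ ∷ fromℤ 1ℤ ∷ [] , sym (begin
    k 0ℤ + x * (k 1ℤ + x * 0#)   ≈⟨ +-cong k.0#-homo (*-congˡ (trans (+-cong k.1#-homo (zeroʳ x)) (+-identityʳ _))) ⟩
    0# + x * 1#                   ≈⟨ trans (+-identityˡ _) (*-identityʳ x) ⟩
    x                             ∎)

  A-^ : ∀ {y} n → InA y → InA (y ^ n)
  A-^ zero    Ay = A-1
  A-^ (suc n) Ay = A-* Ay (A-^ n Ay)

  -- Membership in the ideal 5ᵐℤ₅[x]. These ideals are the neighbourhoods of 0 and take the place of
  -- an absolute value on Ω.
  record D (m : ℕ) (y : Carrier) : Set where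
    constructor multiple
    field
      quotient   : Carrier
      quotient∈A : InA quotient
      equation   : y ≈ k (5^ m) * quotient

  D-cong : ∀ {m y w} → w ≈ y → D m y → D m w
  D-cong w≈y (multiple v Av eq) = multiple v Av (trans w≈y eq)

  D-+ : ∀ {m y w} → D m y → D m w → D m (y + w)
  D-+ (multiple v Av p) (multiple v′ Av′ q) =
    multiple (v + v′) (A-+ Av Av′) (trans (+-cong p q) (sym (distribˡ _ _ _)))

  D-*A : ∀ {m y a} → D m y → InA a → D m (y * a)
  D-*A {a = a} (multiple v Av p) Aa = multiple (v * a) (A-* Av Aa) (trans (*-congʳ p) (*-assoc _ _ _))

  D-A* : ∀ {m y a} → InA a → D m y → D m (a * y)
  D-A* Aa Dy = D-cong (*-comm _ _) (D-*A Dy Aa)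

  D-neg : ∀ {m y} → D m y → D m (- y)
  D-neg (multiple v Av p) = multiple (- v) (A-neg Av) (trans (-‿cong p) (-‿distribʳ-* _ _))

  D-0 : ∀ m → D m 0#
  D-0 m = multiple 0# (A-cong (sym k.0#-homo) (A-ψ (fromℤ 0ℤ))) (sym (zeroʳ _))

  D-* : ∀ m n {y w} → D m y → D n w → D (m ℕ.+ n) (y * w)
  D-* m n {y} {w} (multiple v Av p) (multiple v′ Av′ q) = multiple (v * v′) (A-* Av Av′) (begin
    y * w
      ≈⟨ *-cong p q ⟩
    k (5^ m) * v * (k (5^ n) * v′)
      ≈⟨ solve 4 (λ a b v w → a :* v :* (b :* w) := a :* b :* (v :* w)) refl (k (5^ m)) (k (5^ n)) v v′ ⟩
    k (5^ m) * k (5^ n) * (v * v′)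
      ≈⟨ *-congʳ (trans (k.⟦⟧-cong (5^-+ m n)) (k.*-homo (5^ m) (5^ n))) ⟨
    k (5^ (m ℕ.+ n)) * (v * v′) ∎)

  S : (ℕ → ℤ₅) → ℕ → Carrier
  S F M = Σ[i< M ] (λ i → ψ (F i) * x ^ i)

  Converges : (ℕ → ℤ₅) → Carrier → Set
  Converges F v = ∀ m → ∃ λ M₀ → ∀ M → M₀ ℕ.≤ M → D m (v + - S F M)

  private
    S-cong : ∀ {F G} → F Λ.≈ G → ∀ M → S F M ≈ S G M
    S-cong F≈G M = Σ-cong M λ i _ → *-congʳ (ψ.⟦⟧-cong (F≈G i))

    S-⊕ : ∀ F G M → S (F ⊕ G) M ≈ S F M + S G M
    S-⊕ F G M = trans
      (Σ-cong M λ i _ → trans (*-congʳ (trans (ψ.⟦⟧-cong (⊕-unfold F G i)) (ψ.+-homo (F i) (G i)))) (distribʳ _ _ _))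
      (Σ-+ M (λ i → ψ (F i) * x ^ i) (λ i → ψ (G i) * x ^ i))

    S-const : ∀ a F M → S (const a ⊛ F) M ≈ ψ a * S F M
    S-const a F M = trans
      (Σ-cong M λ i _ → trans (*-congʳ (trans (ψ.⟦⟧-cong (const-⊛ a F i)) (ψ.*-homo a (F i)))) (*-assoc _ _ _))
      (Σ-*ˡ M (ψ a) (λ i → ψ (F i) * x ^ i))

    S-T : ∀ F M → S (T ⊛ F) (suc M) ≈ x * S F M
    S-T F M = begin
      S (T ⊛ F) (suc M)
        ≈⟨ Σ-suc M (λ i → ψ ((T ⊛ F) i) * x ^ i) ⟩
      ψ ((T ⊛ F) 0) * 1# + Σ[i< M ] (λ i → ψ ((T ⊛ F) (suc i)) * (x * x ^ i))
        ≈⟨ +-cong (trans (*-congʳ (trans (ψ.⟦⟧-cong (T-⊛-zero F)) k.0#-homo)) (zeroˡ _))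
                  (Σ-cong M λ i _ → trans (*-congʳ (ψ.⟦⟧-cong (T-⊛-suc F i)))
                    (solve 3 (λ a x y → a :* (x :* y) := x :* (a :* y)) refl (ψ (F i)) x (x ^ i))) ⟩
      0# + Σ[i< M ] (λ i → x * (ψ (F i) * x ^ i))
        ≈⟨ trans (+-identityˡ _) (Σ-*ˡ M x (λ i → ψ (F i) * x ^ i)) ⟩
      x * S F M ∎

  converges-cong : ∀ {F G v w} → F Λ.≈ G → v ≈ w → Converges F v → Converges G w
  converges-cong F≈G v≈w C m with C m
  ... | M₀ , h = M₀ , λ M M₀≤M → D-cong (+-cong (sym v≈w) (-‿cong (sym (S-cong F≈G M)))) (h M M₀≤M)

  converges-⊕ : ∀ {F G v w} → Converges F v → Converges G w → Converges (F ⊕ G) (v + w)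
  converges-⊕ {F} {G} {v} {w} C C′ m with C m | C′ m
  ... | M₀ , h | M₁ , h′ = M₀ ℕ.⊔ M₁ , λ M M₀⊔M₁≤M → D-cong
    (trans (+-congˡ (-‿cong (S-⊕ F G M)))
      (solve 4 (λ v w s t → v :+ w :+ :- (s :+ t) := (v :+ :- s) :+ (w :+ :- t)) refl v w (S F M) (S G M)))
    (D-+ (h M (ℕ.m⊔n≤o⇒m≤o M₀ M₁ M₀⊔M₁≤M)) (h′ M (ℕ.m⊔n≤o⇒n≤o M₀ M₁ M₀⊔M₁≤M)))

  converges-const : ∀ a {F v} → Converges F v → Converges (const a ⊛ F) (ψ a * v)
  converges-const a {F} {v} C m with C m
  ... | M₀ , h = M₀ , λ M M₀≤M → D-cong
    (trans (+-congˡ (-‿cong (S-const a F M)))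
      (solve 3 (λ a v s → a :* v :+ :- (a :* s) := a :* (v :+ :- s)) refl (ψ a) v (S F M)))
    (D-A* (A-ψ a) (h M M₀≤M))

  converges-T : ∀ {F v} → Converges F v → Converges (T ⊛ F) (x * v)
  converges-T {F} {v} C m with C m
  -- Multiplication by `T` shifts partial sums by one index, so the first suc M terms of the product
  -- correspond to the first M terms of F.
  ... | M₀ , h = suc M₀ , λ where
    (suc M) (ℕ.s≤s M₀≤M) → D-cong
      (trans (+-congˡ (-‿cong (S-T F M)))
        (solve 3 (λ a v s → a :* v :+ :- (a :* s) := a :* (v :+ :- s)) refl x v (S F M)))
      (D-A* A-x (h M M₀≤M))

  converges-1 : Converges Λ.1# 1#
  converges-1 m = 1 , λ where
    (suc M) _ → D-cong (begin
      1# + - S Λ.1# (suc M)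
        ≈⟨ +-congˡ (-‿cong (trans (Σ-suc M (λ i → ψ (Λ.1# i) * x ^ i))
             (+-cong (trans (*-congʳ k.1#-homo) (*-identityˡ _))
                     (Σ-zero M λ i → trans (*-congʳ k.0#-homo) (zeroˡ _))))) ⟩
      1# + - (1# + 0#)
        ≈⟨ +-congˡ (-‿cong (+-identityʳ _)) ⟩
      1# + - 1#
        ≈⟨ -‿inverseʳ _ ⟩
      0# ∎) (D-0 m)

  -- Separatedness of the topology is not established here, so two limits are compared modulo each
  -- 5ᵐ: both are close to one common partial sum.
  converges-unique : ∀ {F v w} → Converges F v → Converges F w → ∀ m → D m (v + - w)
  converges-unique {F} {v} {w} C C′ m with C m | C′ m
  ... | M₀ , h | M₁ , h′ = D-cong
    (solve 3 (λ v w s → v :+ :- w := (v :+ :- s) :+ :- (w :+ :- s)) refl v w (S F M))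
    (D-+ (h M (ℕ.m≤m⊔n M₀ M₁)) (D-neg (h′ M (ℕ.m≤n⊔m M₀ M₁))))
    where M = M₀ ℕ.⊔ M₁

  -- Evaluation at x sends G to g; only such continuous multipliers are needed, so limits of
  -- arbitrary series are never constructed.
  Multiplier : (ℕ → ℤ₅) → Carrier → Set
  Multiplier G g = ∀ {F v} → Converges F v → Converges (G ⊛ F) (g * v)

  multiplier-const : ∀ a → Multiplier (const a) (ψ a)
  multiplier-const a = converges-const a

  multiplier-⊕ : ∀ {G H g h} → Multiplier G g → Multiplier H h → Multiplier (G ⊕ H) (g + h)
  multiplier-⊕ {G} {H} {g} {h} Mg Mh {F} {v} C = converges-cong {(G ⊛ F) ⊕ (H ⊛ F)} {(G ⊕ H) ⊛ F}
    (Λₚ.sym {(G ⊕ H) ⊛ F} {(G ⊛ F) ⊕ (H ⊛ F)} (Λₚ.distribʳ F G H)) (sym (distribʳ v g h))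
    (converges-⊕ {G ⊛ F} {H ⊛ F} (Mg {F} C) (Mh {F} C))

  multiplier-⊛ : ∀ {G H g h} → Multiplier G g → Multiplier H h → Multiplier (G ⊛ H) (g * h)
  multiplier-⊛ {G} {H} {g} {h} Mg Mh {F} {v} C = converges-cong {G ⊛ (H ⊛ F)} {(G ⊛ H) ⊛ F}
    (Λₚ.sym {(G ⊛ H) ⊛ F} {G ⊛ (H ⊛ F)} (Λₚ.*-assoc G H F)) (sym (*-assoc g h v))
    (Mg {H ⊛ F} (Mh {F} C))

  multiplier-converges : ∀ {G g} → Multiplier G g → Converges G g
  multiplier-converges {G} {g} Mg = converges-cong {G ⊛ Λ.1#} {G} (Λₚ.*-identityʳ G) (*-identityʳ g)
    (Mg {Λ.1#} converges-1)

  multiplier-z : Multiplier z (1# + x)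
  multiplier-z {F} {v} C = converges-cong {F ⊕ T ⊛ F} {z ⊛ F}
    (Λₚ.sym {z ⊛ F} {F ⊕ T ⊛ F} (Λₚ.trans {z ⊛ F} {(Λ.1# ⊕ T) ⊛ F} {F ⊕ T ⊛ F}
      (Λₚ.*-congʳ {F} {z} {Λ.1# ⊕ T} z≈1+T)
      (Λₚ.trans {(Λ.1# ⊕ T) ⊛ F} {Λ.1# ⊛ F ⊕ T ⊛ F} {F ⊕ T ⊛ F} (Λₚ.distribʳ F Λ.1# T)
        (Λₚ.+-congʳ {T ⊛ F} {Λ.1# ⊛ F} {F} (Λₚ.*-identityˡ F)))))
    (sym (trans (distribʳ v 1# x) (+-congʳ (*-identityˡ v))))
    (converges-⊕ {F} {T ⊛ F} C (converges-T {F} C))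

  multiplier-Φ : ∀ {G g} → Multiplier G g → Multiplier (Λ-ring.Φ G) (Φ g)
  multiplier-Φ {G} {g} Mg =
    multiplier-⊕ {Λ-ring.k 1ℤ ⊕ G ⊕ G ⊛ G ⊕ G ⊛ (G ⊛ G)} {G ⊛ G ⊛ (G ⊛ G)}
      (multiplier-⊕ {Λ-ring.k 1ℤ ⊕ G ⊕ G ⊛ G} {G ⊛ (G ⊛ G)}
        (multiplier-⊕ {Λ-ring.k 1ℤ ⊕ G} {G ⊛ G}
          (multiplier-⊕ {Λ-ring.k 1ℤ} {G} (λ {F} → multiplier-const (fromℤ 1ℤ) {F}) (λ {F} → Mg {F}))
          G²)
        (multiplier-⊛ {G} {G ⊛ G} (λ {F} → Mg {F}) (λ {F} → G² {F})))
      (multiplier-⊛ {G ⊛ G} {G ⊛ G} (λ {F} → G² {F}) (λ {F} → G² {F}))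
    where
    G² : Multiplier (G ⊛ G) (g * g)
    G² = multiplier-⊛ {G} {G} (λ {F} → Mg {F}) (λ {F} → Mg {F})

  -- S_{M+1}(F) = (1 + x) S_{M+1}(G) - G_M x^{M+1} for F = z G.
  multiplier-z⁻¹ : ∀ y → InA y → y * (1# + x) ≈ 1# → (∀ m → ∃ λ M₀ → ∀ M → M₀ ℕ.≤ M → D m (x ^ M)) →
                   Multiplier z⁻¹ y
  multiplier-z⁻¹ y Ay y[1+x]≈1 small {F} {v} C m with C m | small m
  ... | M₀ , h | M₁ , h′ = suc (M₀ ℕ.⊔ M₁) , λ where
      (suc M) (ℕ.s≤s M₀⊔M₁≤M) → D-cong (identity M) (D-A* Ay (D-+
        (h (suc M) (ℕ.m≤n⇒m≤1+n (ℕ.m⊔n≤o⇒m≤o M₀ M₁ M₀⊔M₁≤M)))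
        (D-neg (D-A* (A-ψ (G M)) (h′ (suc M) (ℕ.m≤n⇒m≤1+n (ℕ.m⊔n≤o⇒n≤o M₀ M₁ M₀⊔M₁≤M)))))))
    where
    G = z⁻¹ ⊛ F
    F≈ : F Λ.≈ G ⊕ T ⊛ G
    F≈ = Λₚ.sym {G ⊕ T ⊛ G} {F} (Λₚ.trans {G ⊕ T ⊛ G} {z ⊛ G} {F}
      (Λₚ.trans {G ⊕ T ⊛ G} {(Λ.1# ⊕ T) ⊛ G} {z ⊛ G}
        (Λₚ.sym {(Λ.1# ⊕ T) ⊛ G} {G ⊕ T ⊛ G}
          (Λₚ.trans {(Λ.1# ⊕ T) ⊛ G} {Λ.1# ⊛ G ⊕ T ⊛ G} {G ⊕ T ⊛ G} (Λₚ.distribʳ G Λ.1# T)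
            (Λₚ.+-congʳ {T ⊛ G} {Λ.1# ⊛ G} {G} (Λₚ.*-identityˡ G))))
        (Λₚ.*-congʳ {G} {Λ.1# ⊕ T} {z} (Λₚ.sym {z} {Λ.1# ⊕ T} z≈1+T)))
      (Λₚ.trans {z ⊛ G} {z ⊛ z⁻¹ ⊛ F} {F} (Λₚ.sym {z ⊛ z⁻¹ ⊛ F} {z ⊛ G} (Λₚ.*-assoc z z⁻¹ F))
        (Λₚ.trans {z ⊛ z⁻¹ ⊛ F} {Λ.1# ⊛ F} {F} (Λₚ.*-congʳ {F} {z ⊛ z⁻¹} {Λ.1#} z⊛z⁻¹≈1) (Λₚ.*-identityˡ F))))

    identity : ∀ M → y * v + - S G (suc M) ≈ y * (v + - S F (suc M) + - (ψ (G M) * (x * x ^ M)))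
    identity M = sym (begin
      y * (v + - S F (suc M) + - (g * (x * x ^ M)))
        ≈⟨ *-congˡ (+-congʳ (+-congˡ (-‿cong (trans (S-cong F≈ (suc M))
             (trans (S-⊕ G (T ⊛ G) (suc M)) (+-congˡ (S-T G M))))))) ⟩
      y * (v + - (s + g * x ^ M + x * s) + - (g * (x * x ^ M)))
        ≈⟨ solve 6 (λ y v s g p x →
             y :* (v :+ :- (s :+ g :* p :+ x :* s) :+ :- (g :* (x :* p))) :=
             y :* v :+ :- (y :* (con 1ℤ :+ x) :* (s :+ g :* p))) refl y v s g (x ^ M) x ⟩
      y * v + - (y * (k 1ℤ + x) * (s + g * x ^ M))
        ≈⟨ +-congˡ (-‿cong (*-congʳ (trans (*-congˡ (+-congʳ k.1#-homo)) y[1+x]≈1))) ⟩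
      y * v + - (1# * (s + g * x ^ M))
        ≈⟨ +-congˡ (-‿cong (*-identityˡ _)) ⟩
      y * v + - (s + g * x ^ M) ∎)
      where
      s = S G M
      g = ψ (G M)

-- Zeros at roots of unity of 5-power order

module FifthPowers {R : RawRing 0ℓ 0ℓ} (R-ring : IsCRing R) {ψ : ℤ₅ → RawRing.Carrier R}
                   (ψ-hom : IsHom ℤ₅-ring R ψ) where
  open RawRing R using (Carrier; _≈_; _+_; _*_; -_; 0#; 1#)
  open CommutativeRing (IsCRing.commutativeRing R-ring)
    hiding (Carrier; _≈_; _+_; _*_; -_; 0#; 1#; rawRing)
  open ℤ₅-Algebra R-ring ψ-hom
  open SemiringDefs (RawRing.rawSemiring R) using (_^_)

  -- The fifth power spelled out with the bracketing of `_^_`, so that it matches solver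
  -- expressions.
  p₅ : Carrier → Carrier
  p₅ y = y * (y * (y * (y * y)))

  ^5≈p₅ : ∀ y → y ^ 5 ≈ p₅ y
  ^5≈p₅ y = *-congˡ (*-congˡ (*-congˡ (*-congˡ (*-identityʳ y))))

  Φ-cong : ∀ {y w} → y ≈ w → Φ y ≈ Φ w
  Φ-cong p = +-cong (+-cong (+-cong (+-congˡ p) (*-cong p p)) (*-cong p (*-cong p p)))
                    (*-cong (*-cong p p) (*-cong p p))

  Φ-factor : ∀ y → (y + - k 1ℤ) * Φ y ≈ p₅ y + - k 1ℤ
  Φ-factor = solve 1 (λ y →
    (y :- con 1ℤ) :* (con 1ℤ :+ y :+ y :* y :+ y :* (y :* y) :+ y :* y :* (y :* y)) :=
    y :* (y :* (y :* (y :* y))) :- con 1ℤ) refl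

  -- The congruence (y - 1)⁵ ≡ y⁵ - 1 modulo 5 with its remainder made explicit. For y = ζ of order
  -- 5 it puts (ζ - 1)⁵ into 5ℤ₅[ζ], so the powers of ζ - 1 tend to 0.
  p₅[y-1] : ∀ y → p₅ y ≈ k 1ℤ →
    p₅ (y + - k 1ℤ) ≈ k (+ 5) * - (y * (y * (y * y)) + - (k (+ 2) * (y * (y * y))) + k (+ 2) * (y * y) + - y)
  p₅[y-1] y p = reduce p (solve 1 (λ y →
    let v = y :- con 1ℤ in
    v :* (v :* (v :* (v :* v))) :=
    con (+ 5) :* :- (y :* (y :* (y :* y)) :- con (+ 2) :* (y :* (y :* y)) :+ con (+ 2) :* (y :* y) :- y)
      :+ (con 1ℤ :- y :* (y :* (y :* (y :* y)))) :* :- con 1ℤ) refl y)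

  -- Evaluating `z⁻¹` relies on the powers of ζ - 1 tending to 0, which is available once ζ⁵ = 1 is
  -- known. To derive ζ⁵ = 1 from a vanishing value, the series is first multiplied by 81z⁴; what
  -- remains involves z alone.
  clear-denominators : ∀ z y f → z * y ≈ k 1ℤ →
    k (+ 81) * (z * z * (z * z)) * ((t * t) * (t * t) * (f * f) * ((y * y) * (y * y))) ≈ f * f
  clear-denominators z y f zy≈1 = trans
    (reduce 3t≈1 (solve 4 (λ z y f t →
      con (+ 81) :* (z :* z :* (z :* z)) :* ((t :* t) :* (t :* t) :* (f :* f) :* ((y :* y) :* (y :* y))) :=
      (z :* y) :* (z :* y) :* ((z :* y) :* (z :* y)) :* (f :* f) :+ (con 1ℤ :- con (+ 3) :* t) :*
        :- ((con 1ℤ :+ con (+ 3) :* t) :* (con 1ℤ :+ con (+ 9) :* (t :* t)) :*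
            ((z :* y) :* (z :* y) :* ((z :* y) :* (z :* y)) :* (f :* f)))) refl z y f t))
    (reduce zy≈1 (solve 2 (λ w f →
      w :* w :* (w :* w) :* (f :* f) := f :* f :+ (con 1ℤ :- w) :*
        :- ((con 1ℤ :+ w) :* (con 1ℤ :+ w :* w) :* (f :* f))) refl (z * y) f))

  -- Since j is prime to 5, y can be written through y⁵ and yʲ: for j = 2 and 4, yʲ ≈ 1 gives y ≈
  -- y⁵; for j = 3, y⁵ ≈ 1 gives y ≈ y⁶, the square of y³.
  root-of-unity-trivial : ∀ y → p₅ y ≈ k 1ℤ → ∀ j → 0 ℕ.< j → j ℕ.< 5 → y ^ j ≈ k 1ℤ → y ≈ k 1ℤ
  root-of-unity-trivial y p 1 _ _ q = trans (sym (*-identityʳ y)) q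
  root-of-unity-trivial y p 2 _ _ q = trans
    (reduce (trans (*-congˡ (sym (*-identityʳ y))) q) (solve 1 (λ y →
      y := y :* (y :* (y :* (y :* y))) :+ (con 1ℤ :- y :* y) :* (y :* (con 1ℤ :+ y :* y))) refl y)) p
  root-of-unity-trivial y p 3 _ _ q = trans
    (reduce p (solve 1 (λ y →
      y := (y :* (y :* y)) :* (y :* (y :* y)) :+ (con 1ℤ :- y :* (y :* (y :* (y :* y)))) :* y) refl y))
    (trans (*-cong y³ y³) (solve 0 (con 1ℤ :* con 1ℤ := con 1ℤ) refl))
    where
    y³ : y * (y * y) ≈ k 1ℤ
    y³ = trans (*-congˡ (*-congˡ (sym (*-identityʳ y)))) q
  root-of-unity-trivial y p 4 _ _ q = trans
    (reduce (trans (*-congˡ (*-congˡ (*-congˡ (sym (*-identityʳ y))))) q) (solve 1 (λ y →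
      y := y :* (y :* (y :* (y :* y))) :+ (con 1ℤ :- y :* (y :* (y :* y))) :* y) refl y)) p
  root-of-unity-trivial y p (suc (suc (suc (suc (suc j))))) _ (ℕ.s≤s (ℕ.s≤s (ℕ.s≤s (ℕ.s≤s (ℕ.s≤s ()))))) q

  -- Φ₅(1 + y) = 5 + 10y + 10y² + 5y³ + y⁴. Once y² = 5a, all terms after the first two are
  -- divisible by 25, so dividing by 5 leaves 1 + 2y modulo 5.
  Φ[1+y] : ∀ y a → y * y ≈ k (+ 5) * a →
    Φ (k 1ℤ + y) ≈ k (+ 5) * (k 1ℤ + k (+ 2) * y + k (+ 5) * (a * a + a * y + k (+ 2) * a))
  Φ[1+y] y a y²≈5a = reduce (sym y²≈5a) (solve 2 (λ y a →
    let v = con 1ℤ :+ y in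
    con 1ℤ :+ v :+ v :* v :+ v :* (v :* v) :+ v :* v :* (v :* v) :=
    con (+ 5) :* (con 1ℤ :+ con (+ 2) :* y :+ con (+ 5) :* (a :* a :+ a :* y :+ con (+ 2) :* a)) :+
      (y :* y :- con (+ 5) :* a) :* (y :* y :+ con (+ 5) :* a :+ con (+ 5) :* y :+ con (+ 10))) refl y a)

  -- (1 + 2y)(1 - 2y) = 1 - 20a.
  1≈5* : ∀ y a → y * y ≈ k (+ 5) * a →
    k 1ℤ + k (+ 2) * y + k (+ 5) * (a * a + a * y + k (+ 2) * a) ≈ k 0ℤ →
    k 1ℤ ≈ k (+ 5) * (k (+ 4) * a + - ((a * a + a * y + k (+ 2) * a) * (k 1ℤ + - (k (+ 2) * y))))
  1≈5* y a y²≈5a h = reduce (sym h) (reduce (sym y²≈5a) (solve 2 (λ y a →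
    let b = a :* a :+ a :* y :+ con (+ 2) :* a in
    con 1ℤ :=
    con (+ 5) :* (con (+ 4) :* a :- b :* (con 1ℤ :- con (+ 2) :* y)) :+
      (con 1ℤ :+ con (+ 2) :* y :+ con (+ 5) :* b :- con 0ℤ) :* (con 1ℤ :- con (+ 2) :* y) :+
      (y :* y :- con (+ 5) :* a) :* con (+ 4)) refl y a))

module Closure (Ω : AlgebraicClosureOfℚ₅) where
  open AlgebraicClosureOfℚ₅ Ω

  Ω-commutativeRing : CommutativeRing 0ℓ 0ℓ
  Ω-commutativeRing = HeytingCommutativeRing.commutativeRing (HeytingField.heytingCommutativeRing heytingField)

  Ω-isCRing : IsCRing ring
  Ω-isCRing = isCRing Ω-commutativeRing

  open HeytingField heytingField using (tight; #⇒invertible; invertible⇒#; #-cotrans; #-sym) public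
  open CommutativeRing Ω-commutativeRing
    hiding (Carrier; _≈_; _+_; _*_; -_; _-_; 0#; 1#; rawRing; ring)
  open CommutativeRing Ω-commutativeRing using () renaming (ring to Ω-ring)

  module fromℚ₅ = Morphism.IsRingMonomorphism fromℚ₅-mono

  ι-hom : IsHom ℤ₅-ring ring ι
  ι-hom = ∘-homomorphism {ℤ₅-ring} {ℚ₅-ring} {ring} trans fromℤ₅-hom fromℚ₅.isRingHomomorphism

  open ℤ₅-Algebra Ω-isCRing ι-hom public
  open FifthPowers Ω-isCRing ι-hom public
  open Exp (CommutativeRing.semiring Ω-commutativeRing) using (^-homo-*; ^-assocʳ) public
  open ≈-Reasoning setoid

  1→k : ∀ {y} → y ≈ 1# → y ≈ k 1ℤ
  1→k p = trans p (sym k.1#-homo)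

  k→1 : ∀ {y} → y ≈ k 1ℤ → y ≈ 1#
  k→1 p = trans p k.1#-homo

  ⅕ : Carrier
  ⅕ = fromℚ₅ (fromℤ 1ℤ , 1)

  5*⅕≈1 : k (+ 5) * ⅕ ≈ 1#
  5*⅕≈1 = begin
    k (+ 5) * ⅕                                          ≈⟨ fromℚ₅.*-homo (fromℤ₅ (fromℤ (+ 5))) (fromℤ 1ℤ , 1) ⟨
    fromℚ₅ (fromℤ (+ 5) *₅ fromℤ 1ℤ , 1)                ≈⟨ fromℚ₅.⟦⟧-cong {fromℤ (+ 5) *₅ fromℤ 1ℤ , 1} {fromℤ 1ℤ , 0} (λ n → divides 0ℤ ≡.refl) ⟩
    fromℚ₅ (fromℤ 1ℤ , 0)                                ≈⟨ fromℚ₅.1#-homo ⟩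
    1#                                                    ∎

  5-cancel : ∀ {y w} → k (+ 5) * y ≈ k (+ 5) * w → y ≈ w
  5-cancel {y} {w} p = begin
    y                      ≈⟨ unfold y ⟩
    ⅕ * (k (+ 5) * y)      ≈⟨ *-congˡ p ⟩
    ⅕ * (k (+ 5) * w)      ≈⟨ unfold w ⟨
    w                      ∎
    where
    unfold : ∀ v → v ≈ ⅕ * (k (+ 5) * v)
    unfold v = begin
      v                     ≈⟨ *-identityˡ v ⟨
      1# * v                ≈⟨ *-congʳ 5*⅕≈1 ⟨
      k (+ 5) * ⅕ * v       ≈⟨ *-congʳ (*-comm _ _) ⟩
      ⅕ * k (+ 5) * v       ≈⟨ *-assoc _ _ _ ⟩
      ⅕ * (k (+ 5) * v)     ∎

  -- By injectivity of `fromℚ₅` the equation would hold in ℤ₅, where level 1 says that 5 divides 1.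
  1+5a≉0 : ∀ a → ¬ k 1ℤ + k (+ 5) * ι a ≈ 0#
  1+5a≉0 a p = from-no (+ 5 ∣? 1ℤ) (∣-resp (identity (residue a 1))
    (ℤ∣.∣m∣n⇒∣m-n (fromℚ₅.injective {fromℤ₅ b} {fromℤ₅ (fromℤ 0ℤ)} ιb≈0 1) (ℤ∣.∣m⇒∣m*n (residue a 1) ℤ∣.∣-refl)))
    where
    b = fromℤ 1ℤ +₅ fromℤ (+ 5) *₅ a
    ιb≈0 : ι b ≈ k 0ℤ
    ιb≈0 = trans (ψ.+-homo (fromℤ 1ℤ) (fromℤ (+ 5) *₅ a))
      (trans (+-congˡ (ψ.*-homo (fromℤ (+ 5)) a)) (trans p (sym k.0#-homo)))
    identity : ∀ a → 1ℤ ℤ.* (1ℤ ℤ.+ + 5 ℤ.* a) ℤ.- 1ℤ ℤ.* 0ℤ ℤ.- + 5 ℤ.* a ≡ 1ℤ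
    identity = solve-∀

  1≉0 : ¬ 1# ≈ 0#
  1≉0 p = 1+5a≉0 (fromℤ 0ℤ) (begin
    k 1ℤ + k (+ 5) * k 0ℤ   ≈⟨ solve 0 (con 1ℤ :+ con (+ 5) :* con 0ℤ := con 1ℤ) refl ⟩
    k 1ℤ                     ≈⟨ trans k.1#-homo p ⟩
    0#                       ∎)

  cancel-# : ∀ {y w} → y # 0# → y * w ≈ 0# → w ≈ 0#
  cancel-# {y} {w} y#0 yw≈0 with #⇒invertible y#0
  ... | y⁻¹ , y⁻¹y≈1 , _ = begin
    w                        ≈⟨ *-identityˡ w ⟨
    1# * w                   ≈⟨ *-congʳ y⁻¹y≈1 ⟨
    y⁻¹ * (y - 0#) * w       ≈⟨ *-assoc _ _ _ ⟩
    y⁻¹ * ((y - 0#) * w)     ≈⟨ *-congˡ (*-congʳ (trans (+-congˡ (RingProperties.-0#≈0# Ω-ring)) (+-identityʳ y))) ⟩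
    y⁻¹ * (y * w)            ≈⟨ trans (*-congˡ yw≈0) (zeroʳ _) ⟩
    0#                       ∎

  ζ-1 : ∀ {ζ} → ζ - 1# ≈ ζ + - k 1ℤ
  ζ-1 = +-congˡ (-‿cong (sym k.1#-homo))

  Φ≈0⇒^5≈1 : ∀ ζ → Φ ζ ≈ 0# → ζ ^ 5 ≈ 1#
  Φ≈0⇒^5≈1 ζ Φ≈0 = begin
    ζ ^ 5                                  ≈⟨ ^5≈p₅ ζ ⟩
    p₅ ζ                                   ≈⟨ solve 2 (λ p o → p := p :- o :+ o) refl (p₅ ζ) (k 1ℤ) ⟩
    p₅ ζ + - k 1ℤ + k 1ℤ                   ≈⟨ +-congʳ (Φ-factor ζ) ⟨
    (ζ + - k 1ℤ) * Φ ζ + k 1ℤ              ≈⟨ +-congʳ (trans (*-congˡ Φ≈0) (zeroʳ _)) ⟩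
    0# + k 1ℤ                              ≈⟨ trans (+-identityˡ _) k.1#-homo ⟩
    1#                                      ∎

  ^5≈1⇒p₅≈1 : ∀ {ζ} → ζ ^ 5 ≈ 1# → p₅ ζ ≈ k 1ℤ
  ^5≈1⇒p₅≈1 {ζ} p = 1→k (trans (sym (^5≈p₅ ζ)) p)

  [ζ-1]Φ≈0 : ∀ {ζ} → ζ ^ 5 ≈ 1# → (ζ - 1#) * Φ ζ ≈ 0#
  [ζ-1]Φ≈0 {ζ} p = begin
    (ζ - 1#) * Φ ζ          ≈⟨ *-congʳ ζ-1 ⟩
    (ζ + - k 1ℤ) * Φ ζ      ≈⟨ Φ-factor ζ ⟩
    p₅ ζ + - k 1ℤ           ≈⟨ +-congʳ (^5≈1⇒p₅≈1 p) ⟩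
    k 1ℤ + - k 1ℤ           ≈⟨ -‿inverseʳ _ ⟩
    0#                      ∎

  ζ-1≈0⇒ζ≈1 : ∀ {ζ} → ζ - 1# ≈ 0# → ζ ≈ 1#
  ζ-1≈0⇒ζ≈1 {ζ} p = begin
    ζ                 ≈⟨ solve 2 (λ y o → y := y :- o :+ o) refl ζ 1# ⟩
    ζ - 1# + 1#       ≈⟨ +-congʳ p ⟩
    0# + 1#           ≈⟨ +-identityˡ 1# ⟩
    1#                ∎

  -- (ζ - 1)Φ(ζ) = 0 does not yield a case distinction in Ω. But if Φ(ζ) were apart from 0 it could
  -- be cancelled, giving ζ = 1 against primitivity, and tightness turns this into Φ(ζ) = 0.
  primitive⇒Φ≈0 : ∀ ζ → PrimitiveRoot 5 ζ → Φ ζ ≈ 0#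
  primitive⇒Φ≈0 ζ (ζ^5≈1 , prim) = proj₁ (tight (Φ ζ) 0#) λ Φ#0 →
    prim 1 (ℕ.s≤s ℕ.z≤n) (ℕ.s≤s (ℕ.s≤s ℕ.z≤n))
      (trans (*-identityʳ ζ) (ζ-1≈0⇒ζ≈1 (cancel-# Φ#0 (trans (*-comm _ _) ([ζ-1]Φ≈0 ζ^5≈1)))))

  Φ≈0⇒primitive : ∀ ζ → Φ ζ ≈ 0# → PrimitiveRoot 5 ζ
  Φ≈0⇒primitive ζ Φ≈0 = ζ^5≈1 , λ j 0<j j<5 ζ^j≈1 → 1≉0 (begin
    1#              ≈⟨ 5*⅕≈1 ⟨
    k (+ 5) * ⅕     ≈⟨ *-congʳ (Φ[1]≈5 (root-of-unity-trivial ζ (^5≈1⇒p₅≈1 ζ^5≈1) j 0<j j<5 (1→k ζ^j≈1))) ⟨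
    Φ ζ * ⅕         ≈⟨ trans (*-congʳ Φ≈0) (zeroˡ _) ⟩
    0#              ∎)
    where
    ζ^5≈1 = Φ≈0⇒^5≈1 ζ Φ≈0
    Φ[1]≈5 : ζ ≈ k 1ℤ → Φ ζ ≈ k (+ 5)
    Φ[1]≈5 p = trans (Φ-cong p) (solve 0 (con 1ℤ :+ con 1ℤ :+ con 1ℤ :* con 1ℤ :+ con 1ℤ :* (con 1ℤ :* con 1ℤ)
      :+ con 1ℤ :* con 1ℤ :* (con 1ℤ :* con 1ℤ) := con (+ 5)) refl)

  root-of-Φ : ∃ λ ζ → Φ ζ ≈ 0#
  root-of-Φ with algebraicallyClosed 1# (1# ∷ 1# ∷ 1# ∷ [])
  ... | ζ , eq = ζ , (begin
    Φ ζ
      ≈⟨ solve 1 (λ y → con 1ℤ :+ y :+ y :* y :+ y :* (y :* y) :+ y :* y :* (y :* y) :=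
           con 1ℤ :+ y :* (con 1ℤ :+ y :* (con 1ℤ :+ y :* (con 1ℤ :+ y :* (con 1ℤ :+ y :* con 0ℤ))))) refl ζ ⟩
    k 1ℤ + ζ * (k 1ℤ + ζ * (k 1ℤ + ζ * (k 1ℤ + ζ * (k 1ℤ + ζ * k 0ℤ))))
      ≈⟨ +-cong o (*-congˡ (+-cong o (*-congˡ (+-cong o (*-congˡ (+-cong o (*-congˡ (+-cong o (*-congˡ k.0#-homo))))))))) ⟩
    1# + ζ * (1# + ζ * (1# + ζ * (1# + ζ * (1# + ζ * 0#))))
      ≈⟨ eq ⟩
    0# ∎)
    where o = k.1#-homo

  module AtRoot (ζ : Carrier) where
    x : Carrier
    x = ζ - 1#

    open Adjoin Ω-isCRing ι-hom x public
    open Span Ω-isCRing ι-hom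
    open Summation Ω-isCRing

    1+x≈ζ : 1# + x ≈ ζ
    1+x≈ζ = solve 2 (λ y o → o :+ (y :- o) := y) refl ζ 1#

    A-ζ : InA ζ
    A-ζ = A-cong (sym 1+x≈ζ) (A-+ A-1 A-x)

    -- ℤ₅[ζ] is generated by 1, ζ, …, ζ^N, so Nakayama's lemma applies to it.
    5-nonunit : ∀ N → ζ ^ suc N ≈ 1# → ¬ D 1 1#
    5-nonunit N ζ^N≈1 (multiple w (as , w≈) 1≈5w) =
      1+5a≉0 (proj₁ killed) (trans (sym (*-identityʳ _)) (proj₂ killed))
      where
      e : ℕ → Carrier
      e i = ζ ^ i

      C : Carrier → Set
      C = Combination e (suc N)

      -- As ζ^(N + 1) = 1, multiplication by ζ permutes the generators cyclically; the coefficients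
      -- are rotated to match.
      C-ζ : ∀ {y} → C y → C (ζ * y)
      C-ζ {y} (c , y≈) = shift , (begin
        ζ * y
          ≈⟨ *-congˡ y≈ ⟩
        ζ * Σ[i< suc N ] (λ i → ι (c i) * ζ ^ i)
          ≈⟨ Σ-*ˡ (suc N) ζ (λ i → ι (c i) * ζ ^ i) ⟨
        Σ[i< N ] (λ i → ζ * (ι (c i) * ζ ^ i)) + ζ * (ι (c N) * ζ ^ N)
          ≈⟨ +-cong (Σ-cong N λ i _ → swap (ι (c i)) (ζ ^ i)) (trans (swap (ι (c N)) (ζ ^ N)) (*-congˡ ζ^N≈1)) ⟩
        Σ[i< N ] (λ i → ι (c i) * ζ ^ suc i) + ι (c N) * 1#
          ≈⟨ +-comm _ _ ⟩
        ι (shift 0) * ζ ^ 0 + Σ[i< N ] (λ i → ι (shift (suc i)) * ζ ^ suc i)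
          ≈⟨ Σ-suc N (λ i → ι (shift i) * ζ ^ i) ⟨
        Σ[i< suc N ] (λ i → ι (shift i) * ζ ^ i) ∎)
        where
        shift : ℕ → ℤ₅
        shift zero    = c N
        shift (suc i) = c i
        swap : ∀ a b → ζ * (a * b) ≈ a * (ζ * b)
        swap a b = solve 3 (λ z a b → z :* (a :* b) := a :* (z :* b)) refl ζ a b

      C-1 : C 1#
      C-1 = Λ.1# , sym (begin
        Σ[i< suc N ] (λ i → ι (Λ.1# i) * ζ ^ i)
          ≈⟨ Σ-suc N (λ i → ι (Λ.1# i) * ζ ^ i) ⟩
        k 1ℤ * 1# + Σ[i< N ] (λ i → k 0ℤ * ζ ^ suc i)
          ≈⟨ +-cong (trans (*-congʳ k.1#-homo) (*-identityˡ _))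
                    (Σ-zero N λ i → trans (*-congʳ k.0#-homo) (zeroˡ _)) ⟩
        1# + 0#
          ≈⟨ +-identityʳ _ ⟩
        1# ∎)

      C-eval : ∀ as → C (eval (map ι as) x)
      C-eval []       = combination-cong e {suc N} (sym (trans (*-congʳ k.0#-homo) (zeroˡ _)))
                          (combination-* e (suc N) (fromℤ 0ℤ) C-1)
      C-eval (a ∷ as) = combination-cong e {suc N}
        (+-cong (sym (*-identityʳ _)) (trans (*-congʳ ζ-1)
          (solve 2 (λ z v → (z :- con 1ℤ) :* v := z :* v :+ con -[1+ 0 ] :* v) refl ζ (eval (map ι as) x))))
        (combination-+ e (suc N) (combination-* e (suc N) a C-1)
          (combination-+ e (suc N) (C-ζ (C-eval as)) (combination-* e (suc N) (fromℤ -[1+ 0 ]) (C-eval as))))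

      C-power : ∀ j → C (ζ ^ j * w)
      C-power zero    = combination-cong e {suc N} (trans (*-identityˡ w) w≈) (C-eval as)
      C-power (suc j) = combination-cong e {suc N} (*-assoc _ _ _) (C-ζ (C-power j))

      generators : ∀ j → j ℕ.< suc N → ∃ λ a → ∃ λ y → C y × u e a * e j ≈ k (+ 5) * y
      generators j _ = fromℤ 0ℤ , ζ ^ j * w , C-power j , (begin
        (k 1ℤ + k (+ 5) * k 0ℤ) * ζ ^ j
          ≈⟨ *-congʳ (trans (solve 0 (con 1ℤ :+ con (+ 5) :* con 0ℤ := con 1ℤ) refl) (trans k.1#-homo 1≈5w)) ⟩
        k (+ 5) * w * ζ ^ j
          ≈⟨ solve 3 (λ a w z → a :* w :* z := a :* (z :* w)) refl (k (+ 5)) w (ζ ^ j) ⟩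
        k (+ 5) * (ζ ^ j * w) ∎)

      killed : ∃ λ a → u e a * e 0 ≈ 0#
      killed = nakayama e N generators

    geometric : ∀ n {y} → InA y → ∃ λ q → InA q × y ^ n + - 1# ≈ q * (y + - 1#)
    geometric zero    Ay = 0# , A-cong (sym k.0#-homo) (A-ψ (fromℤ 0ℤ)) , trans (-‿inverseʳ _) (sym (zeroˡ _))
    geometric (suc n) {y} Ay with geometric n Ay
    ... | q , Aq , eq = y * q + 1# , A-+ (A-* Ay Aq) A-1 , (begin
      y * y ^ n + - 1#
        ≈⟨ +-congˡ (-‿cong k.1#-homo) ⟨
      y * y ^ n + - k 1ℤ
        ≈⟨ solve 2 (λ y p → y :* p :- con 1ℤ := y :* (p :- con 1ℤ) :+ con 1ℤ :* (y :- con 1ℤ)) refl y (y ^ n) ⟩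
      y * (y ^ n + - k 1ℤ) + k 1ℤ * (y + - k 1ℤ)
        ≈⟨ +-cong (*-congˡ (+-congˡ (-‿cong k.1#-homo))) (*-cong k.1#-homo (+-congˡ (-‿cong k.1#-homo))) ⟩
      y * (y ^ n + - 1#) + 1# * (y + - 1#)
        ≈⟨ +-congʳ (*-congˡ eq) ⟩
      y * (q * (y + - 1#)) + 1# * (y + - 1#)
        ≈⟨ +-congʳ (*-assoc _ _ _) ⟨
      y * q * (y + - 1#) + 1# * (y + - 1#)
        ≈⟨ distribʳ _ _ _ ⟨
      (y * q + 1#) * (y + - 1#) ∎)

    module _ (N : ℕ) (ζ^N≈1 : ζ ^ suc N ≈ 1#) (Φ²∈5A : D 1 (Φ ζ * Φ ζ)) where
      open D Φ²∈5A using () renaming (quotient to w; quotient∈A to Aw; equation to Φ²≈5w)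

      -- If ω = ζ^(5n) ≠ 1 then y = ω - 1 is a multiple of ζ⁵ - 1 = xΦ₅(ζ), so y² ∈ 5ℤ₅[ζ],
      -- and Φ₅(1 + y) = 0 makes 5 a unit of ℤ₅[ζ].
      ω≈1 : ∀ n → (ζ ^ (5 ℕ.* n)) ^ 5 ≈ 1# → ζ ^ (5 ℕ.* n) ≈ 1#
      ω≈1 n ω^5≈1 = proj₁ (tight ω 1#) λ ω#1 → 5-nonunit N ζ^N≈1 (contra (Φω≈0 ω#1))
        where
        ω = ζ ^ (5 ℕ.* n)

        Φω≈0 : ω # 1# → Φ ω ≈ 0#
        Φω≈0 ω#1 with #⇒invertible ω#1
        ... | i , i[ω-1]≈1 , _ = begin
          Φ ω                       ≈⟨ *-identityˡ _ ⟨
          1# * Φ ω                  ≈⟨ *-congʳ i[ω-1]≈1 ⟨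
          i * (ω - 1#) * Φ ω        ≈⟨ *-assoc _ _ _ ⟩
          i * ((ω - 1#) * Φ ω)      ≈⟨ trans (*-congˡ ([ζ-1]Φ≈0 ω^5≈1)) (zeroʳ _) ⟩
          0#                        ∎

        geo = geometric n (A-^ 5 A-ζ)
        q = proj₁ geo
        y = ω + - k 1ℤ
        a = q * q * (x * x) * w

        y≈ : y ≈ q * (x * Φ ζ)
        y≈ = begin
          ω + - k 1ℤ                     ≈⟨ +-cong (sym (^-assocʳ ζ 5 n)) (-‿cong k.1#-homo) ⟩
          (ζ ^ 5) ^ n + - 1#             ≈⟨ proj₂ (proj₂ geo) ⟩
          q * (ζ ^ 5 + - 1#)             ≈⟨ *-congˡ (+-cong (^5≈p₅ ζ) (-‿cong (sym k.1#-homo))) ⟩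
          q * (p₅ ζ + - k 1ℤ)            ≈⟨ *-congˡ (Φ-factor ζ) ⟨
          q * ((ζ + - k 1ℤ) * Φ ζ)       ≈⟨ *-congˡ (*-congʳ ζ-1) ⟨
          q * (x * Φ ζ)                  ∎

        y²≈5a : y * y ≈ k (+ 5) * a
        y²≈5a = begin
          y * y
            ≈⟨ *-cong y≈ y≈ ⟩
          q * (x * Φ ζ) * (q * (x * Φ ζ))
            ≈⟨ solve 3 (λ q x f → q :* (x :* f) :* (q :* (x :* f)) := q :* q :* (x :* x) :* (f :* f)) refl q x (Φ ζ) ⟩
          q * q * (x * x) * (Φ ζ * Φ ζ)
            ≈⟨ *-congˡ Φ²≈5w ⟩
          q * q * (x * x) * (k (+ 5) * w)
            ≈⟨ solve 3 (λ b c w → b :* (c :* w) := c :* (b :* w)) refl (q * q * (x * x)) (k (+ 5)) w ⟩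
          k (+ 5) * a ∎

        Aq : InA q
        Aq = proj₁ (proj₂ geo)

        Aa : InA a
        Aa = A-* (A-* (A-* Aq Aq) (A-* A-x A-x)) Aw

        Ay : InA y
        Ay = A-+ (A-^ (5 ℕ.* n) A-ζ) (A-neg (A-ψ (fromℤ 1ℤ)))

        contra : Φ ω ≈ 0# → D 1 1#
        contra Φω≈0 = multiple
          (k (+ 4) * a + - ((a * a + a * y + k (+ 2) * a) * (k 1ℤ + - (k (+ 2) * y))))
          (A-+ (A-* (A-ψ (fromℤ (+ 4))) Aa) (A-neg (A-*
            (A-+ (A-+ (A-* Aa Aa) (A-* Aa Ay)) (A-* (A-ψ (fromℤ (+ 2))) Aa))
            (A-+ (A-ψ (fromℤ 1ℤ)) (A-neg (A-* (A-ψ (fromℤ (+ 2))) Ay))))))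
          (trans (sym k.1#-homo) (1≈5* y a y²≈5a (5-cancel (begin
            k (+ 5) * (k 1ℤ + k (+ 2) * y + k (+ 5) * (a * a + a * y + k (+ 2) * a))
              ≈⟨ Φ[1+y] y a y²≈5a ⟨
            Φ (k 1ℤ + y)
              ≈⟨ Φ-cong (solve 2 (λ w o → o :+ (w :- o) := w) refl ω (k 1ℤ)) ⟩
            Φ ω
              ≈⟨ trans Φω≈0 (sym k.0#-homo) ⟩
            k 0ℤ
              ≈⟨ solve 0 (con 0ℤ := con (+ 5) :* con 0ℤ) refl ⟩
            k (+ 5) * k 0ℤ ∎))))

      -- Descent on the exponent: the fifth power of ω = ζ^(5^(n + 1)) is 1, so ω = 1 by `ω≈1`,
      -- which lowers the exponent by one. It stops at ζ⁵, because `ω≈1` speaks of powers of ζ⁵.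
      ^5≈1 : ∀ n → ζ ^ (5 ℕ.^ suc n) ≈ 1# → ζ ^ 5 ≈ 1#
      ^5≈1 zero    p = p
      ^5≈1 (suc n) p = ^5≈1 n (ω≈1 (5 ℕ.^ n) (trans (^-assocʳ ζ (5 ℕ.^ suc n) 5)
        (trans (reflexive (cong (ζ ^_) (ℕ.*-comm (5 ℕ.^ suc n) 5))) p)))

    ⟨x⟩≈⇒converges : ∀ {F v} → F ⟨ x ⟩≈ v → Converges F v
    ⟨x⟩≈⇒converges h m = proj₁ (h m) , λ M M₀≤M → let as , eq = proj₂ (h m) M M₀≤M in
      multiple (eval (map ι as) x) (as , refl) eq

    converges⇒⟨x⟩≈ : ∀ {F v} → Converges F v → F ⟨ x ⟩≈ v
    converges⇒⟨x⟩≈ h m = proj₁ (h m) , λ M M₀≤M → let open D (proj₂ (h m) M M₀≤M) in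
      proj₁ quotient∈A , trans equation (*-congˡ (proj₂ quotient∈A))

    module _ {R : Λ.Carrier} (R≈ : R Λ.≈ Φ₅²/81z⁴) where
      private
        81z⁴ E : Λ.Carrier
        81z⁴ = Λ-ring.k (+ 81) ⊛ (z ⊛ z ⊛ (z ⊛ z))
        E = ⅑ₛ ⊛ ⅑ₛ ⊛ (Λ-ring.Φ z ⊛ Λ-ring.Φ z) ⊛ (z⁻¹ ⊛ z⁻¹ ⊛ (z⁻¹ ⊛ z⁻¹))

        R≈E : R Λ.≈ E
        R≈E = Λₚ.trans {R} {Φ₅²/81z⁴} {E} R≈ Φ₅²/81z⁴≈

        81z⁴R≈Φ² : 81z⁴ ⊛ R Λ.≈ Λ-ring.Φ z ⊛ Λ-ring.Φ z
        81z⁴R≈Φ² = Λₚ.trans {81z⁴ ⊛ R} {81z⁴ ⊛ E} {Λ-ring.Φ z ⊛ Λ-ring.Φ z} (Λₚ.*-congˡ {81z⁴} {R} {E} R≈E)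
          (FifthPowers.clear-denominators Λᵒ-isCRing const-hom z z⁻¹ (Λ-ring.Φ z) z⊛z⁻¹≈1)

        M-Φ : Multiplier (Λ-ring.Φ z) (Φ (1# + x))
        M-Φ = multiplier-Φ {z} (λ {F} → multiplier-z {F})

        M-Φ² : Multiplier (Λ-ring.Φ z ⊛ Λ-ring.Φ z) (Φ (1# + x) * Φ (1# + x))
        M-Φ² = multiplier-⊛ {Λ-ring.Φ z} {Λ-ring.Φ z} (λ {F} → M-Φ {F}) (λ {F} → M-Φ {F})

        square : ∀ {G g} → Multiplier G g → Multiplier (G ⊛ G) (g * g)
        square {G} M = multiplier-⊛ {G} {G} (λ {F} → M {F}) (λ {F} → M {F})

        fourth : ∀ {G g} → Multiplier G g → Multiplier (G ⊛ G ⊛ (G ⊛ G)) (g * g * (g * g))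
        fourth {G} M = square {G ⊛ G} (λ {F} → square {G} (λ {F} → M {F}) {F})

      -- The series 81z⁴R = Φ₅(z)² has two limits at ζ - 1: Φ(ζ)² from the right side and 81ζ⁴ times
      -- 0 from the left.
      Φ²∈D : Converges R 0# → ∀ m → D m (Φ ζ * Φ ζ)
      Φ²∈D C m = D-cong
        (trans (*-cong (Φ-cong (sym 1+x≈ζ)) (Φ-cong (sym 1+x≈ζ)))
          (solve 1 (λ v → v := v :+ :- con 0ℤ) refl (Φ (1# + x) * Φ (1# + x))))
        (converges-unique {Λ-ring.Φ z ⊛ Λ-ring.Φ z} (multiplier-converges {Λ-ring.Φ z ⊛ Λ-ring.Φ z} (λ {F} → M-Φ² {F}))
          (converges-cong {81z⁴ ⊛ R} {Λ-ring.Φ z ⊛ Λ-ring.Φ z} 81z⁴R≈Φ² (trans (zeroʳ _) (sym k.0#-homo))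
            (multiplier-⊛ {Λ-ring.k (+ 81)} {z ⊛ z ⊛ (z ⊛ z)}
              (λ {F} → multiplier-const (fromℤ (+ 81)) {F})
              (λ {F} → fourth {z} (λ {F} → multiplier-z {F}) {F}) {R} C)) m)

      converges⇒primitive : μ5^∞ ζ → Converges R 0# → PrimitiveRoot 5 ζ
      converges⇒primitive (n , p) C = ζ^5≈1 , λ j 0<j j<5 ζ^j≈1 →
        5-nonunit 4 ζ^5≈1 (25∈D₃ (root-of-unity-trivial ζ (^5≈1⇒p₅≈1 ζ^5≈1) j 0<j j<5 (1→k ζ^j≈1)))
        where
        root : ∀ n → ζ ^ (5 ℕ.^ n) ≈ 1# → ζ ^ 5 ≈ 1#
        root zero    p = trans (^5≈p₅ ζ) (trans (*-cong ζ≈1 (*-cong ζ≈1 (*-cong ζ≈1 (*-cong ζ≈1 ζ≈1))))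
          (trans (solve 0 (con 1ℤ :* (con 1ℤ :* (con 1ℤ :* (con 1ℤ :* con 1ℤ))) := con 1ℤ) refl) k.1#-homo))
          where
          ζ≈1 : ζ ≈ k 1ℤ
          ζ≈1 = 1→k (trans (sym (*-identityʳ ζ)) p)
        root (suc n) p = ^5≈1 N (trans (reflexive (cong (ζ ^_) suc-N)) p) (Φ²∈D C 1) n p
          where
          N = ℕ.pred (5 ℕ.^ suc n)
          suc-N : suc N ≡ 5 ℕ.^ suc n
          suc-N = ℕ.suc-pred (5 ℕ.^ suc n) {{ℕ.m^n≢0 5 (suc n)}}
        ζ^5≈1 = root n p
        -- At ζ = 1 the number Φ(ζ)² is 25, and m = 3 is the least exponent that helps: 25 = 125w
        -- cancels to 1 = 5w.
        25∈D₃ : ζ ≈ k 1ℤ → D 1 1#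
        25∈D₃ ζ≈1 = multiple w Aw (trans (sym k.1#-homo) (5-cancel (5-cancel (begin
          k (+ 5) * (k (+ 5) * k 1ℤ)
            ≈⟨ solve 0 (con (+ 5) :* (con (+ 5) :* con 1ℤ) :=
                 (con 1ℤ :+ con 1ℤ :+ con 1ℤ :* con 1ℤ :+ con 1ℤ :* (con 1ℤ :* con 1ℤ) :+ con 1ℤ :* con 1ℤ :* (con 1ℤ :* con 1ℤ)) :*
                 (con 1ℤ :+ con 1ℤ :+ con 1ℤ :* con 1ℤ :+ con 1ℤ :* (con 1ℤ :* con 1ℤ) :+ con 1ℤ :* con 1ℤ :* (con 1ℤ :* con 1ℤ))) refl ⟩
          Φ (k 1ℤ) * Φ (k 1ℤ)
            ≈⟨ *-cong (Φ-cong ζ≈1) (Φ-cong ζ≈1) ⟨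
          Φ ζ * Φ ζ
            ≈⟨ Φ²≈125w ⟩
          k (+ 125) * w
            ≈⟨ solve 1 (λ w → con (+ 125) :* w := con (+ 5) :* (con (+ 5) :* (con (+ 5) :* w))) refl w ⟩
          k (+ 5) * (k (+ 5) * (k (+ 5) * w)) ∎))))
          where open D (Φ²∈D C 3) using () renaming (quotient to w; quotient∈A to Aw; equation to Φ²≈125w)

      -- The factor Φ₅(z)² of the series evaluates to 0. For the factor z⁻⁴, order 5 supplies both
      -- ingredients: ζ⁴ inverts 1 + x, and x⁵ lies in 5ℤ₅[ζ].
      primitive⇒converges : PrimitiveRoot 5 ζ → Converges R 0#
      primitive⇒converges prim@(ζ^5≈1 , _) = converges-cong {E} {R} (Λₚ.sym {R} {E} R≈E)
        (trans (*-congʳ (trans (*-congˡ (trans (*-congʳ Φ[1+x]≈0) (zeroˡ _))) (zeroʳ _))) (zeroˡ _))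
        (multiplier-converges {E} (multiplier-⊛ {⅑ₛ ⊛ ⅑ₛ ⊛ (Λ-ring.Φ z ⊛ Λ-ring.Φ z)} {z⁻¹ ⊛ z⁻¹ ⊛ (z⁻¹ ⊛ z⁻¹)}
          (multiplier-⊛ {⅑ₛ ⊛ ⅑ₛ} {Λ-ring.Φ z ⊛ Λ-ring.Φ z}
            (λ {F} → fourth {const ⅓} (λ {F} → multiplier-const ⅓ {F}) {F}) (λ {F} → M-Φ² {F}))
          (λ {F} → fourth {z⁻¹} (λ {F} → multiplier-z⁻¹ (ζ ^ 4) (A-^ 4 A-ζ) ζ^4 small {F}) {F})))
        where
        Φ[1+x]≈0 : Φ (1# + x) ≈ 0#
        Φ[1+x]≈0 = trans (Φ-cong 1+x≈ζ) (primitive⇒Φ≈0 ζ prim)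

        ζ^4 : ζ ^ 4 * (1# + x) ≈ 1#
        ζ^4 = trans (*-congˡ 1+x≈ζ) (trans (*-comm _ _) ζ^5≈1)

        x^5∈D : D 1 (x ^ 5)
        x^5∈D = multiple _
          (A-neg (A-+ (A-+ (A-+ (A-* A-ζ (A-* A-ζ (A-* A-ζ A-ζ)))
            (A-neg (A-* (A-ψ (fromℤ (+ 2))) (A-* A-ζ (A-* A-ζ A-ζ)))))
            (A-* (A-ψ (fromℤ (+ 2))) (A-* A-ζ A-ζ))) (A-neg A-ζ)))
          (trans (^5≈p₅ x) (trans (*-cong ζ-1 (*-cong ζ-1 (*-cong ζ-1 (*-cong ζ-1 ζ-1))))
            (p₅[y-1] ζ (^5≈1⇒p₅≈1 ζ^5≈1))))

        powers : ∀ m → D m ((x ^ 5) ^ m)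
        powers zero    = multiple 1# A-1 (sym (trans (*-congʳ k.1#-homo) (*-identityˡ 1#)))
        powers (suc m) = D-* 1 m x^5∈D (powers m)

        small : ∀ m → ∃ λ M₀ → ∀ M → M₀ ℕ.≤ M → D m (x ^ M)
        -- Each block of five factors x contributes one factor 5, so 5m factors reach 5ᵐ.
        small m = 5 ℕ.* m , λ M 5m≤M → D-cong
          (trans (reflexive (cong (x ^_) (≡.sym (ℕ.m+[n∸m]≡n 5m≤M))))
            (trans (^-homo-* x (5 ℕ.* m) (M ℕ.∸ 5 ℕ.* m)) (*-congʳ (sym (^-assocʳ x 5 m)))))
          (D-*A (powers m) (A-^ (M ℕ.∸ 5 ℕ.* m) A-x))

  vanishing : ∀ {R} → R Λ.≈ Φ₅²/81z⁴ →
    (∀ ζ → μ5^∞ ζ → (R ⟨ ζ - 1# ⟩≈ 0#) ⇔ PrimitiveRoot 5 ζ) ×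
    ¬ (∀ ζ → μ5^∞ ζ → ¬ (R ⟨ ζ - 1# ⟩≈ 0#))
  vanishing {R} R≈ = equivalence , λ nonvanishing →
    let ζ , Φ≈0 = root-of-Φ in
    nonvanishing ζ (1 , Φ≈0⇒^5≈1 ζ Φ≈0)
      (AtRoot.converges⇒⟨x⟩≈ ζ {R} (AtRoot.primitive⇒converges ζ {R} R≈ (Φ≈0⇒primitive ζ Φ≈0)))
    where
    equivalence : ∀ ζ → μ5^∞ ζ → (R ⟨ ζ - 1# ⟩≈ 0#) ⇔ PrimitiveRoot 5 ζ
    equivalence ζ ζ∈μ = mk⇔ (λ h → converges⇒primitive {R} R≈ ζ∈μ (⟨x⟩≈⇒converges {R} h))
                             (λ prim → converges⇒⟨x⟩≈ {R} (primitive⇒converges {R} R≈ prim))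
      where open AtRoot ζ

-- Eigenvalues of the Grover matrices

module ListSum {R : RawRing 0ℓ 0ℓ} (R-ring : IsCRing R) where
  open RawRing R using (Carrier; _≈_; _+_; _*_; -_; 0#; 1#)
  open CommutativeRing (IsCRing.commutativeRing R-ring)
    hiding (Carrier; _≈_; _+_; _*_; -_; 0#; 1#; rawRing)
  open CommutativeSemigroup +-commutativeSemigroup using (interchange)

  Sum : {A : Set} → (A → Carrier) → List A → Carrier
  Sum f = foldr (λ a y → f a + y) 0#

  Sum-cong : {A : Set} {f g : A → Carrier} → (∀ a → f a ≈ g a) → ∀ as → Sum f as ≈ Sum g as
  Sum-cong f≈g []       = refl
  Sum-cong f≈g (a ∷ as) = +-cong (f≈g a) (Sum-cong f≈g as)

  Sum-+ : {A : Set} (f g : A → Carrier) → ∀ as → Sum (λ a → f a + g a) as ≈ Sum f as + Sum g as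
  Sum-+ f g []       = sym (+-identityʳ 0#)
  Sum-+ f g (a ∷ as) = trans (+-congˡ (Sum-+ f g as)) (interchange _ _ _ _)

  Sum-*ˡ : {A : Set} (b : Carrier) (f : A → Carrier) → ∀ as → Sum (λ a → b * f a) as ≈ b * Sum f as
  Sum-*ˡ b f []       = sym (zeroʳ b)
  Sum-*ˡ b f (a ∷ as) = trans (+-congˡ (Sum-*ˡ b f as)) (sym (distribˡ b _ _))

  Sum-++ : {A : Set} (f : A → Carrier) → ∀ as bs → Sum f (as ++ bs) ≈ Sum f as + Sum f bs
  Sum-++ f []       bs = sym (+-identityˡ _)
  Sum-++ f (a ∷ as) bs = trans (+-congˡ (Sum-++ f as bs)) (sym (+-assoc _ _ _))

  Sum-cartesianProduct : {A B : Set} (f : A × B → Carrier) → ∀ as bs →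
    Sum f (cartesianProduct as bs) ≈ Sum (λ a → Sum (λ b → f (a , b)) bs) as
  Sum-cartesianProduct f []       bs = refl
  Sum-cartesianProduct f (a ∷ as) bs = trans (Sum-++ f (map (a ,_) bs) (cartesianProduct as bs))
    (+-cong (reflexive (List.foldr-map _ (a ,_) 0# bs)) (Sum-cartesianProduct f as bs))

  Sum-zero : {A : Set} {f : A → Carrier} → ∀ {as} → All (λ a → f a ≈ 0#) as → Sum f as ≈ 0#
  Sum-zero []         = refl
  Sum-zero (p ∷ ps) = trans (+-cong p (Sum-zero ps)) (+-identityʳ 0#)

  Sum-single : {A : Set} {f : A → Carrier} {a : A} {as : List A} → Unique as → a ∈ as →
    (∀ b → b ≢ a → f b ≈ 0#) → Sum f as ≈ f a
  Sum-single (a∉as ∷ _) (here ≡.refl) f≈0 =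
    trans (+-congˡ (Sum-zero (All.map (λ a≢b → f≈0 _ (a≢b ∘ ≡.sym)) a∉as))) (+-identityʳ _)
  Sum-single (b∉as ∷ uniq) (there a∈as) f≈0 =
    trans (+-cong (f≈0 _ (All.lookup b∉as a∈as)) (Sum-single uniq a∈as f≈0)) (+-identityˡ _)

-- Degrees and Grover entries on the layers

module _ {A B : Set} {P : Pred (A × B) 0ℓ} (P? : Decidable P) where

  length-filter-none : ∀ a {bs} → All (λ b → ¬ P (a , b)) bs → length (filter P? (map (a ,_) bs)) ≡ 0
  length-filter-none a []                   = ≡.refl
  length-filter-none a (_∷_ {x = b} ¬p ¬ps) =
    ≡.trans (cong length (List.filter-reject P? ¬p)) (length-filter-none a ¬ps)

  length-filter-single : ∀ a {b bs} → Unique bs → b ∈ bs → P (a , b) → (∀ c → c ≢ b → ¬ P (a , c)) →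
    length (filter P? (map (a ,_) bs)) ≡ 1
  length-filter-single a (b∉bs ∷ _) (here ≡.refl) p ¬p = ≡.trans (cong length (List.filter-accept P? p))
    (cong suc (length-filter-none a (All.map (λ b≢c → ¬p _ (b≢c ∘ ≡.sym)) b∉bs)))
  length-filter-single a (c∉bs ∷ uniq) (there b∈bs) p ¬p =
    ≡.trans (cong length (List.filter-reject P? (¬p _ (All.lookup c∉bs b∈bs))))
      (length-filter-single a uniq b∈bs p ¬p)

  length-filter-cartesianProduct : ∀ as {b bs} → Unique bs → b ∈ bs →
    (∀ a → P (a , b)) → (∀ a c → c ≢ b → ¬ P (a , c)) →
    length (filter P? (cartesianProduct as bs)) ≡ length as
  length-filter-cartesianProduct []       uniq b∈bs p ¬p = ≡.refl
  length-filter-cartesianProduct (a ∷ as) {bs = bs} uniq b∈bs p ¬p = ≡.trans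
    (cong length (List.filter-++ P? (map (a ,_) bs) (cartesianProduct as bs)))
    (≡.trans (List.length-++ (filter P? (map (a ,_) bs)))
      (cong₂ ℕ._+_ (length-filter-single a uniq b∈bs (p a) (¬p a))
                   (length-filter-cartesianProduct as uniq b∈bs p ¬p)))

module _ (X : SymmetricDigraph) where
  open SymmetricDigraph X

  Grover-≢ : ∀ e f → t f ≢ o e → Grover X e f ≡ 0ℚ
  Grover-≢ e f t≢o = cong (λ b → if b then 2/_ X (degree (t f)) ℚ.- (if does (f ≟ₑ bar e) then 1ℚ else 0ℚ) else 0ℚ)
    (dec-false (t f ≟ᵥ o e) t≢o)

  Grover-≡ : ∀ e f → t f ≡ o e →
    Grover X e f ≡ 2/_ X (degree (t f)) ℚ.- (if does (f ≟ₑ bar e) then 1ℚ else 0ℚ)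
  Grover-≡ e f t≡o = cong (λ b → if b then 2/_ X (degree (t f)) ℚ.- (if does (f ≟ₑ bar e) then 1ℚ else 0ℚ) else 0ℚ)
    (dec-true (t f ≟ᵥ o e) t≡o)

module BouquetLayer (n : ℕ) where
  N : ℕ
  N = 5 ℕ.^ n

  open SymmetricDigraph bouquet using (E; edges; edges-unique; edges-complete; bar; bar-involutive; _≟ₑ_) public
  open Voltage bouquetVoltage using (α; α-bar) public
  module L = SymmetricDigraph (bouquetLayer n)

  -- The only h for which the edge (c, h) ends at (tt, g). Hence a row of the Grover matrix at (b,
  -- g) has at most one non-zero entry for each base edge c.
  predecessor : Fin N → E → Fin N
  predecessor g c = _⊞_ n g (α (bar c))

  predecessor-⊞ : ∀ g c → _⊞_ n (predecessor g c) (α c) ≡ g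
  predecessor-⊞ g c = ⊞-inverse n g (α (bar c)) (α c)
    (≡.subst (λ d → α d ≈₅ -₅ α (bar c)) (bar-involutive c) (α-bar (bar c)))

  predecessor-unique : ∀ g c h → _⊞_ n h (α c) ≡ g → h ≡ predecessor g c
  predecessor-unique g c h eq = ≡.trans (≡.sym (⊞-inverse n h (α c) (α (bar c)) (α-bar c)))
    (cong (λ g → _⊞_ n g (α (bar c))) eq)

  -- The edge (e, h) starts at (tt, h), so each of the six directed base edges contributes exactly
  -- one edge at (tt, g).
  degree≡6 : ∀ g → L.degree (tt , g) ≡ 6
  degree≡6 g = length-filter-cartesianProduct (λ e → L.o e L.≟ᵥ (tt , g)) edges (allFin⁺ N) (∈-allFin g)
    (λ _ → ≡.refl) (λ _ c c≢g eq → c≢g (cong proj₂ eq))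

  δ : E → E → ℚ
  δ b c = if does (c ≟ₑ bar b) then 1ℚ else 0ℚ

  Grover-predecessor : ∀ b g c → Grover (bouquetLayer n) (b , g) (c , predecessor g c) ≡ + 2 ℚ./ 6 ℚ.- δ b c
  Grover-predecessor b g c = ≡.trans
    (Grover-≡ (bouquetLayer n) (b , g) (c , predecessor g c) (cong (tt ,_) (predecessor-⊞ g c)))
    (cong₂ (λ d β → 2/_ (bouquetLayer n) d ℚ.- (if β then 1ℚ else 0ℚ))
      (degree≡6 (_⊞_ n (predecessor g c) (α c))) same)
    where
    -- If c = bar b, the fibre component of the predecessor is that of `L.bar (b , g)`
    -- automatically, so comparing edges of the layer amounts to comparing base edges.
    same-cases : (d : Dec (c ≡ bar b)) → does ((c , predecessor g c) L.≟ₑ L.bar (b , g)) ≡ does d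
    same-cases (yes eq) = dec-true ((c , predecessor g c) L.≟ₑ L.bar (b , g))
      (cong₂ _,_ eq (cong (λ d → _⊞_ n g (α d)) (≡.trans (cong bar eq) (bar-involutive b))))
    same-cases (no c≢b̄) = dec-false ((c , predecessor g c) L.≟ₑ L.bar (b , g)) (c≢b̄ ∘ cong proj₁)
    same : does ((c , predecessor g c) L.≟ₑ L.bar (b , g)) ≡ does (c ≟ₑ bar b)
    same = same-cases (c ≟ₑ bar b)

  Grover-other : ∀ b g c h → h ≢ predecessor g c → Grover (bouquetLayer n) (b , g) (c , h) ≡ 0ℚ
  Grover-other b g c h h≢ = Grover-≢ (bouquetLayer n) (b , g) (c , h)
    λ eq → h≢ (predecessor-unique g c h (cong proj₂ eq))

-- Polynomial identities behind the eigenvectors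

module EigenIdentities {R : RawRing 0ℓ 0ℓ} (R-ring : IsCRing R) {ψ : ℤ₅ → RawRing.Carrier R}
                       (ψ-hom : IsHom ℤ₅-ring R ψ) where
  open RawRing R using (Carrier; _≈_; _+_; _*_; -_; 0#; 1#)
  open CommutativeRing (IsCRing.commutativeRing R-ring)
    hiding (Carrier; _≈_; _+_; _*_; -_; 0#; 1#; rawRing)
  open ℤ₅-Algebra R-ring ψ-hom
  open FifthPowers R-ring ψ-hom
  open ≈-Reasoning setoid

  F : Carrier → Carrier → Carrier
  F A c = A * A + k 1ℤ + - (t * (c + k (+ 4)) * A)

  -- For a fifth root of unity w these are w + w⁻¹ and w² + w⁻², with inverses written as positive
  -- powers. If w is primitive they are the two roots of c² + c - 1.
  c₁ c₂ : Carrier → Carrier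
  c₁ w = w + w * (w * (w * w))
  c₂ w = w * w + w * (w * w)

  c₁+c₂ : ∀ w → Φ w ≈ k 0ℤ → c₁ w + c₂ w ≈ k -[1+ 0 ]
  c₁+c₂ w Φ≈0 = reduce (sym Φ≈0) (solve 1 (λ w →
    w :+ w :* (w :* (w :* w)) :+ (w :* w :+ w :* (w :* w)) :=
    con -[1+ 0 ] :+ (con 1ℤ :+ w :+ w :* w :+ w :* (w :* w) :+ w :* w :* (w :* w) :- con 0ℤ) :* con 1ℤ) refl w)

  c₁*c₂ : ∀ w → Φ w ≈ k 0ℤ → c₁ w * c₂ w ≈ k -[1+ 0 ]
  c₁*c₂ w Φ≈0 = reduce (sym Φ≈0) (solve 1 (λ w →
    (w :+ w :* (w :* (w :* w))) :* (w :* w :+ w :* (w :* w)) :=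
    con -[1+ 0 ] :+ (con 1ℤ :+ w :+ w :* w :+ w :* (w :* w) :+ w :* w :* (w :* w) :- con 0ℤ) :*
      (con 1ℤ :- w :+ w :* (w :* w))) refl w)

  -- The product is symmetric in c and d, so only c + d = cd = -1 enters. The coefficient of A²
  -- comes out as 2 + 11t², which is 29t² by 9t² = 1.
  P≈FF : ∀ A c d → c + d ≈ k -[1+ 0 ] → c * d ≈ k -[1+ 0 ] → F A c * F A d ≈ P A
  P≈FF A c d c+d cd = reduce c+d (reduce cd (reduce 3t≈1 (solve 4 (λ A c d t →
    (A :* A :+ con 1ℤ :- t :* (c :+ con (+ 4)) :* A) :* (A :* A :+ con 1ℤ :- t :* (d :+ con (+ 4)) :* A) :=
    con 1ℤ :+ A :* (:- (con (+ 7) :* t) :+ A :* (con (+ 29) :* (t :* t) :+ A :* (:- (con (+ 7) :* t) :+ A :* con 1ℤ)))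
    :+ (con -[1+ 0 ] :- (c :+ d)) :* (t :* A :* (A :* A :+ con 1ℤ) :- con (+ 4) :* (t :* t) :* (A :* A))
    :+ (con -[1+ 0 ] :- c :* d) :* :- (t :* t :* (A :* A))
    :+ (con 1ℤ :- con (+ 3) :* t) :* (con (+ 2) :* (A :* A) :* (con 1ℤ :+ con (+ 3) :* t))) refl A c d t)))

  -- P(A) = 1 + A q(A) because the constant term is 1, so -q(A) inverts A at a root.
  A⁻¹ : Carrier → Carrier
  A⁻¹ A = - (- (k (+ 7) * t) + A * (k (+ 29) * (t * t) + A * (- (k (+ 7) * t) + A * k 1ℤ)))

  A*A⁻¹ : ∀ A → P A ≈ k 0ℤ → A * A⁻¹ A ≈ k 1ℤ
  A*A⁻¹ A P≈0 = reduce P≈0 (solve 2 (λ A t →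
    let q = :- (con (+ 7) :* t) :+ A :* (con (+ 29) :* (t :* t) :+ A :* (:- (con (+ 7) :* t) :+ A :* con 1ℤ)) in
    A :* :- q := con 1ℤ :+ (con 0ℤ :- (con 1ℤ :+ A :* q)) :* con 1ℤ) refl A t)

  -- (c - d)² = (c + d)² - 4cd = 5.
  F-F-invertible : ∀ A c d v → c + d ≈ k -[1+ 0 ] → c * d ≈ k -[1+ 0 ] → P A ≈ k 0ℤ → k (+ 5) * v ≈ k 1ℤ →
    (F A c + - F A d) * ((d + - c) * (k (+ 3) * v * A⁻¹ A)) ≈ k 1ℤ
  F-F-invertible A c d v c+d cd P≈0 5v = begin
    (F A c + - F A d) * ((d + - c) * (k (+ 3) * v * A⁻¹ A))
      ≈⟨ reduce c+d (reduce cd (solve 6 (λ A c d v t i →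
           ((A :* A :+ con 1ℤ :- t :* (c :+ con (+ 4)) :* A) :- (A :* A :+ con 1ℤ :- t :* (d :+ con (+ 4)) :* A)) :*
             ((d :- c) :* (con (+ 3) :* v :* i)) :=
           (con (+ 3) :* t) :* (con (+ 5) :* v) :* (A :* i)
           :+ (con -[1+ 0 ] :- (c :+ d)) :* ((con 1ℤ :- c :- d) :* (con (+ 3) :* t :* v :* A :* i))
           :+ (con -[1+ 0 ] :- c :* d) :* (con (+ 4) :* (con (+ 3) :* t :* v :* A :* i))) refl A c d v t (A⁻¹ A))) ⟩
    (k (+ 3) * t) * (k (+ 5) * v) * (A * A⁻¹ A)
      ≈⟨ *-cong (*-cong 3t≈1 5v) (A*A⁻¹ A P≈0) ⟩
    k 1ℤ * k 1ℤ * k 1ℤ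
      ≈⟨ solve 0 (con 1ℤ :* con 1ℤ :* con 1ℤ := con 1ℤ) refl ⟩
    k 1ℤ ∎

  -- The quotient of P by A - 1. The remainder is P(1) = 5/9, so at a root the product with A - 1 is
  -- -5/9; the missing factor -9/5 is supplied in `A-1-invertible`.
  [A-1]⁻¹ : Carrier → Carrier
  [A-1]⁻¹ A = A * A * A + (k 1ℤ + - (k (+ 7) * t)) * (A * A) +
    (k 1ℤ + - (k (+ 7) * t) + k (+ 29) * (t * t)) * A + (k 1ℤ + - (k (+ 14) * t) + k (+ 29) * (t * t))

  A-1-invertible : ∀ A v → P A ≈ k 0ℤ → k (+ 5) * v ≈ k 1ℤ →
    (A + - k 1ℤ) * ([A-1]⁻¹ A * (k -[1+ 8 ] * v)) ≈ k 1ℤ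
  A-1-invertible A v P≈0 5v = reduce P≈0 (reduce 3t≈1 (reduce 5v (solve 3 (λ A v t →
    (A :- con 1ℤ) :* ((A :* A :* A :+ (con 1ℤ :- con (+ 7) :* t) :* (A :* A) :+
      (con 1ℤ :- con (+ 7) :* t :+ con (+ 29) :* (t :* t)) :* A :+ (con 1ℤ :- con (+ 14) :* t :+ con (+ 29) :* (t :* t)))
      :* (con -[1+ 8 ] :* v)) :=
    con 1ℤ
    :+ (con 0ℤ :- (con 1ℤ :+ A :* (:- (con (+ 7) :* t) :+ A :* (con (+ 29) :* (t :* t) :+ A :* (:- (con (+ 7) :* t) :+ A :* con 1ℤ)))))
       :* (con (+ 9) :* v)
    :+ (con 1ℤ :- con (+ 3) :* t) :*
         (con (+ 9) :* v :* (con (+ 2) :* (con 1ℤ :- con (+ 4) :* t)) :- (con 1ℤ :+ con (+ 3) :* t) :* (con (+ 5) :* v))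
    :+ (con 1ℤ :- con (+ 5) :* v) :* :- con 1ℤ) refl A v t)))

  -- Replacing w by w² exchanges the two periods. Thus an eigenvector built from `c₁` also serves
  -- the factor with `c₂`.
  c₁[w²] : ∀ w → p₅ w ≈ k 1ℤ → c₁ (w * w) ≈ c₂ w
  c₁[w²] w p = reduce p (solve 1 (λ w →
    w :* w :+ w :* w :* (w :* w :* (w :* w :* (w :* w))) :=
    w :* w :+ w :* (w :* w) :+ (con 1ℤ :- w :* (w :* (w :* (w :* w)))) :* :- (w :* (w :* w))) refl w)

  p₅[w²] : ∀ w → p₅ w ≈ k 1ℤ → p₅ (w * w) ≈ k 1ℤ
  p₅[w²] w p = reduce p (solve 1 (λ w →
    w :* w :* (w :* w :* (w :* w :* (w :* w :* (w :* w)))) :=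
    con 1ℤ :+ (con 1ℤ :- w :* (w :* (w :* (w :* w)))) :* :- (con 1ℤ :+ w :* (w :* (w :* (w :* w))))) refl w)

module Eigenvalues (Ω : AlgebraicClosureOfℚ₅) where
  open AlgebraicClosureOfℚ₅ Ω
  open Closure Ω
  open CommutativeRing Ω-commutativeRing
    hiding (Carrier; _≈_; _+_; _*_; -_; _-_; 0#; 1#; rawRing; ring)
  open EigenIdentities Ω-isCRing ι-hom
  open ListSum Ω-isCRing
  open ≈-Reasoning setoid
  private
    module fromℚ = Morphism.IsRingHomomorphism fromℚ-homo

  r : Carrier
  r = fromℚ (+ 2 ℚ./ 6)

  -- 1/3 reaches Ω by two routes, through ℚ for the Grover entries and through ℤ₅ for `P₅`. Both
  -- images are inverse to 3.
  r≈t : r ≈ t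
  r≈t = begin
    r                       ≈⟨ *-identityˡ r ⟨
    1# * r                  ≈⟨ *-congʳ (trans 3t≈1 k.1#-homo) ⟨
    k (+ 3) * t * r         ≈⟨ solve 2 (λ t r → con (+ 3) :* t :* r := t :* (r :+ (r :+ r))) refl t r ⟩
    t * (r + (r + r))       ≈⟨ *-congˡ (trans (+-congˡ (sym (fromℚ.+-homo (+ 2 ℚ./ 6) (+ 2 ℚ./ 6))))
                                 (sym (fromℚ.+-homo (+ 2 ℚ./ 6) (+ 2 ℚ./ 6 ℚ.+ + 2 ℚ./ 6)))) ⟩
    t * fromℚ 1ℚ            ≈⟨ trans (*-congˡ fromℚ.1#-homo) (*-identityʳ t) ⟩
    t                       ∎

  module Eigenvector (A ζ : Carrier) (ζ^5≈1 : ζ ^ 5 ≈ 1#) (F≈0 : F A (c₁ ζ) ≈ 0#) (n : ℕ) where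
    open BouquetLayer (suc n)

    -- The value ζ^α(c) of the character on the voltage, with ζ⁻¹ written as ζ⁴.
    χ : E → Carrier
    χ (0F , false) = ζ
    χ (0F , true)  = ζ * (ζ * (ζ * ζ))
    χ (1F , _)     = k 1ℤ
    χ (2F , _)     = k 1ℤ

    p₅ζ≈1 : p₅ ζ ≈ k 1ℤ
    p₅ζ≈1 = ^5≈1⇒p₅≈1 ζ^5≈1

    ψ : Fin N → Carrier
    ψ g = ζ ^ toℕ g

    ζ^N≈1 : ζ ^ N ≈ 1#
    ζ^N≈1 = trans (sym (^-assocʳ ζ 5 (5 ℕ.^ n))) (1^ (5 ℕ.^ n) ζ^5≈1)
      where
      1^ : ∀ m {y} → y ≈ 1# → y ^ m ≈ 1#
      1^ zero    p = refl
      1^ (suc m) p = trans (*-cong p (1^ m p)) (*-identityˡ 1#)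

    private instance
      nonZero-N : NonZero N
      nonZero-N = ℕ.m^n≢0 5 (suc n)

    ζ^% : ∀ m → ζ ^ (m ℕ.% N) ≈ ζ ^ m
    ζ^% m = sym (begin
      ζ ^ m
        ≈⟨ reflexive (cong (ζ ^_) (ℕ.m≡m%n+[m/n]*n m N)) ⟩
      ζ ^ (m ℕ.% N ℕ.+ m ℕ./ N ℕ.* N)
        ≈⟨ ^-homo-* ζ (m ℕ.% N) (m ℕ./ N ℕ.* N) ⟩
      ζ ^ (m ℕ.% N) * ζ ^ (m ℕ./ N ℕ.* N)
        ≈⟨ *-congˡ (reflexive (cong (ζ ^_) (ℕ.*-comm (m ℕ./ N) N))) ⟩
      ζ ^ (m ℕ.% N) * ζ ^ (N ℕ.* (m ℕ./ N))
        ≈⟨ *-congˡ (trans (sym (^-assocʳ ζ N (m ℕ./ N))) (1^ (m ℕ./ N))) ⟩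
      ζ ^ (m ℕ.% N) * 1#
        ≈⟨ *-identityʳ _ ⟩
      ζ ^ (m ℕ.% N) ∎)
      where
      1^ : ∀ m → (ζ ^ N) ^ m ≈ 1#
      1^ zero    = refl
      1^ (suc m) = trans (*-cong ζ^N≈1 (1^ m)) (*-identityˡ 1#)

    -- The representative may be reduced modulo N since ζ^N = 1. The residue of y is required to be
    -- a natural number m so that it can serve as an exponent.
    ψ-⊞ : ∀ g y m → residue y (suc n) ≡ + m → ψ (_⊞_ (suc n) g y) ≈ ψ g * ζ ^ m
    ψ-⊞ g y m eq = begin
      ζ ^ toℕ (_⊞_ (suc n) g y)
        ≈⟨ reflexive (cong (ζ ^_) toℕ-⊞) ⟩
      ζ ^ ((toℕ g ℕ.+ m) ℕ.% N)
        ≈⟨ ζ^% (toℕ g ℕ.+ m) ⟩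
      ζ ^ (toℕ g ℕ.+ m)
        ≈⟨ ^-homo-* ζ (toℕ g) m ⟩
      ζ ^ toℕ g * ζ ^ m ∎
      where
      toℕ-⊞ : toℕ (_⊞_ (suc n) g y) ≡ (toℕ g ℕ.+ m) ℕ.% N
      toℕ-⊞ = ≡.trans (Fin.toℕ-fromℕ< _) (cong (λ a → (+ toℕ g ℤ.+ a) %ℕ N) eq)

    ψ-α : ∀ g c → ψ (_⊞_ (suc n) g (α c)) ≈ ψ g * χ c
    ψ-α g (0F , false) = trans (ψ-⊞ g (α (0F , false)) 1 ≡.refl) (*-congˡ (*-identityʳ ζ))
    -- Here the residue is -1, which is no exponent. Instead, h lies one step of s₀ before g, so ψ g
    -- = ψ h ζ, and multiplying by ζ⁴ gives the claim.
    ψ-α g (0F , true)  = begin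
      ψ h                                    ≈⟨ *-identityʳ _ ⟨
      ψ h * 1#                               ≈⟨ *-congˡ (trans p₅ζ≈1 k.1#-homo) ⟨
      ψ h * (ζ * (ζ * (ζ * (ζ * ζ))))        ≈⟨ *-assoc _ _ _ ⟨
      ψ h * ζ * (ζ * (ζ * (ζ * ζ)))          ≈⟨ *-congʳ (ψ-α h (0F , false)) ⟨
      ψ (_⊞_ (suc n) h (α (0F , false))) * (ζ * (ζ * (ζ * ζ)))
        ≈⟨ *-congʳ (reflexive (cong ψ (predecessor-⊞ g (0F , false)))) ⟩
      ψ g * (ζ * (ζ * (ζ * ζ)))              ∎
      where h = _⊞_ (suc n) g (α (0F , true))
    ψ-α g (1F , false) = trans (ψ-⊞ g (α (1F , false)) 0 ≡.refl) (*-congˡ (sym k.1#-homo))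
    ψ-α g (1F , true)  = trans (ψ-⊞ g (α (1F , true)) 0 ≡.refl) (*-congˡ (sym k.1#-homo))
    ψ-α g (2F , false) = trans (ψ-⊞ g (α (2F , false)) 0 ≡.refl) (*-congˡ (sym k.1#-homo))
    ψ-α g (2F , true)  = trans (ψ-⊞ g (α (2F , true)) 0 ≡.refl) (*-congˡ (sym k.1#-homo))

    -- The ansatz v(e , g) = ζᵍ w(e) reduces Uv = Av to a w(e) + χ(e) w(ē) = const.
    v : E × Fin N → Carrier
    v (c , g) = ψ g * (A + - χ c)

    y : E → Carrier
    y c = χ (bar c) * (A + - χ c)

    v-predecessor : ∀ g c → v (c , predecessor g c) ≈ ψ g * y c
    v-predecessor g c = trans (*-congʳ (ψ-α g (bar c))) (*-assoc _ _ _)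

    δ′ : E → E → Carrier
    δ′ b c = if does (c ≟ₑ bar b) then k 1ℤ else k 0ℤ

    fromℚ-δ : ∀ b c → fromℚ (+ 2 ℚ./ 6 ℚ.- δ b c) ≈ r + - δ′ b c
    fromℚ-δ b c = trans (fromℚ.+-homo (+ 2 ℚ./ 6) (ℚ.- δ b c))
      (+-congˡ (trans (fromℚ.-‿homo (δ b c)) (-‿cong (cases (does (c ≟ₑ bar b))))))
      where
      cases : ∀ β → fromℚ (if β then 1ℚ else 0ℚ) ≈ (if β then k 1ℤ else k 0ℤ)
      cases true  = trans fromℚ.1#-homo (sym k.1#-homo)
      cases false = trans fromℚ.0#-homo (sym k.0#-homo)

    row : ∀ b g → Sum (λ f → fromℚ (Grover (bouquetLayer (suc n)) (b , g) f) * v f) L.edges ≈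
                  Sum (λ c → (r + - δ′ b c) * (ψ g * y c)) edges
    row b g = trans (Sum-cartesianProduct _ edges (allFin N)) (Sum-cong single edges)
      where
      single : ∀ c → Sum (λ h → fromℚ (Grover (bouquetLayer (suc n)) (b , g) (c , h)) * v (c , h)) (allFin N) ≈
                     (r + - δ′ b c) * (ψ g * y c)
      single c = trans
        (Sum-single (allFin⁺ N) (∈-allFin (predecessor g c)) λ h h≢ →
          trans (*-congʳ (trans (fromℚ.⟦⟧-cong (Grover-other b g c h h≢)) fromℚ.0#-homo)) (zeroˡ _))
        (*-cong (trans (fromℚ.⟦⟧-cong (Grover-predecessor b g c)) (fromℚ-δ b c)) (v-predecessor g c))

    -- The sum of y is (c₁(ζ) + 4)A - 6. Times 1/3 this is A² + 1 - 2 by F(A, c₁(ζ)) = 0, which is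
    -- where the spectral equation enters.
    r*Σy : r * Sum y edges ≈ A * A + - k 1ℤ
    r*Σy = trans (*-cong r≈t (+-congˡ (+-congˡ (+-congˡ (+-congˡ (+-congˡ (+-identityʳ _)))))))
      (reduce (trans F≈0 (sym k.0#-homo)) (reduce p₅ζ≈1 (reduce 3t≈1
      (solve 3 (λ A ζ t →
        let ζ⁴  = ζ :* (ζ :* (ζ :* ζ))
            one = con 1ℤ :* (A :- con 1ℤ)
        in
        t :* (ζ⁴ :* (A :- ζ) :+ (ζ :* (A :- ζ⁴) :+ (one :+ (one :+ (one :+ one))))) :=
        A :* A :- con 1ℤ
        :+ (con 0ℤ :- (A :* A :+ con 1ℤ :- t :* (ζ :+ ζ⁴ :+ con (+ 4)) :* A)) :* con 1ℤ
        :+ (con 1ℤ :- ζ :* ζ⁴) :* (con (+ 2) :* t)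
        :+ (con 1ℤ :- con (+ 3) :* t) :* con (+ 2)) refl A ζ t))))

    χ-χbar : ∀ c → χ c * χ (bar c) ≈ k 1ℤ
    χ-χbar (0F , false) = p₅ζ≈1
    χ-χbar (0F , true)  = trans (*-comm _ _) p₅ζ≈1
    χ-χbar (1F , _)     = trans (*-congˡ k.1#-homo) (*-identityʳ _)
    χ-χbar (2F , _)     = trans (*-congˡ k.1#-homo) (*-identityʳ _)

    Σδy : ∀ b → Sum (λ c → δ′ b c * y c) edges ≈ y (bar b)
    Σδy b = trans
      (Sum-single edges-unique (edges-complete (bar b)) λ c c≢b̄ → begin
        δ′ b c * y c   ≈⟨ *-congʳ (reflexive (cong (λ β → if β then k 1ℤ else k 0ℤ) (dec-false (c ≟ₑ bar b) c≢b̄))) ⟩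
        k 0ℤ * y c     ≈⟨ trans (*-congʳ k.0#-homo) (zeroˡ _) ⟩
        0#             ∎)
      (begin
        δ′ b (bar b) * y (bar b)
          ≈⟨ *-congʳ (reflexive (cong (λ β → if β then k 1ℤ else k 0ℤ) (dec-true (bar b ≟ₑ bar b) ≡.refl))) ⟩
        k 1ℤ * y (bar b)
          ≈⟨ trans (*-congʳ k.1#-homo) (*-identityˡ _) ⟩
        y (bar b) ∎)

    -- The constant part of the row gives A² - 1, the backtracking part subtracts χ(b)(A - χ(bar b))
    -- = χ(b)A - 1, and A(A - χ(b)) remains.
    eigen-equation : ∀ e →
      Sum (λ f → fromℚ (Grover (bouquetLayer (suc n)) e f) * v f) L.edges ≈ A * v e
    eigen-equation (b , g) = begin
      Sum (λ f → fromℚ (Grover (bouquetLayer (suc n)) (b , g) f) * v f) L.edges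
        ≈⟨ row b g ⟩
      Sum (λ c → (r + - δ′ b c) * (ψ g * y c)) edges
        ≈⟨ Sum-cong (λ c → solve 4 (λ r d z y → (r :- d) :* (z :* y) := z :* r :* y :+ :- z :* (d :* y))
             refl r (δ′ b c) (ψ g) (y c)) edges ⟩
      Sum (λ c → ψ g * r * y c + - ψ g * (δ′ b c * y c)) edges
        ≈⟨ Sum-+ (λ c → ψ g * r * y c) (λ c → - ψ g * (δ′ b c * y c)) edges ⟩
      Sum (λ c → ψ g * r * y c) edges + Sum (λ c → - ψ g * (δ′ b c * y c)) edges
        ≈⟨ +-cong (trans (Sum-*ˡ (ψ g * r) y edges) (trans (*-assoc _ _ _) (*-congˡ r*Σy)))
                  (trans (Sum-*ˡ (- ψ g) (λ c → δ′ b c * y c) edges) (*-congˡ (Σδy b))) ⟩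
      ψ g * (A * A + - k 1ℤ) + - ψ g * (χ (bar (bar b)) * (A + - χ (bar b)))
        ≈⟨ +-congˡ (*-congˡ (*-congʳ (reflexive (cong χ (bar-involutive b))))) ⟩
      ψ g * (A * A + - k 1ℤ) + - ψ g * (χ b * (A + - χ (bar b)))
        ≈⟨ reduce (χ-χbar b) (solve 4 (λ z A c d →
             z :* (A :* A :- con 1ℤ) :+ :- z :* (c :* (A :- d)) :=
             A :* (z :* (A :- c)) :+ (con 1ℤ :- c :* d) :* :- z) refl (ψ g) A (χ b) (χ (bar b))) ⟩
      A * v (b , g) ∎

  invertible⇒#0 : ∀ {y i} → y * i ≈ 1# → y # 0#
  invertible⇒#0 {y} {i} yi≈1 = invertible⇒# (i , trans (*-comm _ _) right , right)
    where
    right : (y - 0#) * i ≈ 1#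
    right = trans (*-congʳ (trans (+-congˡ (RingProperties.-0#≈0# (CommutativeRing.ring Ω-commutativeRing))) (+-identityʳ y))) yi≈1

  5⅕≈1 : k (+ 5) * ⅕ ≈ k 1ℤ
  5⅕≈1 = 1→k 5*⅕≈1

  -- An eigenvector must have an entry apart from 0. On the loop s₁, whose voltage is 0, the entry
  -- over g = 0 is A - 1, and it is invertible because P₅(1) = 5/9 is.
  eigenvalue : ∀ A → P A ≈ k 0ℤ → ∀ ζ → ζ ^ 5 ≈ 1# → F A (c₁ ζ) ≈ 0# →
               ∀ n → IsEigenvalueOfGrover Ω (bouquetLayer (suc n)) A
  eigenvalue A P≈0 ζ ζ^5≈1 F≈0 n = v , (((1F , false) , g₀) , invertible⇒#0 (begin
    ζ ^ toℕ g₀ * (A + - k 1ℤ) * i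
      ≈⟨ *-congʳ (*-congʳ (reflexive (cong (ζ ^_) g₀≡0))) ⟩
    1# * (A + - k 1ℤ) * i
      ≈⟨ *-congʳ (*-identityˡ _) ⟩
    (A + - k 1ℤ) * i
      ≈⟨ k→1 (A-1-invertible A ⅕ P≈0 5⅕≈1) ⟩
    1# ∎)) , eigen-equation
    where
    open Eigenvector A ζ ζ^5≈1 F≈0 n
    i = [A-1]⁻¹ A * (k -[1+ 8 ] * ⅕)
    -- The zero of ℤ/5^(n + 1): the modulus does not reduce to a successor, so this element is
    -- obtained as a residue.
    g₀ = mod5^ (suc n) 0ℤ
    g₀≡0 : toℕ g₀ ≡ 0
    g₀≡0 = ≡.trans (Fin.toℕ-fromℕ< _) (ℕ.m<n⇒m%n≡m {{ℕ.m^n≢0 5 (suc n)}} (ℕ.m^n>0 5 (suc n)))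

  -- F A (c₁ ω) and F A (c₂ ω) multiply to P A = 0 and have an invertible difference, so one of them vanishes.
  root⇒eigenvalue : ∀ A → IsRoot P₅ A → ∀ n → IsEigenvalueOfGrover Ω (bouquetLayer (suc n)) A
  root⇒eigenvalue A P₅≈0 = from (proj₁ root-of-Φ) (proj₂ root-of-Φ)
    where
    P≈0 : P A ≈ k 0ℤ
    P≈0 = trans (sym (eval-P₅ A)) (trans P₅≈0 (sym k.0#-homo))

    from : ∀ ω → Φ ω ≈ 0# → ∀ n → IsEigenvalueOfGrover Ω (bouquetLayer (suc n)) A
    from ω Φ≈0 = choose (#-cotrans F₁#F₂ 0#)
      where
      Φ≈k0 = trans Φ≈0 (sym k.0#-homo)
      F₁ = F A (c₁ ω)
      F₂ = F A (c₂ ω)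
      ω^5≈1 = Φ≈0⇒^5≈1 ω Φ≈0

      F₁F₂≈0 : F₁ * F₂ ≈ 0#
      F₁F₂≈0 = trans (P≈FF A (c₁ ω) (c₂ ω) (c₁+c₂ ω Φ≈k0) (c₁*c₂ ω Φ≈k0)) (trans P≈0 k.0#-homo)

      F₁#F₂ : F₁ # F₂
      F₁#F₂ = invertible⇒# (i , trans (*-comm _ _) right , right)
        where
        i = (c₂ ω + - c₁ ω) * (k (+ 3) * ⅕ * A⁻¹ A)
        right : (F₁ - F₂) * i ≈ 1#
        right = k→1 (F-F-invertible A (c₁ ω) (c₂ ω) ⅕ (c₁+c₂ ω Φ≈k0) (c₁*c₂ ω Φ≈k0) P≈0 5⅕≈1)

      choose : F₁ # 0# ⊎ 0# # F₂ → ∀ n → IsEigenvalueOfGrover Ω (bouquetLayer (suc n)) A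
      choose (inj₁ F₁#0) = eigenvalue A P≈0 (ω * ω)
        (trans (^5≈p₅ (ω * ω)) (k→1 (p₅[w²] ω (^5≈1⇒p₅≈1 ω^5≈1))))
        (trans (+-congˡ (-‿cong (*-congʳ (*-congˡ (+-congʳ (c₁[w²] ω (^5≈1⇒p₅≈1 ω^5≈1)))))))
               (cancel-# F₁#0 F₁F₂≈0))
      choose (inj₂ 0#F₂) = eigenvalue A P≈0 ω ω^5≈1
        (cancel-# (#-sym 0#F₂) (trans (*-comm _ _) F₁F₂≈0))

  roots-are-eigenvalues : ∀ a → IsRoot P₅ a →
    (∀ n → ContainsPrimitiveFifthCharacters n → IsEigenvalueOfGrover Ω (bouquetLayer n) a) ×
    (∀ n → 1 ℕ.≤ n → IsEigenvalueOfGrover Ω (bouquetLayer n) a)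
  roots-are-eigenvalues a root = characters , levels
    where
    levels : ∀ n → 1 ℕ.≤ n → IsEigenvalueOfGrover Ω (bouquetLayer n) a
    levels (suc n) _ = root⇒eigenvalue a root n
    characters : ∀ n → ContainsPrimitiveFifthCharacters n → IsEigenvalueOfGrover Ω (bouquetLayer n) a
    -- At level 0 the only character is trivial: 5⁰ = 1 gives ζ¹ = 1, against primitivity at j = 1.
    characters zero    (ζ , ζ^1≈1 , _ , prim) = contradiction ζ^1≈1 (prim 1 (ℕ.s≤s ℕ.z≤n) (ℕ.s≤s (ℕ.s≤s ℕ.z≤n)))
    characters (suc n) _ = root⇒eigenvalue a root n
proposition7p12 : Polynomial.eval ℤ₅-ring P₅ (fromℤ 1ℤ) ≈₅ fromℤ (+ 5) *₅ ⅑
    × Polynomial.eval ℤ₅-ring P₅ (-₅ fromℤ 1ℤ) ≈₅ fromℤ (+ 89) *₅ ⅑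
    × Coprimeℚ₅[A] P₅ A²-1
    × (∃ λ R → Is-R-X P₅ R)
    × (∀ R → Is-R-X P₅ R →
    R Λ.≈ Φ₅²/81z⁴
    × μ-invariant R 0
    × λ-invariant R 8
    × ((Ω : AlgebraicClosureOfℚ₅) → let open AlgebraicClosureOfℚ₅ Ω in
    (∀ ζ → μ5^∞ ζ → (R ⟨ ζ - 1# ⟩≈ 0#) ⇔ PrimitiveRoot 5 ζ)
    × ¬ (∀ ζ → μ5^∞ ζ → ¬ (R ⟨ ζ - 1# ⟩≈ 0#))))
    × ((Ω : AlgebraicClosureOfℚ₅) → let open AlgebraicClosureOfℚ₅ Ω in
    ∀ a → IsRoot P₅ a →
    (∀ n → ContainsPrimitiveFifthCharacters n → IsEigenvalueOfGrover Ω (bouquetLayer n) a)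
    × (∀ n → 1 ≤ n → IsEigenvalueOfGrover Ω (bouquetLayer n) a))
proposition7p12 =
  P₅[1]≈5/9 , P₅[-1]≈89/9 , Coprimality.P₅-coprime-A²-1 ,
  (Φ₅²/81z⁴ , Φ₅²/81z⁴-isResultant) ,
  (λ R R-res → let R≈ = resultant-unique R R-res in
    R≈ , Invariants.μ≡0 R R≈ , Invariants.λ≡8 R R≈ , λ Ω → Closure.vanishing Ω {R} R≈) ,
  Eigenvalues.roots-are-eigenvalues
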